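{- Let $n\ge 3$ and $k\ge 1$ be integers, and let $C(n,k)$ be the caterpillar defined in the context. Then $$\mathrm{rn}(C(n,k))=\begin{cases}3k+7, & \text{if } n=3,\\ 4k+9, & \text{if } n=4,\\ \tfrac12(n^2+4nk+2n-2k-1), & \text{if } n>3 \text{ is odd},\\ \tfrac12(n^2+4nk+2n-4k-6), & \text{if } n>4 \text{ is even}.\end{cases}$$ In particular, for $T=C(n,k)$, with order $p$ and diameter $d$, one has $\mathrm{rn}(T)=(p-1)(d+\varepsilon(T))-2L(T)+\varepsilon(T)+\xi(T)$.
   Context: A radio labelling of a graph $G$ is a map $f: V(G)\to\{0,1,2,\ldots\}$ with $|f(u)-f(v)| \ge \mathrm{diam}(G)+1-d(u,v)$ for all distinct $u,v\in V(G)$. Its span is $\max\{|f(u)-f(v)|: u,v\in V(G)\}$, and the radio number $\mathrm{rn}(G)$ is the minimum span of a radio labelling of $G$. For $n\ge3$, $k\ge1$, $C(n,k)$ is the tree obtained from a path (spine) $v_1,v_2,\ldots,v_n$ ($v_i$ adjacent to $v_{i+1}$) by attaching leaves as follows: (i) if $n$ is odd, each of $v_1,v_{(n-1)/2},v_{(n+3)/2},v_n$ has exactly $k$ neighbours of degree one, and all other spine vertices have no neighbour of degree one; (ii) if $n$ is even, each of $v_1,v_{(n-2)/2},v_{(n+4)/2},v_n$ has exactly $k$ neighbours of degree one, and all other spine vertices have no neighbour of degree one. (For $n=3,4$ these four vertices reduce to the two vertices $v_1,v_n$.) It has order $n+2k\min\{2,\lfloor (n-1)/2\rfloor\}$ and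 diameter $n+1$. For a tree $T$ with diameter $d$: $W(T)$ is the set of weight centers, i.e. vertices minimizing $\sum_{u\in V(T)}d(u,v)$ over $v$ (one vertex or two adjacent vertices). Put $\varepsilon(T)=2-|W(T)|$, $L(u)=\min\{d(u,x):x\in W(T)\}$ and $L(T)=\sum_{u\in V(T)} L(u)$. Also $S(T)=\{u:L(u)\ge\lceil d/2\rceil\}$ if $|W(T)|=1$ and $S(T)=\{u:L(u)\ge\lfloor d/2\rfloor\}$ if $|W(T)|=2$. Finally $\xi(T)=\lfloor|S(T)|/2\rfloor$ if $|W(T)|=1$, and $\xi(T)=\max\{0,|S(T)|-2\}$ if $|W(T)|=2$. -}

module Defs where

open import Data.Bool.Base using (if_then_else_)
open import Data.Fin.Base as Fin using (Fin; toℕ)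
import Data.Fin.Properties as Fin
open import Data.Integer.Base as ℤ using (ℤ)
open import Data.List.Base using (List; []; _∷_; _++_; map; concatMap; filter; length; allFin; cartesianProductWith)
open import Data.List.Extrema.Nat using (max; min)
open import Data.List.Membership.Propositional using (_∈_; lose)
open import Data.List.Membership.Propositional.Properties
  using (∈-map⁺; ∈-map⁻; ∈-++⁺ˡ; ∈-++⁺ʳ; ∈-allFin; ∈-concat⁺′; ∈-concat⁻′)
open import Data.List.Relation.Binary.Disjoint.Propositional using (Disjoint)
open import Data.List.Relation.Unary.All using (All; all?)
import Data.List.Relation.Unary.All.Properties as All
import Data.List.Relation.Unary.AllPairs as AllPairs
import Data.List.Relation.Unary.AllPairs.Properties as AllPairs
open import Data.List.Relation.Unary.Any using (any?; satisfied)
open import Data.List.Relation.Unary.Unique.Propositional using (Unique)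
import Data.List.Relation.Unary.Unique.Propositional.Properties as Unique
open import Data.Nat.Base
open import Data.Nat.Divisibility using (_∣?_)
open import Data.Nat.ListAction using (sum)
import Data.Nat.Properties as ℕ
open import Data.List.Membership.DecPropositional ℕ._≟_ using (_∈?_)
open import Data.Product.Base using (∃-syntax; _×_; _,_; proj₁; proj₂)
open import Data.Sum.Base using (inj₁; inj₂)
open import Function.Base using (_∘_)
open import Level using (0ℓ)
open import Relation.Binary.Core using (Rel)
open import Relation.Binary.Definitions using (DecidableEquality; Symmetric; Irreflexive)
import Relation.Binary.Definitions as Binary
open import Relation.Binary.PropositionalEquality.Core using (_≡_; _≢_; refl; sym; cong; subst)
open import Relation.Nullary.Decidable using (Dec; yes; no; ⌊_⌋; map′; _×-dec_)
open import Relation.Nullary.Negation using (contradiction)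
open import Relation.Unary using (Decidable)

module _ {V : Set} (_~_ : Rel V 0ℓ) where

  infixr 5 _∷_

  data Walk : ℕ → V → V → Set where
    []  : ∀ {u} → Walk 0 u u
    _∷_ : ∀ {ℓ u v w} → u ~ v → Walk ℓ v w → Walk (suc ℓ) u w

record Graph : Set₁ where
  infix 4 _~_ _≟_ _~?_
  field
    V         : Set
    vertices  : List V
    unique    : Unique vertices
    complete  : ∀ v → v ∈ vertices
    _≟_       : DecidableEquality V
    _~_       : Rel V 0ℓ
    _~?_      : Binary.Decidable _~_
    ~-sym     : Symmetric _~_
    ~-irrefl  : Irreflexive _≡_ _~_
    connected : ∀ u v → ∃[ ℓ ] Walk _~_ ℓ u v

  walk? : ∀ ℓ u v → Dec (Walk _~_ ℓ u v)
  walk? zero u v = map′ (λ { refl → [] }) (λ { [] → refl }) (u ≟ v)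
  walk? (suc ℓ) u v = map′
    (λ p → cons (satisfied p))
    (λ { (e ∷ W) → lose (complete _) (e , W) })
    (any? (λ w → (u ~? w) ×-dec walk? ℓ w v) vertices)
    where
    cons : ∃[ w ] (u ~ w × Walk _~_ ℓ w v) → Walk _~_ (suc ℓ) u v
    cons (_ , e , W) = e ∷ W

least : ∀ {P : ℕ → Set} → Decidable P → ∀ m → P m →
        ∃[ l ] (P l × (∀ j → P j → l ≤ j))
least P? zero    p = 0 , p , λ _ _ → z≤n
least P? (suc m) p with P? 0
... | yes p₀ = 0 , p₀ , λ _ _ → z≤n
... | no ¬p₀ with least (P? ∘ suc) m p
...   | l , pₗ , l-min = suc l , pₗ , λ where
          zero    p₀ → contradiction p₀ ¬p₀
          (suc j) pⱼ → s≤s (l-min j pⱼ)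

module _ (G : Graph) where
  open Graph G

  shortest : ∀ u v → ∃[ l ] (Walk _~_ l u v × (∀ j → Walk _~_ j u v → l ≤ j))
  shortest u v = least (λ ℓ → walk? ℓ u v) (proj₁ (connected u v)) (proj₂ (connected u v))

  dist : V → V → ℕ
  dist u v = proj₁ (shortest u v)

  order : ℕ
  order = length vertices

  maxOverPairs : (V → V → ℕ) → ℕ
  maxOverPairs f = max 0 (cartesianProductWith f vertices vertices)

  diam : ℕ
  diam = maxOverPairs dist

  IsRadioLabelling : (V → ℕ) → Set
  IsRadioLabelling f = ∀ u v → u ≢ v → diam + 1 ∸ dist u v ≤ ∣ f u - f v ∣

  span : (V → ℕ) → ℕ
  span f = maxOverPairs λ u v → ∣ f u - f v ∣

  IsRadioNumber : ℕ → Set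
  IsRadioNumber r = (∃[ f ] (IsRadioLabelling f × span f ≡ r))
                  × (∀ f → IsRadioLabelling f → r ≤ span f)

  weight : V → ℕ
  weight v = sum (map (λ u → dist u v) vertices)

  IsWeightCenter : V → Set
  IsWeightCenter v = All (λ u → weight v ≤ weight u) vertices

  weightCenters : List V
  weightCenters = filter (λ v → all? (λ u → weight v ℕ.≤? weight u) vertices) vertices

  ε : ℤ
  ε = ℤ.+ 2 ℤ.- ℤ.+ length weightCenters

  -- The default value `diam` never matters: there is always a weight center,
  -- and no distance exceeds the diameter.
  level : V → ℕ
  level u = min diam (map (dist u) weightCenters)

  totalLevel : ℕ
  totalLevel = sum (map level vertices)

  -- A tree has one or two weight centers, so in the next two definitions the
  -- second case is that of two weight centers.
  levelBound : ℕ
  levelBound = if length weightCenters ≡ᵇ 1 then ⌈ diam /2⌉ else ⌊ diam /2⌋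

  farVertices : List V
  farVertices = filter (λ u → levelBound ℕ.≤? level u) vertices

  ξ : ℕ
  ξ = if length weightCenters ≡ᵇ 1
      then ⌊ length farVertices /2⌋
      else length farVertices ∸ 2

-- Spine indices here are the 1, …, n of v₁, …, vₙ.  Repetitions (n = 3, 4) are
-- harmless, since only membership in this list is used.
leafBearing : ℕ → List ℕ
leafBearing n = if ⌊ 2 ∣? n ⌋
  then 1 ∷ (n ∸ 2) / 2 ∷ (n + 4) / 2 ∷ n ∷ []
  else 1 ∷ (n ∸ 1) / 2 ∷ (n + 3) / 2 ∷ n ∷ []

module Caterpillar (n k : ℕ) where

  -- `i : Fin n` stands for the spine vertex with index `suc (toℕ i)`.
  leaves : Fin n → ℕ
  leaves i = if ⌊ suc (toℕ i) ∈? leafBearing n ⌋ then k else 0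

  data Vertex : Set where
    spine : Fin n → Vertex
    leaf  : (i : Fin n) → Fin (leaves i) → Vertex

  infix 4 _~_ _~?_ _≟_

  data _~_ : Rel Vertex 0ℓ where
    next : ∀ {i j} → suc (toℕ i) ≡ toℕ j → spine i ~ spine j
    prev : ∀ {i j} → suc (toℕ j) ≡ toℕ i → spine i ~ spine j
    down : ∀ {i x} → spine i ~ leaf i x
    up   : ∀ {i x} → leaf i x ~ spine i

  leavesAt : Fin n → List Vertex
  leavesAt i = map (leaf i) (allFin (leaves i))

  vertices : List Vertex
  vertices = map spine (allFin n) ++ concatMap leavesAt (allFin n)

  complete : ∀ v → v ∈ vertices
  complete (spine i)  = ∈-++⁺ˡ (∈-map⁺ spine (∈-allFin i))
  complete (leaf i x) = ∈-++⁺ʳ (map spine (allFin n))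
    (∈-concat⁺′ (∈-map⁺ (leaf i) (∈-allFin x)) (∈-map⁺ leavesAt (∈-allFin i)))

  unique : Unique vertices
  unique = Unique.++⁺
    (Unique.map⁺ (λ { refl → refl }) (Unique.allFin⁺ n))
    (Unique.concat⁺
      (All.map⁺ (All.tabulate⁺ λ i → Unique.map⁺ (λ { refl → refl }) (Unique.allFin⁺ (leaves i))))
      (AllPairs.map⁺ (AllPairs.map leavesDisjoint (Unique.allFin⁺ n))))
    spineDisjoint
    where
    leavesDisjoint : ∀ {i j} → i ≢ j → Disjoint (leavesAt i) (leavesAt j)
    leavesDisjoint i≢j (p , q) with ∈-map⁻ _ p | ∈-map⁻ _ q
    ... | _ , _ , refl | _ , _ , refl = i≢j refl

    spineDisjoint : Disjoint (map spine (allFin n)) (concatMap leavesAt (allFin n))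
    spineDisjoint (p , q) with ∈-map⁻ spine p | ∈-concat⁻′ (map leavesAt (allFin n)) q
    ... | _ , _ , refl | _ , q′ , r with ∈-map⁻ leavesAt r
    ...   | _ , _ , refl with ∈-map⁻ _ q′
    ...     | _ , _ , ()

  _≟_ : DecidableEquality Vertex
  spine i  ≟ spine j  = map′ (cong spine) (λ { refl → refl }) (i Fin.≟ j)
  spine _  ≟ leaf _ _ = no λ ()
  leaf _ _ ≟ spine _  = no λ ()
  leaf i x ≟ leaf j y with i Fin.≟ j
  ... | no i≢j   = no λ { refl → i≢j refl }
  ... | yes refl = map′ (cong (leaf i)) (λ { refl → refl }) (x Fin.≟ y)

  _~?_ : Binary.Decidable _~_
  spine i ~? spine j with suc (toℕ i) ℕ.≟ toℕ j | suc (toℕ j) ℕ.≟ toℕ i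
  ... | yes p | _     = yes (next p)
  ... | no _  | yes q = yes (prev q)
  ... | no ¬p | no ¬q = no λ { (next p) → ¬p p ; (prev q) → ¬q q }
  spine i  ~? leaf j _ = map′ (λ { refl → down }) (λ { down → refl }) (i Fin.≟ j)
  leaf i _ ~? spine j  = map′ (λ { refl → up }) (λ { up → refl }) (i Fin.≟ j)
  leaf _ _ ~? leaf _ _ = no λ ()

  ~-sym : Symmetric _~_
  ~-sym (next p) = prev p
  ~-sym (prev p) = next p
  ~-sym down     = up
  ~-sym up       = down

  ~-irrefl : Irreflexive _≡_ _~_
  ~-irrefl refl (next p) = ℕ.1+n≢n p
  ~-irrefl refl (prev p) = ℕ.1+n≢n p

  snoc : ∀ {ℓ u v w} → Walk _~_ ℓ u v → v ~ w → Walk _~_ (suc ℓ) u w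
  snoc []      e = e ∷ []
  snoc (d ∷ W) e = d ∷ snoc W e

  spineForward : ∀ ℓ {i j} → ℓ + toℕ i ≡ toℕ j → Walk _~_ ℓ (spine i) (spine j)
  spineForward zero    eq with Fin.toℕ-injective eq
  ... | refl = []
  spineForward (suc ℓ) {i} {j} eq =
    next (sym i′-value) ∷ spineForward ℓ (subst (λ m → ℓ + m ≡ toℕ j) (sym i′-value) shifted)
    where
    shifted : ℓ + suc (toℕ i) ≡ toℕ j
    shifted rewrite ℕ.+-suc ℓ (toℕ i) = eq

    i′<n : suc (toℕ i) < n
    i′<n = ℕ.≤-<-trans (subst (suc (toℕ i) ≤_) shifted (ℕ.m≤n+m _ ℓ)) (Fin.toℕ<n j)

    i′-value : toℕ (Fin.fromℕ< i′<n) ≡ suc (toℕ i)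
    i′-value = Fin.toℕ-fromℕ< i′<n

  reverse : ∀ {ℓ u v} → Walk _~_ ℓ u v → Walk _~_ ℓ v u
  reverse []      = []
  reverse (e ∷ W) = snoc (reverse W) (~-sym e)

  spineConnected : ∀ i j → ∃[ ℓ ] Walk _~_ ℓ (spine i) (spine j)
  spineConnected i j with ℕ.≤-total (toℕ i) (toℕ j)
  ... | inj₁ i≤j = _ , spineForward (toℕ j ∸ toℕ i) (ℕ.m∸n+n≡m i≤j)
  ... | inj₂ j≤i = _ , reverse (spineForward (toℕ i ∸ toℕ j) (ℕ.m∸n+n≡m j≤i))

  connected : ∀ u v → ∃[ ℓ ] Walk _~_ ℓ u v
  connected (spine i)  (spine j)  = spineConnected i j
  connected (spine i)  (leaf j _) = _ , snoc (proj₂ (spineConnected i j)) down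
  connected (leaf i _) (spine j)  = _ , up ∷ proj₂ (spineConnected i j)
  connected (leaf i _) (leaf j _) = _ , up ∷ snoc (proj₂ (spineConnected i j)) down

C : ℕ → ℕ → Graph
C n k = record { Caterpillar n k }

{-# OPTIONS --safe #-}
-- Write n = 1 + 2h + δ with δ ∈ {0, 1}: the weight centers are the spine vertices at
-- positions h and h + δ (counted from 0), and with L the level, D = 2h + 3 = d + ε and
-- κ = 1 + δ one has d(u, v) ≤ L u + L v + δ.
--
-- Lower bound.  List the vertices in the order of a radio labelling f.  Consecutive ones
-- satisfy f y - f x ≥ D - L x - L y.  If y is far (L y = h + 1) and neither neighbour x, z
-- of y in the list is a center, then two of x, y, z lie strictly on the same side of the
-- centers, their distance is at most the sum of their levels minus 2, and f z - f x
-- exceeds the sum of the two bounds by at least κ.  Summing over all triples gives the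
-- bound; ξ comes from the far vertices, up to those at the ends or next to a center.
--
-- Upper bound.  The leaves are labelled in k blocks of period P, one leaf of each kind per
-- block, alternating between the sides; then the spine in the order
-- l₁, r_h, l₂, r_{h-1}, …, l_h, r₁, where l_j and r_j have level j.  If δ = 1, one leaf at
-- the left end is moved behind all of these and followed by the right center.
module Submission where

open import Data.Bool.Base as Bool using (if_then_else_)
open import Data.Fin.Base as Fin using (Fin; toℕ)
import Data.Fin.Properties as Fin
open import Data.List.Base as List
  using (List; []; _∷_; _++_; map; concatMap; applyUpTo; tabulate; allFin; filter; foldr; length)
open import Data.List.Extrema.Nat using (max≤v⁺; v≤max⁺; min≤v⁺; v≤min⁺)
open import Data.List.Membership.Propositional using (_∈_; _∉_)
open import Data.List.Membership.Propositional.Properties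
  using (∈-map⁺; ∈-filter⁺; ∈-filter⁻; ∈-cartesianProductWith⁺; ∈-cartesianProductWith⁻)
import Data.List.Properties as List
open import Data.List.Relation.Binary.Permutation.Propositional using (_↭_; ↭-sym; ↭⇒↭ₛ)
open import Data.List.Relation.Binary.Permutation.Propositional.Properties
  using (∈-resp-↭; ↭-length) renaming (map⁺ to ↭-map⁺)
import Data.List.Relation.Binary.Permutation.Setoid.Properties as Permutation
open import Data.List.Relation.Unary.All as All using (All; []; _∷_)
import Data.List.Relation.Unary.All.Properties as All
open import Data.List.Relation.Unary.AllPairs as AllPairs using (AllPairs; []; _∷_)
open import Data.List.Relation.Unary.Any as Any using (here; there)
open import Data.List.Relation.Unary.Linked.Properties using (Linked⇒AllPairs)
open import Data.List.Relation.Unary.Unique.Propositional using (Unique)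
open import Data.Maybe as Maybe using (Maybe; just; nothing; is-just; to-witness-T)
open import Data.Nat.Base
open import Data.Nat.Divisibility using (_∣_; _∤_; _∣?_; m∣m*n; ∣m+n∣m⇒∣n; ∣1⇒≡1)
open import Data.Nat.DivMod using (m*n/n≡m; m≡m%n+[m/n]*n; m%n<n; m≥n⇒m/n>0)
open import Data.Nat.ListAction using (sum)
open import Data.Nat.ListAction.Properties using (sum-++; sum-↭)
import Data.Nat.Properties as ℕ
open import Algebra.Properties.CommutativeSemigroup ℕ.+-commutativeSemigroup
  using (interchange) renaming (x∙yz≈y∙xz to +-swap)
open import Data.List.Membership.DecPropositional ℕ._≟_ using (_∈?_)
open import Data.Nat.Tactic.RingSolver using (solve-∀)
open import Data.Product.Base using (∃-syntax; _×_; _,_; proj₁; proj₂)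
open import Data.Sum.Base as Sum using (_⊎_; inj₁; inj₂)
open import Data.Vec.Base as Vec using (Vec; []; _∷_)
open import Data.Vec.N-ary using (N-ary; _$ⁿ_)
import Data.Vec.Properties as Vec
open import Function.Base using (_∘_)
import Relation.Binary.Construct.On as On
open import Relation.Binary.Definitions using (tri<; tri≈; tri>)
open import Relation.Binary.PropositionalEquality
open import Relation.Nullary.Decidable using (Dec; yes; no; ⌊_⌋)
open import Relation.Nullary.Negation using (¬_; contradiction)
open import Relation.Unary using (Decidable)
open import Defs

-- Linear arithmetic

-- The bounds for consecutive vertices alone miss ξ. The excess κ of a far y can sit in either
-- difference around y, so one enlarged difference can serve two consecutive far vertices. This is
-- why triples are added up and the sum is halved, and why the labelling puts leaves at the two ends
-- of the spine next to each other. If δ = 0, the doubled bound is odd, and rounding up supplies the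
-- summand ε = 1. If δ = 1, each center spares the far vertices beside it, and the labelling has to
-- profit from this twice: it starts with the left center followed by a leaf at the right end, and
-- it closes with the moved leaf followed by the right center. A vertex enters only through its
-- position on the spine and its height above it, which turns distances, levels and weights into
-- arithmetic with truncated and absolute differences. The many inequalities that result are linear
-- consequences of a few facts about such differences; a small reflective prover settles them.

infixl 6 _⊕_
infixl 7 _⊗_
infix 5.5 _:≤_
infix 3 _⊢_

data Expr (n : ℕ) : Set where
  #   : ℕ → Expr n
  var : Fin n → Expr n
  _⊕_ _⊗_ : Expr n → Expr n → Expr n

data Inequality (n : ℕ) : Set where
  _:≤_ : Expr n → Expr n → Inequality n

data Sequent (n : ℕ) : Set where
  _⊢_ : List (Inequality n) → Inequality n → Sequent n

module _ {n : ℕ} where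

  Monomial Polynomial : Set
  Monomial = Vec ℕ n
  Polynomial = List (ℕ × Monomial)

  1ᵐ : Monomial
  1ᵐ = Vec.replicate n 0

  addTerm : ℕ × Monomial → Polynomial → Polynomial
  addTerm t [] = t ∷ []
  addTerm (c , m) ((c′ , m′) ∷ p) with Vec.≡-dec ℕ._≟_ m m′
  ... | yes _ = (c + c′ , m′) ∷ p
  ... | no _  = (c′ , m′) ∷ addTerm (c , m) p

  _⊞_ : Polynomial → Polynomial → Polynomial
  p ⊞ q = foldr addTerm q p

  mulTerm : ℕ × Monomial → Polynomial → Polynomial
  mulTerm (c , m) = map λ (c′ , m′) → c * c′ , Vec.zipWith _+_ m m′

  _⊠_ : Polynomial → Polynomial → Polynomial
  p ⊠ q = foldr (λ t → mulTerm t q ⊞_) [] p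

  norm : Expr n → Polynomial
  norm (# c)   = (c , 1ᵐ) ∷ []
  norm (var i) = (1 , Vec.updateAt 1ᵐ i (λ _ → 1)) ∷ []
  norm (a ⊕ b) = norm a ⊞ norm b
  norm (a ⊗ b) = norm a ⊠ norm b

  module _ (ρ : Vec ℕ n) where

    ⟦_⟧ : Expr n → ℕ
    ⟦ # c ⟧   = c
    ⟦ var i ⟧ = Vec.lookup ρ i
    ⟦ a ⊕ b ⟧ = ⟦ a ⟧ + ⟦ b ⟧
    ⟦ a ⊗ b ⟧ = ⟦ a ⟧ * ⟦ b ⟧

    ⟦_⟧≤ : Inequality n → Set
    ⟦ a :≤ b ⟧≤ = ⟦ a ⟧ ≤ ⟦ b ⟧

  ⟦_⟧ᵐ : ∀ {l} → Vec ℕ l → Vec ℕ l → ℕ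
  ⟦ [] ⟧ᵐ    []      = 1
  ⟦ e ∷ m ⟧ᵐ (x ∷ ρ) = x ^ e * ⟦ m ⟧ᵐ ρ

  1ᵐ-sound : ∀ {l} (ρ : Vec ℕ l) → ⟦ Vec.replicate l 0 ⟧ᵐ ρ ≡ 1
  1ᵐ-sound []      = refl
  1ᵐ-sound (x ∷ ρ) = trans (ℕ.*-identityˡ _) (1ᵐ-sound ρ)

  var-sound : ∀ {l} (ρ : Vec ℕ l) i →
              ⟦ Vec.updateAt (Vec.replicate l 0) i (λ _ → 1) ⟧ᵐ ρ ≡ Vec.lookup ρ i
  var-sound (x ∷ ρ) Fin.zero rewrite 1ᵐ-sound ρ = trans (ℕ.*-identityʳ _) (ℕ.*-identityʳ x)
  var-sound (x ∷ ρ) (Fin.suc i) = trans (ℕ.*-identityˡ _) (var-sound ρ i)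

  *ᵐ-sound : ∀ {l} (m m′ ρ : Vec ℕ l) → ⟦ Vec.zipWith _+_ m m′ ⟧ᵐ ρ ≡ ⟦ m ⟧ᵐ ρ * ⟦ m′ ⟧ᵐ ρ
  *ᵐ-sound []      []        []      = refl
  *ᵐ-sound (e ∷ m) (e′ ∷ m′) (x ∷ ρ)
    rewrite *ᵐ-sound m m′ ρ | ℕ.^-distribˡ-+-* x e e′ =
    ℕ.[m*n]*[o*p]≡[m*o]*[n*p] (x ^ e) (x ^ e′) (⟦ m ⟧ᵐ ρ) (⟦ m′ ⟧ᵐ ρ)

  module _ (ρ : Vec ℕ n) where

    ⟦_⟧ᵗ : ℕ × Monomial → ℕ
    ⟦ c , m ⟧ᵗ = c * ⟦ m ⟧ᵐ ρ

    ⟦_⟧ᵖ : Polynomial → ℕ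
    ⟦ [] ⟧ᵖ    = 0
    ⟦ t ∷ p ⟧ᵖ = ⟦ t ⟧ᵗ + ⟦ p ⟧ᵖ

    addTerm-sound : ∀ t p → ⟦ addTerm t p ⟧ᵖ ≡ ⟦ t ⟧ᵗ + ⟦ p ⟧ᵖ
    addTerm-sound t [] = refl
    addTerm-sound (c , m) ((c′ , m′) ∷ p) with Vec.≡-dec ℕ._≟_ m m′
    ... | yes refl rewrite ℕ.*-distribʳ-+ (⟦ m ⟧ᵐ ρ) c c′ = ℕ.+-assoc (c * ⟦ m ⟧ᵐ ρ) _ _
    ... | no _ rewrite addTerm-sound (c , m) p = +-swap (c′ * ⟦ m′ ⟧ᵐ ρ) (c * ⟦ m ⟧ᵐ ρ) ⟦ p ⟧ᵖ

    ⊞-sound : ∀ p q → ⟦ p ⊞ q ⟧ᵖ ≡ ⟦ p ⟧ᵖ + ⟦ q ⟧ᵖ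
    ⊞-sound []      q = refl
    ⊞-sound (t ∷ p) q rewrite addTerm-sound t (p ⊞ q) | ⊞-sound p q = sym (ℕ.+-assoc ⟦ t ⟧ᵗ _ _)

    mulTerm-sound : ∀ t p → ⟦ mulTerm t p ⟧ᵖ ≡ ⟦ t ⟧ᵗ * ⟦ p ⟧ᵖ
    mulTerm-sound t [] = sym (ℕ.*-zeroʳ ⟦ t ⟧ᵗ)
    mulTerm-sound t@(c , m) ((c′ , m′) ∷ p)
      rewrite *ᵐ-sound m m′ ρ | mulTerm-sound t p
            | ℕ.[m*n]*[o*p]≡[m*o]*[n*p] c c′ (⟦ m ⟧ᵐ ρ) (⟦ m′ ⟧ᵐ ρ) =
      sym (ℕ.*-distribˡ-+ ⟦ t ⟧ᵗ ⟦ c′ , m′ ⟧ᵗ ⟦ p ⟧ᵖ)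

    ⊠-sound : ∀ p q → ⟦ p ⊠ q ⟧ᵖ ≡ ⟦ p ⟧ᵖ * ⟦ q ⟧ᵖ
    ⊠-sound []      q = refl
    ⊠-sound (t ∷ p) q
      rewrite ⊞-sound (mulTerm t q) (p ⊠ q) | mulTerm-sound t q | ⊠-sound p q =
      sym (ℕ.*-distribʳ-+ ⟦ q ⟧ᵖ ⟦ t ⟧ᵗ ⟦ p ⟧ᵖ)

    norm-sound : ∀ a → ⟦ norm a ⟧ᵖ ≡ ⟦ ρ ⟧ a
    norm-sound (# c) rewrite 1ᵐ-sound ρ = trans (ℕ.+-identityʳ _) (ℕ.*-identityʳ c)
    norm-sound (var i) rewrite var-sound ρ i = trans (ℕ.+-identityʳ _) (ℕ.*-identityˡ _)
    norm-sound (a ⊕ b) rewrite ⊞-sound (norm a) (norm b) = cong₂ _+_ (norm-sound a) (norm-sound b)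
    norm-sound (a ⊗ b) rewrite ⊠-sound (norm a) (norm b) = cong₂ _*_ (norm-sound a) (norm-sound b)

    -- Only soundness is proved, which is all that `conclude` uses. A term with coefficient 0, such
    -- as `# 0` produces, is dropped because its monomial may be absent from `q`.
    takeTerm : ∀ t q → Maybe (∃[ q′ ] ⟦ t ⟧ᵗ + ⟦ q′ ⟧ᵖ ≤ ⟦ q ⟧ᵖ)
    takeTerm (zero , _) q = just (q , ℕ.≤-refl)
    takeTerm (suc _ , _) [] = nothing
    takeTerm (c@(suc _) , m) ((c′ , m′) ∷ q) with Vec.≡-dec ℕ._≟_ m m′
    ... | no _ = Maybe.map
      (λ (q′ , le) → (c′ , m′) ∷ q′ ,
        ℕ.≤-trans (ℕ.≤-reflexive (+-swap (⟦ c , m ⟧ᵗ) (⟦ c′ , m′ ⟧ᵗ) _))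
                  (ℕ.+-monoʳ-≤ ⟦ c′ , m′ ⟧ᵗ le))
      (takeTerm (c , m) q)
    ... | yes refl with c ℕ.≤? c′
    ...   | no _ = nothing
    ...   | yes c≤c′ = just ((c′ ∸ c , m) ∷ q , ℕ.≤-reflexive (begin
      c * x + ((c′ ∸ c) * x + ⟦ q ⟧ᵖ) ≡⟨ ℕ.+-assoc (c * x) _ _ ⟨
      c * x + (c′ ∸ c) * x + ⟦ q ⟧ᵖ   ≡⟨ cong (_+ ⟦ q ⟧ᵖ) (ℕ.*-distribʳ-+ x c (c′ ∸ c)) ⟨
      (c + (c′ ∸ c)) * x + ⟦ q ⟧ᵖ     ≡⟨ cong (λ y → y * x + ⟦ q ⟧ᵖ) (ℕ.m+[n∸m]≡n c≤c′) ⟩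
      c′ * x + ⟦ q ⟧ᵖ                 ∎))
      where
      open ≡-Reasoning
      x = ⟦ m ⟧ᵐ ρ

    _⊑_ : ∀ p q → Maybe (⟦ p ⟧ᵖ ≤ ⟦ q ⟧ᵖ)
    []      ⊑ q = just z≤n
    (t ∷ p) ⊑ q = takeTerm t q Maybe.>>= λ (q′ , le) →
      Maybe.map (λ p⊑q′ → ℕ.≤-trans (ℕ.+-monoʳ-≤ ⟦ t ⟧ᵗ p⊑q′) le) (p ⊑ q′)

    total : (Expr n × Expr n → Expr n) → List (Inequality n) → Expr n
    total side = foldr (λ { (A :≤ B) e → side (A , B) ⊕ e }) (# 0)

    -- The search inspects coefficients and exponents only, so it runs with `ρ` left open. When it
    -- succeeds, this type computes to the unit type and the implicit argument of `lin` is filled in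
    -- by unification. The conclusion must agree with the goal up to computation, which is why
    -- sequents spell out summands such as `# 0`.
    Certified : Sequent n → Set
    Certified (Γ ⊢ a :≤ b) =
      Bool.T (is-just (norm (a ⊕ total proj₂ Γ) ⊑ norm (b ⊕ total proj₁ Γ)))

    sum-hypotheses : ∀ {Γ} → All ⟦ ρ ⟧≤ Γ → ⟦ ρ ⟧ (total proj₁ Γ) ≤ ⟦ ρ ⟧ (total proj₂ Γ)
    sum-hypotheses []                         = z≤n
    sum-hypotheses {(A :≤ B) ∷ Γ} (A≤B ∷ hyps) = ℕ.+-mono-≤ A≤B (sum-hypotheses hyps)

    Conclusion : Sequent n → Set
    Conclusion (Γ ⊢ goal) = All ⟦ ρ ⟧≤ Γ → ⟦ ρ ⟧≤ goal

    conclude : ∀ S → Certified S → Conclusion S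
    conclude (Γ ⊢ a :≤ b) certified hyps =
      ℕ.+-cancelʳ-≤ (⟦ ρ ⟧ (total proj₂ Γ)) _ _ (ℕ.≤-trans
        (subst₂ _≤_ (norm-sound (a ⊕ total proj₂ Γ)) (norm-sound (b ⊕ total proj₁ Γ))
          (to-witness-T _ certified))
        (ℕ.+-monoʳ-≤ (⟦ ρ ⟧ b) (sum-hypotheses hyps)))

-- The hypotheses are added up; the check is that, as polynomials, the coefficients of the
-- left-hand side of the goal plus the right-hand sides of the hypotheses are bounded by
-- those of the other side.  A hypothesis needed with multiplicity m is listed m times.
lin : ∀ {n} (ρ : Vec ℕ n) (f : N-ary n (Expr n) (Sequent n)) →
      let S = f $ⁿ Vec.tabulate var in {Certified ρ S} → Conclusion ρ S
lin ρ f {certified} = conclude ρ (f $ⁿ Vec.tabulate var) certified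

-- Finite sums

∑ : ℕ → (ℕ → ℕ) → ℕ
∑ n f = sum (applyUpTo f n)

∑-cong : ∀ n {f g} → (∀ i → i < n → f i ≡ g i) → ∑ n f ≡ ∑ n g
∑-cong zero    eq = refl
∑-cong (suc n) eq = cong₂ _+_ (eq 0 z<s) (∑-cong n λ i i<n → eq (suc i) (s<s i<n))

∑-const : ∀ n c → ∑ n (λ _ → c) ≡ n * c
∑-const zero    c = refl
∑-const (suc n) c = cong (c +_) (∑-const n c)

∑-++ : ∀ m n f → ∑ (m + n) f ≡ ∑ m f + ∑ n (f ∘ (m +_))
∑-++ zero    n f = refl
∑-++ (suc m) n f = trans (cong (f 0 +_) (∑-++ m n (f ∘ suc))) (sym (ℕ.+-assoc (f 0) _ _))

∑-last : ∀ n f → ∑ (suc n) f ≡ ∑ n f + f n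
∑-last zero    f = ℕ.+-identityʳ (f 0)
∑-last (suc n) f = trans (cong (f 0 +_) (∑-last n (f ∘ suc))) (sym (ℕ.+-assoc (f 0) _ _))

∑-reverse : ∀ n f → ∑ n f ≡ ∑ n (λ i → f (n ∸ suc i))
∑-reverse zero    f = refl
∑-reverse (suc n) f = begin
  ∑ (suc n) f                          ≡⟨ ∑-last n f ⟩
  ∑ n f + f n                          ≡⟨ ℕ.+-comm (∑ n f) (f n) ⟩
  f n + ∑ n f                          ≡⟨ cong (f n +_) (∑-reverse n f) ⟩
  f n + ∑ n (λ i → f (n ∸ suc i))      ∎
  where open ≡-Reasoning

∑-triangular : ∀ n → 2 * ∑ n suc ≡ n * suc n
∑-triangular zero    = refl
∑-triangular (suc n) = begin
  2 * ∑ (suc n) suc         ≡⟨ cong (2 *_) (∑-last n suc) ⟩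
  2 * (∑ n suc + suc n)     ≡⟨ ℕ.*-distribˡ-+ 2 (∑ n suc) (suc n) ⟩
  2 * ∑ n suc + 2 * suc n   ≡⟨ cong (_+ 2 * suc n) (∑-triangular n) ⟩
  n * suc n + 2 * suc n     ≡⟨ ℕ.*-distribʳ-+ (suc n) n 2 ⟨
  (n + 2) * suc n           ≡⟨ cong (_* suc n) (ℕ.+-comm n 2) ⟩
  (2 + n) * suc n           ≡⟨ ℕ.*-comm (2 + n) (suc n) ⟩
  suc n * suc (suc n)       ∎
  where open ≡-Reasoning

except : ℕ → (ℕ → ℕ) → ℕ → ℕ
except p f i with i ℕ.≟ p
... | yes _ = 0
... | no _  = f i

except-≢ : ∀ {p i} f → i ≢ p → except p f i ≡ f i
except-≢ {p} {i} f i≢p with i ℕ.≟ p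
... | yes i≡p = contradiction i≡p i≢p
... | no _    = refl

except-≡ : ∀ p f → except p f p ≡ 0
except-≡ p f with p ℕ.≟ p
... | yes _  = refl
... | no p≢p = contradiction refl p≢p

∑-remove : ∀ {n p} f → p < n → ∑ n f ≡ f p + ∑ n (except p f)
∑-remove {suc n} {zero} f _ =
  cong (f 0 +_) (∑-cong n λ i _ → sym (except-≢ {0} f λ ()))
∑-remove {suc n} {suc p} f p<n = begin
  f 0 + ∑ n (f ∘ suc)
    ≡⟨ cong (f 0 +_) (∑-remove (f ∘ suc) (s<s⁻¹ p<n)) ⟩
  f 0 + (f (suc p) + ∑ n (except p (f ∘ suc)))
    ≡⟨ +-swap (f 0) (f (suc p)) _ ⟩
  f (suc p) + (f 0 + ∑ n (except p (f ∘ suc)))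
    ≡⟨ cong (λ s → f (suc p) + (f 0 + s)) (∑-cong n λ i _ → shift i) ⟩
  f (suc p) + ∑ (suc n) (except (suc p) f) ∎
  where
  open ≡-Reasoning
  shift : ∀ i → except p (f ∘ suc) i ≡ except (suc p) f (suc i)
  shift i with i ℕ.≟ p
  ... | yes refl = sym (except-≡ (suc p) f)
  ... | no i≢p   = sym (except-≢ f (i≢p ∘ ℕ.suc-injective))

-- Induction on the support: the head is split off the sum and the weight is set to 0 there, so that
-- the remaining weight is supported on the tail.
∑-support : ∀ {n k} ps w g → Unique ps → All (_< n) ps →
            (∀ {i} → i ∈ ps → w i ≡ k) → (∀ {i} → i ∉ ps → w i ≡ 0) →
            ∑ n (λ i → w i * g i) ≡ k * sum (map g ps)
∑-support {n} {k} [] w g _ _ _ w≡0 = begin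
  ∑ n (λ i → w i * g i) ≡⟨ ∑-cong n (λ i _ → cong (_* g i) (w≡0 {i} λ ())) ⟩
  ∑ n (λ _ → 0)         ≡⟨ ∑-const n 0 ⟩
  n * 0                 ≡⟨ ℕ.*-zeroʳ n ⟩
  0                     ≡⟨ ℕ.*-zeroʳ k ⟨
  k * 0                 ∎
  where open ≡-Reasoning
∑-support {n} {k} (p ∷ ps) w g (p∉ps AllPairs.∷ unique) (p<n ∷ ps<n) w≡k w≡0 = begin
  ∑ n wg                                         ≡⟨ ∑-remove wg p<n ⟩
  w p * g p + ∑ n (except p wg)                  ≡⟨ cong₂ (λ c s → c * g p + s) (w≡k (here refl)) (∑-cong n λ i _ → except-* i) ⟩
  k * g p + ∑ n (λ i → except p w i * g i)       ≡⟨ cong (k * g p +_) (∑-support ps (except p w) g unique ps<n w′≡k w′≡0) ⟩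
  k * g p + k * sum (map g ps)                   ≡⟨ ℕ.*-distribˡ-+ k (g p) _ ⟨
  k * sum (map g (p ∷ ps))                       ∎
  where
  open ≡-Reasoning
  wg : ℕ → ℕ
  wg i = w i * g i
  except-* : ∀ i → except p wg i ≡ except p w i * g i
  except-* i with i ℕ.≟ p
  ... | yes _ = refl
  ... | no _  = refl
  w′≡k : ∀ {i} → i ∈ ps → except p w i ≡ k
  w′≡k i∈ps = trans (except-≢ w λ i≡p → All.lookup p∉ps i∈ps (sym i≡p)) (w≡k (there i∈ps))
  w′≡0 : ∀ {i} → i ∉ ps → except p w i ≡ 0
  w′≡0 {i} i∉ps with i ℕ.≟ p
  ... | yes _  = refl
  ... | no i≢p = w≡0 λ { (here i≡p) → i≢p i≡p ; (there i∈ps) → i∉ps i∈ps }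

sum-allFin : ∀ n f → sum (map (f ∘ toℕ) (allFin n)) ≡ ∑ n f
sum-allFin n f = trans (cong sum (List.map-tabulate {n = n} (λ i → i) (f ∘ toℕ))) (go n f)
  where
  go : ∀ n f → sum (tabulate {n = n} (f ∘ toℕ)) ≡ ∑ n f
  go zero    f = refl
  go (suc n) f = cong (f 0 +_) (go n (f ∘ suc))

module _ {A : Set} where

  sum-mono : ∀ {f g : A → ℕ} xs → (∀ x → f x ≤ g x) → sum (map f xs) ≤ sum (map g xs)
  sum-mono []       f≤g = z≤n
  sum-mono (x ∷ xs) f≤g = ℕ.+-mono-≤ (f≤g x) (sum-mono xs f≤g)

  sum-+ : ∀ (f g : A → ℕ) xs → sum (map (λ x → f x + g x) xs) ≡ sum (map f xs) + sum (map g xs)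
  sum-+ f g []       = refl
  sum-+ f g (x ∷ xs) = trans (cong (f x + g x +_) (sum-+ f g xs)) (interchange (f x) (g x) _ _)

  sum-* : ∀ c (f : A → ℕ) xs → sum (map (λ x → c * f x) xs) ≡ c * sum (map f xs)
  sum-* c f []       = sym (ℕ.*-zeroʳ c)
  sum-* c f (x ∷ xs) = trans (cong (c * f x +_) (sum-* c f xs)) (sym (ℕ.*-distribˡ-+ c (f x) _))

  sum-const : ∀ c (xs : List A) → sum (map (λ _ → c) xs) ≡ length xs * c
  sum-const c []       = refl
  sum-const c (x ∷ xs) = cong (c +_) (sum-const c xs)

  sum-concatMap : ∀ {B : Set} (g : B → ℕ) (f : A → List B) xs →
                  sum (map g (concatMap f xs)) ≡ sum (map (λ x → sum (map g (f x))) xs)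
  sum-concatMap g f []       = refl
  sum-concatMap g f (x ∷ xs) = begin
    sum (map g (f x ++ concatMap f xs))               ≡⟨ cong sum (List.map-++ g (f x) _) ⟩
    sum (map g (f x) ++ map g (concatMap f xs))       ≡⟨ sum-++ (map g (f x)) _ ⟩
    sum (map g (f x)) + sum (map g (concatMap f xs))  ≡⟨ cong (sum (map g (f x)) +_) (sum-concatMap g f xs) ⟩
    sum (map g (f x)) + sum (map (λ x → sum (map g (f x))) xs) ∎
    where open ≡-Reasoning

  -- Turns counting into summing an indicator. The indicators meant are `1 ∸ L v` for the centers
  -- and `L v ∸ h` for the far vertices, whose sums are evaluated level by level.
  length-filter : ∀ {Q : A → Set} (Q? : Decidable Q) (g : A → ℕ) xs →
                  (∀ x → Q x → g x ≡ 1) → (∀ x → ¬ Q x → g x ≡ 0) →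
                  length (filter Q? xs) ≡ sum (map g xs)
  length-filter Q? g []       g≡1 g≡0 = refl
  length-filter Q? g (x ∷ xs) g≡1 g≡0 with Q? x
  ... | yes q rewrite g≡1 x q  = cong suc (length-filter Q? g xs g≡1 g≡0)
  ... | no ¬q rewrite g≡0 x ¬q = length-filter Q? g xs g≡1 g≡0

-- Distances in caterpillars

∣-∣-≤ : ∀ {a b e} → a ≤ b + e → b ≤ a + e → ∣ a - b ∣ ≤ e
∣-∣-≤ {a} {b} a≤b+e b≤a+e with ℕ.≤-total a b
... | inj₁ a≤b rewrite ℕ.m≤n⇒∣m-n∣≡n∸m a≤b = ℕ.m≤n+o⇒m∸n≤o b a b≤a+e
... | inj₂ b≤a rewrite ℕ.m≤n⇒∣n-m∣≡n∸m b≤a = ℕ.m≤n+o⇒m∸n≤o a b a≤b+e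

≤-∣-∣ : ∀ {a b e} → a + e ≤ b ⊎ b + e ≤ a → e ≤ ∣ a - b ∣
≤-∣-∣ {a} {b} {e} (inj₁ a+e≤b) = ℕ.≤-trans
  (ℕ.m+n≤o⇒m≤o∸n e (subst (_≤ b) (ℕ.+-comm a e) a+e≤b)) (subst (b ∸ a ≤_) (ℕ.∣-∣-comm b a) (ℕ.m∸n≤∣m-n∣ b a))
≤-∣-∣ {a} {b} {e} (inj₂ b+e≤a) = ℕ.≤-trans
  (ℕ.m+n≤o⇒m≤o∸n e (subst (_≤ a) (ℕ.+-comm b e) b+e≤a)) (ℕ.m∸n≤∣m-n∣ a b)

module _ (G : Graph) where
  open Graph G

  dist-min : ∀ {ℓ u v} → Walk _~_ ℓ u v → dist G u v ≤ ℓ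
  dist-min {ℓ} {u} {v} W = proj₂ (proj₂ (shortest G u v)) ℓ W

  dist-refl : ∀ u → dist G u u ≡ 0
  dist-refl u = ℕ.n≤0⇒n≡0 (dist-min [])

module Metric (n k : ℕ) where
  open Caterpillar n k

  position height : Vertex → ℕ
  position (spine i)  = toℕ i
  position (leaf i _) = toℕ i
  height (spine _)  = 0
  height (leaf _ _) = 1

  -- The distance of distinct vertices. On the diagonal it is 2 at a leaf instead of 0, so only the
  -- bound from below needs `u ≢ v`.
  gap : Vertex → Vertex → ℕ
  gap u v = ∣ position u - position v ∣ + (height u + height v)

  spineWalk : ∀ i j → Walk _~_ ∣ toℕ i - toℕ j ∣ (spine i) (spine j)
  spineWalk i j with ℕ.≤-total (toℕ i) (toℕ j)
  ... | inj₁ i≤j rewrite ℕ.m≤n⇒∣m-n∣≡n∸m i≤j = spineForward _ (ℕ.m∸n+n≡m i≤j)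
  ... | inj₂ j≤i rewrite ℕ.m≤n⇒∣n-m∣≡n∸m j≤i = reverse (spineForward _ (ℕ.m∸n+n≡m j≤i))

  dist≤gap : ∀ u v → dist (C n k) u v ≤ gap u v
  dist≤gap (spine i) (spine j) = ℕ.≤-trans
    (dist-min (C n k) (spineWalk i j)) (ℕ.m≤m+n _ 0)
  dist≤gap (spine i) (leaf j y) = ℕ.≤-trans
    (dist-min (C n k) (snoc (spineWalk i j) (down {x = y}))) (ℕ.≤-reflexive (ℕ.+-comm 1 _))
  dist≤gap (leaf i x) (spine j) = ℕ.≤-trans
    (dist-min (C n k) (up {x = x} ∷ spineWalk i j)) (ℕ.≤-reflexive (ℕ.+-comm 1 _))
  dist≤gap (leaf i x) (leaf j y) = ℕ.≤-trans
    (dist-min (C n k) (up {x = x} ∷ snoc (spineWalk i j) (down {x = y}))) (ℕ.≤-reflexive (ℕ.+-comm 2 _))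

  -- With the triangle inequality for positions this says that crossing one edge changes `gap` to a
  -- fixed target by at most 1. The heights stand on different sides because the target contributes
  -- the same height before and after.
  edge-length : ∀ {u v} → u ~ v → ∣ position u - position v ∣ + height u ≤ suc (height v)
  edge-length (next {i} {j} eq) = ℕ.≤-trans (ℕ.≤-reflexive (ℕ.+-identityʳ _))
    (∣-∣-≤ (ℕ.≤-trans (ℕ.n≤1+n _) (ℕ.≤-trans (ℕ.≤-reflexive eq) (ℕ.m≤m+n _ 1)))
           (ℕ.≤-reflexive (trans (sym eq) (ℕ.+-comm 1 _))))
  edge-length (prev {i} {j} eq) = ℕ.≤-trans (ℕ.≤-reflexive (ℕ.+-identityʳ _))
    (∣-∣-≤ (ℕ.≤-reflexive (trans (sym eq) (ℕ.+-comm 1 _)))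
           (ℕ.≤-trans (ℕ.n≤1+n _) (ℕ.≤-trans (ℕ.≤-reflexive eq) (ℕ.m≤m+n _ 1))))
  edge-length (down {i}) rewrite ℕ.∣n-n∣≡0 (toℕ i) = z≤n
  edge-length (up {i})   rewrite ℕ.∣n-n∣≡0 (toℕ i) = ℕ.≤-refl

  edge-gap : ∀ {u v} → u ~ v → gap u v ≤ 1
  edge-gap (next {i} {j} eq) = subst (_≤ 1) (ℕ.+-identityʳ _) (ℕ.+-monoˡ-≤ 0 (edge-length (next {i} {j} eq)))
  edge-gap (prev {i} {j} eq) = subst (_≤ 1) (ℕ.+-identityʳ _) (ℕ.+-monoˡ-≤ 0 (edge-length (prev {i} {j} eq)))
  edge-gap (down {i}) rewrite ℕ.∣n-n∣≡0 (toℕ i) = ℕ.≤-refl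
  edge-gap (up {i})   rewrite ℕ.∣n-n∣≡0 (toℕ i) = ℕ.≤-refl

  gap≤walk : ∀ {ℓ u v} → Walk _~_ ℓ u v → u ≢ v → gap u v ≤ ℓ
  gap≤walk [] u≢u = contradiction refl u≢u
  gap≤walk {suc ℓ} {u} {v} (_∷_ {v = w} e W) u≢v with w ≟ v
  ... | yes refl = ℕ.≤-trans (edge-gap e) (s≤s z≤n)
  ... | no w≢v   = lin
    (∣ position u - position v ∣ ∷ ∣ position u - position w ∣ ∷ ∣ position w - position v ∣
      ∷ height u ∷ height v ∷ height w ∷ ℓ ∷ [])
    (λ uv uw wv u v w ℓ →
      uw ⊕ u :≤ # 1 ⊕ w ∷ wv ⊕ (w ⊕ v) :≤ ℓ ∷ uv :≤ uw ⊕ wv ∷ [] ⊢ uv ⊕ (u ⊕ v) :≤ # 1 ⊕ ℓ)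
    (edge-length e ∷ gap≤walk W w≢v ∷ ℕ.∣-∣-triangle (position u) (position w) (position v) ∷ [])

  gap≤dist : ∀ u v → u ≢ v → gap u v ≤ dist (C n k) u v
  gap≤dist u v = gap≤walk (proj₁ (proj₂ (shortest (C n k) u v)))

  sum-vertices : (g : Vertex → ℕ) (γ : ℕ → ℕ → ℕ) → (∀ v → g v ≡ γ (position v) (height v)) →
                 (leaves′ : ℕ → ℕ) → (∀ i → leaves i ≡ leaves′ (toℕ i)) →
                 sum (map g vertices) ≡ ∑ n (λ i → γ i 0) + ∑ n (λ i → leaves′ i * γ i 1)
  sum-vertices g γ g≡γ leaves′ leaves≡ = begin
    sum (map g vertices)
      ≡⟨ cong sum (List.map-++ g (map spine (allFin n)) _) ⟩
    sum (map g (map spine (allFin n)) List.++ map g (concatMap leavesAt (allFin n)))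
      ≡⟨ sum-++ (map g (map spine (allFin n))) _ ⟩
    sum (map g (map spine (allFin n))) + sum (map g (concatMap leavesAt (allFin n)))
      ≡⟨ cong₂ _+_ onSpine onLeaves ⟩
    ∑ n (λ i → γ i 0) + ∑ n (λ i → leaves′ i * γ i 1) ∎
    where
    open ≡-Reasoning
    onSpine : sum (map g (map spine (allFin n))) ≡ ∑ n (λ i → γ i 0)
    onSpine = begin
      sum (map g (map spine (allFin n)))         ≡⟨ cong sum (List.map-∘ (allFin n)) ⟨
      sum (map (g ∘ spine) (allFin n))           ≡⟨ cong sum (List.map-cong (g≡γ ∘ spine) (allFin n)) ⟩
      sum (map (λ i → γ (toℕ i) 0) (allFin n))   ≡⟨ sum-allFin n (λ i → γ i 0) ⟩
      ∑ n (λ i → γ i 0)                          ∎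
    atLeaves : ∀ i → sum (map g (leavesAt i)) ≡ leaves′ (toℕ i) * γ (toℕ i) 1
    atLeaves i = begin
      sum (map g (leavesAt i))                             ≡⟨ cong sum (List.map-∘ (allFin (leaves i))) ⟨
      sum (map (g ∘ leaf i) (allFin (leaves i)))           ≡⟨ cong sum (List.map-cong (g≡γ ∘ leaf i) (allFin (leaves i))) ⟩
      sum (map (λ _ → γ (toℕ i) 1) (allFin (leaves i)))    ≡⟨ sum-const (γ (toℕ i) 1) (allFin (leaves i)) ⟩
      length (allFin (leaves i)) * γ (toℕ i) 1             ≡⟨ cong (_* γ (toℕ i) 1) (List.length-tabulate {n = leaves i} (λ x → x)) ⟩
      leaves i * γ (toℕ i) 1                               ≡⟨ cong (_* γ (toℕ i) 1) (leaves≡ i) ⟩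
      leaves′ (toℕ i) * γ (toℕ i) 1                        ∎
    onLeaves : sum (map g (concatMap leavesAt (allFin n))) ≡ ∑ n (λ i → leaves′ i * γ i 1)
    onLeaves = begin
      sum (map g (concatMap leavesAt (allFin n)))                 ≡⟨ sum-concatMap g leavesAt (allFin n) ⟩
      sum (map (λ i → sum (map g (leavesAt i))) (allFin n))       ≡⟨ cong sum (List.map-cong atLeaves (allFin n)) ⟩
      sum (map (λ i → leaves′ (toℕ i) * γ (toℕ i) 1) (allFin n))  ≡⟨ sum-allFin n (λ i → leaves′ i * γ i 1) ⟩
      ∑ n (λ i → leaves′ i * γ i 1)                               ∎

2a+2b : ∀ a b → a + (b + (b + (a + 0))) ≡ 2 * a + 2 * b
2a+2b = solve-∀

reverse₂ : ∀ a b → a + (b + 0) ≡ b + (a + 0)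
reverse₂ = solve-∀

reverse₄ : ∀ a b c d → a + (b + (c + (d + 0))) ≡ d + (c + (b + (a + 0)))
reverse₄ = solve-∀

≤-maxOverPairs : ∀ G (f : Graph.V G → Graph.V G → ℕ) u v → f u v ≤ maxOverPairs G f
≤-maxOverPairs G f u v = v≤max⁺ 0 _ (inj₂ (Any.map ℕ.≤-reflexive
  (∈-cartesianProductWith⁺ f (Graph.complete G u) (Graph.complete G v))))

maxOverPairs-≤ : ∀ G {f : Graph.V G → Graph.V G → ℕ} {b} → (∀ u v → f u v ≤ b) → maxOverPairs G f ≤ b
maxOverPairs-≤ G {f} f≤b = max≤v⁺ z≤n (All.tabulate λ x∈ → bound (∈-cartesianProductWith⁻ f vertices vertices x∈))
  where
  open Graph G
  bound : ∀ {x} → ∃[ u ] ∃[ v ] (u ∈ vertices × v ∈ vertices × x ≡ f u v) → x ≤ _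
  bound (u , v , _ , _ , refl) = f≤b u v

-- Orderings by label

module _ {A : Set} (f : A → ℕ) where
  open import Data.List.Sort (On.decTotalOrder ℕ.≤-decTotalOrder f)

  -- The order is recorded for all pairs, not only for consecutive ones, because the bound for a
  -- triple also compares its outer members.
  sortBy : ∀ {xs} → Unique xs → ∃[ ys ] (ys ↭ xs × AllPairs (λ x y → x ≢ y × f x ≤ f y) ys)
  sortBy {xs} unique = sort xs , sort-↭ xs , AllPairs.zip
    ( Permutation.Unique-resp-↭ (setoid A) (↭⇒↭ₛ (↭-sym (sort-↭ xs))) unique
    , Linked⇒AllPairs ℕ.≤-trans (sort-↗ xs))

module _ {A : Set} where

  lastOf : A → List A → A
  lastOf x []       = x
  lastOf x (y ∷ ys) = lastOf y ys

  lastOf-∈ : ∀ x ys → lastOf x ys ∈ x ∷ ys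
  lastOf-∈ x []       = here refl
  lastOf-∈ x (y ∷ ys) = there (lastOf-∈ y ys)

  -- Summing the inequality `triple` over all consecutive triples counts every consecutive
  -- difference of f twice, except the first and the last one.
  module Telescope (f L s c : A → ℕ) (D κ : ℕ) (R : A → A → Set)
    (pair : ∀ {x y} → R x y → D + f x ≤ f y + (L x + L y))
    (triple : ∀ {x y z} → R x y → R y z → R x z →
              2 * D + f x + κ * s y ≤ f z + (L x + 2 * L y + L z) + κ * (c x + c z)) where

    Σ_ : (A → ℕ) → List A → ℕ
    (Σ g) xs = sum (map g xs)

    -- Here every difference is counted twice except the first, which is counted once; so x has a
    -- single share of its level, y three, inner vertices four and the last one two. A further
    -- triple in front counts the old first difference a second time and the new one once.
    -- `telescope` then adds the first pair once more.
    telescope′ : ∀ x y zs → AllPairs R (x ∷ y ∷ zs) → let ℓ = lastOf y zs in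
      (2 * length zs + 1) * D + f x + f y + 2 * L ℓ + 3 * L x + L y
        + κ * (s x + (s y + (Σ s) zs) + c x + c y + c ℓ)
      ≤ 2 * f ℓ + 4 * (L x + (L y + (Σ L) zs)) + κ * (s x + s ℓ + 2 * (c x + (c y + (Σ c) zs)))
    telescope′ x y [] ((xy ∷ []) ∷ _) = lin
      (f x ∷ f y ∷ L x ∷ L y ∷ s x ∷ s y ∷ c x ∷ c y ∷ D ∷ κ ∷ [])
      (λ fx fy Lx Ly sx sy cx cy D κ → D ⊕ fx :≤ fy ⊕ (Lx ⊕ Ly) ∷ [] ⊢
        (# 2 ⊗ # 0 ⊕ # 1) ⊗ D ⊕ fx ⊕ fy ⊕ # 2 ⊗ Ly ⊕ # 3 ⊗ Lx ⊕ Ly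
          ⊕ κ ⊗ (sx ⊕ (sy ⊕ # 0) ⊕ cx ⊕ cy ⊕ cy)
        :≤ # 2 ⊗ fy ⊕ # 4 ⊗ (Lx ⊕ (Ly ⊕ # 0)) ⊕ κ ⊗ (sx ⊕ sy ⊕ # 2 ⊗ (cx ⊕ (cy ⊕ # 0))))
      (pair xy ∷ [])
    telescope′ x y (z ∷ zs) ((xy ∷ xz ∷ _) ∷ rest@((yz ∷ _) ∷ _)) = lin
      (f x ∷ f y ∷ f z ∷ f ℓ ∷ L x ∷ L y ∷ L z ∷ L ℓ ∷ (Σ L) zs ∷ s x ∷ s y ∷ s z ∷ s ℓ ∷ (Σ s) zs
        ∷ c x ∷ c y ∷ c z ∷ c ℓ ∷ (Σ c) zs ∷ D ∷ κ ∷ length zs ∷ [])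
      (λ fx fy fz fℓ Lx Ly Lz Lℓ ΣL sx sy sz sℓ Σs cx cy cz cℓ Σc D κ m →
        (# 2 ⊗ m ⊕ # 1) ⊗ D ⊕ fy ⊕ fz ⊕ # 2 ⊗ Lℓ ⊕ # 3 ⊗ Ly ⊕ Lz
          ⊕ κ ⊗ (sy ⊕ (sz ⊕ Σs) ⊕ cy ⊕ cz ⊕ cℓ)
        :≤ # 2 ⊗ fℓ ⊕ # 4 ⊗ (Ly ⊕ (Lz ⊕ ΣL)) ⊕ κ ⊗ (sy ⊕ sℓ ⊕ # 2 ⊗ (cy ⊕ (cz ⊕ Σc)))
        ∷ # 2 ⊗ D ⊕ fx ⊕ κ ⊗ sy :≤ fz ⊕ (Lx ⊕ # 2 ⊗ Ly ⊕ Lz) ⊕ κ ⊗ (cx ⊕ cz)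
        ∷ [] ⊢
        (# 2 ⊗ (# 1 ⊕ m) ⊕ # 1) ⊗ D ⊕ fx ⊕ fy ⊕ # 2 ⊗ Lℓ ⊕ # 3 ⊗ Lx ⊕ Ly
          ⊕ κ ⊗ (sx ⊕ (sy ⊕ (sz ⊕ Σs)) ⊕ cx ⊕ cy ⊕ cℓ)
        :≤ # 2 ⊗ fℓ ⊕ # 4 ⊗ (Lx ⊕ (Ly ⊕ (Lz ⊕ ΣL))) ⊕ κ ⊗ (sx ⊕ sℓ ⊕ # 2 ⊗ (cx ⊕ (cy ⊕ (cz ⊕ Σc)))))
      (telescope′ y z zs rest ∷ triple xy yz xz ∷ [])
      where ℓ = lastOf z zs

    telescope : ∀ x y zs → AllPairs R (x ∷ y ∷ zs) → let ℓ = lastOf y zs; xs = x ∷ y ∷ zs in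
      2 * (1 + length zs) * D + 2 * f x + 2 * (L x + L ℓ) + κ * ((Σ s) xs + (c x + c ℓ))
      ≤ 2 * f ℓ + 4 * (Σ L) xs + κ * (s x + s ℓ + 2 * (Σ c) xs)
    telescope x y zs R-xs@((xy ∷ _) ∷ _) = lin
      (f x ∷ f y ∷ f ℓ ∷ L x ∷ L y ∷ L ℓ ∷ (Σ L) zs ∷ s x ∷ s y ∷ s ℓ ∷ (Σ s) zs
        ∷ c x ∷ c y ∷ c ℓ ∷ (Σ c) zs ∷ D ∷ κ ∷ length zs ∷ [])
      (λ fx fy fℓ Lx Ly Lℓ ΣL sx sy sℓ Σs cx cy cℓ Σc D κ m →
        (# 2 ⊗ m ⊕ # 1) ⊗ D ⊕ fx ⊕ fy ⊕ # 2 ⊗ Lℓ ⊕ # 3 ⊗ Lx ⊕ Ly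
          ⊕ κ ⊗ (sx ⊕ (sy ⊕ Σs) ⊕ cx ⊕ cy ⊕ cℓ)
        :≤ # 2 ⊗ fℓ ⊕ # 4 ⊗ (Lx ⊕ (Ly ⊕ ΣL)) ⊕ κ ⊗ (sx ⊕ sℓ ⊕ # 2 ⊗ (cx ⊕ (cy ⊕ Σc)))
        ∷ D ⊕ fx :≤ fy ⊕ (Lx ⊕ Ly)
        ∷ [] ⊢
        # 2 ⊗ (# 1 ⊕ m) ⊗ D ⊕ # 2 ⊗ fx ⊕ # 2 ⊗ (Lx ⊕ Lℓ) ⊕ κ ⊗ (sx ⊕ (sy ⊕ Σs) ⊕ (cx ⊕ cℓ))
        :≤ # 2 ⊗ fℓ ⊕ # 4 ⊗ (Lx ⊕ (Ly ⊕ ΣL)) ⊕ κ ⊗ (sx ⊕ sℓ ⊕ # 2 ⊗ (cx ⊕ (cy ⊕ Σc))))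
      (telescope′ x y zs R-xs ∷ pair xy ∷ [])
      where ℓ = lastOf y zs

-- Caterpillars of the theorem

-- The third index is the period of the leaf labels, which makes the radio number
-- 2h² + 4h + 1 + 2hδ + P k.  For h = 1 (n = 3, 4) the inner leaf positions coincide with
-- the ends of the spine.
data Shape (h δ : ℕ) : ℕ → Set where
  short : h ≡ 1 → Shape h δ (3 + δ)
  long  : 2 ≤ h → Shape h δ (4 * h + 1 + δ)

-- The number of leaf-bearing positions that are not ends of the spine.
inner : ∀ {h δ P} → Shape h δ P → ℕ
inner (short _) = 0
inner (long _)  = 2

radioNumber : (h δ k P : ℕ) → ℕ
radioNumber h δ k P = 2 * h * h + 4 * h + 1 + 2 * h * δ + P * k

-- The slack 1 is where parity enters: for δ = 0 the doubled lower bound exceeds an even number by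
-- 1.
2*-cancel : ∀ {a b} → 2 * a ≤ 1 + 2 * b → a ≤ b
2*-cancel {a} {b} le with a ℕ.≤? b
... | yes a≤b = a≤b
... | no a≰b  = contradiction (ℕ.≤-trans (ℕ.*-monoʳ-≤ 2 (ℕ.≰⇒> a≰b)) le)
  (λ le′ → ℕ.<⇒≱ (ℕ.≤-reflexive (cong suc (sym (ℕ.*-suc 2 b)))) (s≤s le′))

radioNumber-≤ : ∀ {h δ k P m x y ΣL} → δ ≤ 1 → (s : Shape h δ P) →
  2 + m ≡ 2 * h + suc δ + k * (2 + inner s) → ΣL ≡ h * suc h + k * (2 * suc h + inner s * 2) →
  2 * (1 + m) * (2 * h + 3) + 2 * x + suc δ * (2 * k) + 2 + suc δ ≤ 2 * y + 4 * ΣL + suc δ * (2 * suc δ) →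
  radioNumber h δ k P + x ≤ y
radioNumber-≤ {h} {δ} {k} {P} {m} {x} {y} {ΣL} δ≤1 s |V| refl le = 2*-cancel (go δ≤1 s
  -- `lin` adds hypotheses but does not multiply them, so the equation for the order is multiplied
  -- by 2h + 3 beforehand.
  (ℕ.≤-reflexive (cong (_* (2 * h + 3)) (sym |V|))) le)
  where
  go : ∀ {h δ P} → δ ≤ 1 → (s : Shape h δ P) →
    (2 * h + suc δ + k * (2 + inner s)) * (2 * h + 3) ≤ (2 + m) * (2 * h + 3) →
    2 * (1 + m) * (2 * h + 3) + 2 * x + suc δ * (2 * k) + 2 + suc δ
      ≤ 2 * y + 4 * (h * suc h + k * (2 * suc h + inner s * 2)) + suc δ * (2 * suc δ) →
    2 * (radioNumber h δ k P + x) ≤ 1 + 2 * y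
  go z≤n (short refl) eq le = lin (k ∷ m ∷ x ∷ y ∷ [])
    (λ k m x y →
      (# 3 ⊕ k ⊗ # 2) ⊗ # 5 :≤ (# 2 ⊕ m) ⊗ # 5 ∷ (# 3 ⊕ k ⊗ # 2) ⊗ # 5 :≤ (# 2 ⊕ m) ⊗ # 5
      ∷ # 2 ⊗ (# 1 ⊕ m) ⊗ # 5 ⊕ # 2 ⊗ x ⊕ # 1 ⊗ (# 2 ⊗ k) ⊕ # 2 ⊕ # 1 :≤ # 2 ⊗ y ⊕ # 4 ⊗ (# 2 ⊕ k ⊗ # 4) ⊕ # 2 ∷ [] ⊢
      # 2 ⊗ (# 7 ⊕ # 3 ⊗ k ⊕ x) :≤ # 1 ⊕ # 2 ⊗ y)
    (eq ∷ eq ∷ le ∷ [])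
  go (s≤s z≤n) (short refl) eq le = lin (k ∷ m ∷ x ∷ y ∷ [])
    (λ k m x y →
      (# 4 ⊕ k ⊗ # 2) ⊗ # 5 :≤ (# 2 ⊕ m) ⊗ # 5 ∷ (# 4 ⊕ k ⊗ # 2) ⊗ # 5 :≤ (# 2 ⊕ m) ⊗ # 5
      ∷ # 2 ⊗ (# 1 ⊕ m) ⊗ # 5 ⊕ # 2 ⊗ x ⊕ # 2 ⊗ (# 2 ⊗ k) ⊕ # 2 ⊕ # 2 :≤ # 2 ⊗ y ⊕ # 4 ⊗ (# 2 ⊕ k ⊗ # 4) ⊕ # 8 ∷ [] ⊢
      # 2 ⊗ (# 9 ⊕ # 4 ⊗ k ⊕ x) :≤ # 1 ⊕ # 2 ⊗ y)
    (eq ∷ eq ∷ le ∷ [])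
  go {h} z≤n (long _) eq le = lin (h ∷ k ∷ m ∷ x ∷ y ∷ [])
    (λ h k m x y →
      (# 2 ⊗ h ⊕ # 1 ⊕ k ⊗ # 4) ⊗ (# 2 ⊗ h ⊕ # 3) :≤ (# 2 ⊕ m) ⊗ (# 2 ⊗ h ⊕ # 3)
      ∷ (# 2 ⊗ h ⊕ # 1 ⊕ k ⊗ # 4) ⊗ (# 2 ⊗ h ⊕ # 3) :≤ (# 2 ⊕ m) ⊗ (# 2 ⊗ h ⊕ # 3)
      ∷ # 2 ⊗ (# 1 ⊕ m) ⊗ (# 2 ⊗ h ⊕ # 3) ⊕ # 2 ⊗ x ⊕ # 1 ⊗ (# 2 ⊗ k) ⊕ # 2 ⊕ # 1
        :≤ # 2 ⊗ y ⊕ # 4 ⊗ (h ⊗ (# 1 ⊕ h) ⊕ k ⊗ (# 2 ⊗ (# 1 ⊕ h) ⊕ # 4)) ⊕ # 2 ∷ [] ⊢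
      # 2 ⊗ (# 2 ⊗ h ⊗ h ⊕ # 4 ⊗ h ⊕ # 1 ⊕ # 2 ⊗ h ⊗ # 0 ⊕ (# 4 ⊗ h ⊕ # 1 ⊕ # 0) ⊗ k ⊕ x) :≤ # 1 ⊕ # 2 ⊗ y)
    (eq ∷ eq ∷ le ∷ [])
  go {h} (s≤s z≤n) (long _) eq le = lin (h ∷ k ∷ m ∷ x ∷ y ∷ [])
    (λ h k m x y →
      (# 2 ⊗ h ⊕ # 2 ⊕ k ⊗ # 4) ⊗ (# 2 ⊗ h ⊕ # 3) :≤ (# 2 ⊕ m) ⊗ (# 2 ⊗ h ⊕ # 3)
      ∷ (# 2 ⊗ h ⊕ # 2 ⊕ k ⊗ # 4) ⊗ (# 2 ⊗ h ⊕ # 3) :≤ (# 2 ⊕ m) ⊗ (# 2 ⊗ h ⊕ # 3)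
      ∷ # 2 ⊗ (# 1 ⊕ m) ⊗ (# 2 ⊗ h ⊕ # 3) ⊕ # 2 ⊗ x ⊕ # 2 ⊗ (# 2 ⊗ k) ⊕ # 2 ⊕ # 2
        :≤ # 2 ⊗ y ⊕ # 4 ⊗ (h ⊗ (# 1 ⊕ h) ⊕ k ⊗ (# 2 ⊗ (# 1 ⊕ h) ⊕ # 4)) ⊕ # 8 ∷ [] ⊢
      # 2 ⊗ (# 2 ⊗ h ⊗ h ⊕ # 4 ⊗ h ⊕ # 1 ⊕ # 2 ⊗ h ⊗ # 1 ⊕ (# 4 ⊗ h ⊕ # 1 ⊕ # 1) ⊗ k ⊕ x) :≤ # 1 ⊕ # 2 ⊗ y)
    (eq ∷ eq ∷ le ∷ [])

2∤1+2m : ∀ m → 2 ∤ suc (2 * m)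
2∤1+2m m 2∣ with ∣1⇒≡1 (∣m+n∣m⇒∣n (subst (2 ∣_) (ℕ.+-comm 1 (2 * m)) 2∣) (m∣m*n m))
... | ()

2∣2+2m : ∀ m → 2 ∣ 2 + 2 * m
2∣2+2m m = subst (2 ∣_) (ℕ.*-distribˡ-+ 2 1 m) (m∣m*n (1 + m))

half : ∀ m {e} → e ≡ m * 2 → e / 2 ≡ m
half m refl = m*n/n≡m m 2

leafBearing-odd : ∀ {n} → 2 ∤ n → leafBearing n ≡ 1 ∷ (n ∸ 1) / 2 ∷ (n + 3) / 2 ∷ n ∷ []
leafBearing-odd {n} 2∤n with 2 ∣? n
... | yes 2∣n = contradiction 2∣n 2∤n
... | no _    = refl

leafBearing-even : ∀ {n} → 2 ∣ n → leafBearing n ≡ 1 ∷ (n ∸ 2) / 2 ∷ (n + 4) / 2 ∷ n ∷ []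
leafBearing-even {n} 2∣n with 2 ∣? n
... | yes _  = refl
... | no 2∤n = contradiction 2∣n 2∤n

-- For odd n the inner indices are h and h + 2, for even n they are h and h + 3. In terms of h and δ
-- the two cases of the definition become one.
leafBearing-≡ : ∀ h {δ} → δ ≤ 1 →
  leafBearing (suc (2 * h + δ)) ≡ 1 ∷ h ∷ 2 + (h + δ) ∷ suc (2 * h + δ) ∷ []
leafBearing-≡ h z≤n rewrite ℕ.+-identityʳ (2 * h) =
  trans (leafBearing-odd (2∤1+2m h)) (cong₂ (λ a b → 1 ∷ a ∷ b ∷ suc (2 * h) ∷ [])
    (half h (ℕ.*-comm 2 h))
    (trans (half (2 + h) (trans (ℕ.+-comm (suc (2 * h)) 3) (cong (4 +_) (ℕ.*-comm 2 h))))
      (cong (2 +_) (sym (ℕ.+-identityʳ h)))))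
leafBearing-≡ h (s≤s z≤n) rewrite ℕ.+-comm (2 * h) 1 =
  trans (leafBearing-even (2∣2+2m h)) (cong₂ (λ a b → 1 ∷ a ∷ b ∷ 2 + 2 * h ∷ [])
    (half h (ℕ.*-comm 2 h))
    (trans (half (3 + h) (trans (ℕ.+-comm (2 + 2 * h) 4) (cong (6 +_) (ℕ.*-comm 2 h))))
      (cong (2 +_) (ℕ.+-comm 1 h))))

module Balanced (h δ k P : ℕ) (1≤h : 1 ≤ h) (δ≤1 : δ ≤ 1) (1≤k : 1 ≤ k) (shape : Shape h δ P) where

  N : ℕ
  N = 2 * h + δ

  open Caterpillar (suc N) k
  open Metric (suc N) k

  T : Graph
  T = C (suc N) k

  -- Indexed by the values of `h ∸ p` and `p ∸ (h + δ)`, of which at most one is nonzero; matching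
  -- on a side therefore evaluates both.
  data Side (p : ℕ) : ℕ → ℕ → Set where
    left  : ∀ t → p + suc t ≡ h → Side p (suc t) 0
    mid   : h ≤ p → p ≤ h + δ → Side p 0 0
    right : ∀ t → h + δ + suc t ≡ p → Side p 0 (suc t)

  left-≡ : ∀ {p} t → p + suc t ≡ h → h ∸ p ≡ suc t × p ∸ (h + δ) ≡ 0
  left-≡ {p} t refl = ℕ.m+n∸m≡n p (suc t) ,
    ℕ.m≤n⇒m∸n≡0 (ℕ.≤-trans (ℕ.m≤m+n p (suc t)) (ℕ.m≤m+n _ δ))

  mid-≡ : ∀ {p} → h ≤ p → p ≤ h + δ → h ∸ p ≡ 0 × p ∸ (h + δ) ≡ 0
  mid-≡ h≤p p≤h+δ = ℕ.m≤n⇒m∸n≡0 h≤p , ℕ.m≤n⇒m∸n≡0 p≤h+δ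

  right-≡ : ∀ {p} t → h + δ + suc t ≡ p → h ∸ p ≡ 0 × p ∸ (h + δ) ≡ suc t
  right-≡ t refl =
    ℕ.m≤n⇒m∸n≡0 (ℕ.≤-trans (ℕ.m≤m+n h δ) (ℕ.m≤m+n _ (suc t))) , ℕ.m+n∸m≡n (h + δ) (suc t)

  side : ∀ p → Side p (h ∸ p) (p ∸ (h + δ))
  side p with h ℕ.≤? p | p ℕ.≤? h + δ
  ... | no h≰p | _ = subst₂ (Side p) (sym l) (sym r) (left _ e)
    where
    e : p + suc (h ∸ suc p) ≡ h
    e = trans (ℕ.+-suc p _) (ℕ.m+[n∸m]≡n (ℕ.≰⇒> h≰p))
    l = proj₁ (left-≡ _ e)
    r = proj₂ (left-≡ _ e)
  ... | yes h≤p | yes p≤h+δ =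
    subst₂ (Side p) (sym (ℕ.m≤n⇒m∸n≡0 h≤p)) (sym (ℕ.m≤n⇒m∸n≡0 p≤h+δ)) (mid h≤p p≤h+δ)
  ... | yes h≤p | no p≰h+δ = subst₂ (Side p) (sym l) (sym r) (right _ e)
    where
    e : h + δ + suc (p ∸ suc (h + δ)) ≡ p
    e = trans (ℕ.+-suc (h + δ) _) (ℕ.m+[n∸m]≡n (ℕ.≰⇒> p≰h+δ))
    l = proj₁ (right-≡ _ e)
    r = proj₂ (right-≡ _ e)

  -- The inner places carry `2 ≤ h` and the value of `P`, on which the labels of the inner leaves
  -- depend. For h = 1 the same positions are classified as outer.
  data Place (p : ℕ) : Set where
    outerˡ : p ≡ 0 → Place p
    outerʳ : p ≡ N → Place p
    innerˡ : 2 ≤ h → P ≡ 4 * h + 1 + δ → suc p ≡ h → Place p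
    innerʳ : 2 ≤ h → P ≡ 4 * h + 1 + δ → p ≡ suc (h + δ) → Place p

  place : ∀ {p} → suc p ∈ leafBearing (suc N) → Place p
  place p∈ rewrite leafBearing-≡ h δ≤1 = go shape p∈
    where
    go : ∀ {p} → Shape h δ P → suc p ∈ 1 ∷ h ∷ 2 + (h + δ) ∷ suc N ∷ [] → Place p
    go _            (here e)                         = outerˡ (ℕ.suc-injective e)
    go (short refl) (there (here e))                 = outerˡ (ℕ.suc-injective e)
    go (long 2≤h)   (there (here e))                 = innerˡ 2≤h refl e
    go (short refl) (there (there (here e)))         = outerʳ (ℕ.suc-injective e)
    go (long 2≤h)   (there (there (here e)))         = innerʳ 2≤h refl (ℕ.suc-injective e)
    go _            (there (there (there (here e)))) = outerʳ (ℕ.suc-injective e)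

  -- Free of repetitions, unlike `leafBearing` for h = 1, so that `∑-support` counts each position
  -- once.
  positions : Shape h δ P → List ℕ
  positions (short _) = 0 ∷ N ∷ []
  positions (long _)  = 0 ∷ pred h ∷ suc (h + δ) ∷ N ∷ []

  leafPositions : List ℕ
  leafPositions = positions shape

  suc-pred-h : suc (pred h) ≡ h
  suc-pred-h = ℕ.suc-pred h {{>-nonZero 1≤h}}

  ∈-leafPositions : ∀ {p} → Place p → p ∈ leafPositions
  ∈-leafPositions = go shape
    where
    go : ∀ {p} (s : Shape h δ P) → Place p → p ∈ positions s
    go (short _)    (outerˡ e)             = here e
    go (short _)    (outerʳ e)             = there (here e)
    go (short refl) (innerˡ (s≤s ()) _ _)
    go (short refl) (innerʳ (s≤s ()) _ _)
    go (long _)     (outerˡ e)             = here e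
    go (long _)     (outerʳ e)             = there (there (there (here e)))
    go (long _)     (innerˡ _ _ e)         = there (here (cong pred e))
    go (long _)     (innerʳ _ _ e)         = there (there (here e))

  ∈-leafBearing : ∀ {p} → p ∈ leafPositions → suc p ∈ leafBearing (suc N)
  ∈-leafBearing p∈ rewrite leafBearing-≡ h δ≤1 = go shape p∈
    where
    go : ∀ {p} (s : Shape h δ P) → p ∈ positions s → suc p ∈ 1 ∷ h ∷ 2 + (h + δ) ∷ suc N ∷ []
    go (short _) (here refl)                         = here refl
    go (short _) (there (here refl))                 = there (there (there (here refl)))
    go (long _)  (here refl)                         = here refl
    go (long _)  (there (here refl))                 = there (here suc-pred-h)
    go (long _)  (there (there (here refl)))         = there (there (here refl))
    go (long _)  (there (there (there (here refl)))) = there (there (there (here refl)))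

  leaves′ : ℕ → ℕ
  leaves′ p = if ⌊ suc p ∈? leafBearing (suc N) ⌋ then k else 0

  leaves′-∈ : ∀ {p} → p ∈ leafPositions → leaves′ p ≡ k
  leaves′-∈ {p} p∈ with suc p ∈? leafBearing (suc N)
  ... | yes _ = refl
  ... | no p∉ = contradiction (∈-leafBearing p∈) p∉

  leaves′-∉ : ∀ {p} → p ∉ leafPositions → leaves′ p ≡ 0
  leaves′-∉ {p} p∉ with suc p ∈? leafBearing (suc N)
  ... | yes p∈ = contradiction (∈-leafPositions (place p∈)) p∉
  ... | no _   = refl

  placeOfLeaf : ∀ i → Fin (leaves i) → Place (toℕ i)
  placeOfLeaf i x with suc (toℕ i) ∈? leafBearing (suc N)
  ... | yes p∈ = place p∈
  placeOfLeaf i () | no _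

  leaves≤k : ∀ i → leaves i ≤ k
  leaves≤k i with suc (toℕ i) ∈? leafBearing (suc N)
  ... | yes _ = ℕ.≤-refl
  ... | no _  = z≤n

  positions-< : ∀ s → All (_< suc N) (positions s)
  positions-< (short _)  = z<s ∷ ℕ.≤-refl ∷ []
  positions-< (long 2≤h) = z<s
    ∷ lin (pred h ∷ h ∷ δ ∷ []) (λ q h δ → # 1 ⊕ q :≤ h ∷ [] ⊢ # 1 ⊕ q :≤ # 1 ⊕ (# 2 ⊗ h ⊕ δ)) (ℕ.≤-reflexive suc-pred-h ∷ [])
    ∷ lin (h ∷ δ ∷ []) (λ h δ → # 2 :≤ h ∷ [] ⊢ # 2 ⊕ (h ⊕ δ) :≤ # 1 ⊕ (# 2 ⊗ h ⊕ δ)) (2≤h ∷ [])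
    ∷ ℕ.≤-refl ∷ []

  positions-unique : ∀ s → Unique (positions s)
  positions-unique (short refl) = ((λ ()) ∷ []) ∷ [] ∷ []
  positions-unique (long 2≤h) =
      (ℕ.<⇒≢ (s≤s⁻¹ (subst (2 ≤_) (sym suc-pred-h) 2≤h)) ∷ (λ ())
        ∷ ℕ.<⇒≢ (lin (h ∷ δ ∷ []) (λ h δ → # 2 :≤ h ∷ [] ⊢ # 1 :≤ # 2 ⊗ h ⊕ δ) (2≤h ∷ [])) ∷ [])
    ∷ (ℕ.<⇒≢ (lin (pred h ∷ h ∷ δ ∷ []) (λ q h δ → # 1 ⊕ q :≤ h ∷ [] ⊢ # 1 ⊕ q :≤ # 1 ⊕ (h ⊕ δ)) (ℕ.≤-reflexive suc-pred-h ∷ []))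
        ∷ ℕ.<⇒≢ (lin (pred h ∷ h ∷ δ ∷ []) (λ q h δ → # 1 ⊕ q :≤ h ∷ [] ⊢ # 1 ⊕ q :≤ # 2 ⊗ h ⊕ δ) (ℕ.≤-reflexive suc-pred-h ∷ [])) ∷ [])
    ∷ (ℕ.<⇒≢ (lin (h ∷ δ ∷ []) (λ h δ → # 2 :≤ h ∷ [] ⊢ # 2 ⊕ (h ⊕ δ) :≤ # 2 ⊗ h ⊕ δ) (2≤h ∷ [])) ∷ [])
    ∷ [] ∷ []

  sumOver : (γ : ℕ → ℕ → ℕ) → sum (map (λ v → γ (position v) (height v)) vertices) ≡
            ∑ (suc N) (λ i → γ i 0) + k * sum (map (λ i → γ i 1) leafPositions)
  sumOver γ = trans (sum-vertices _ γ (λ _ → refl) leaves′ (λ _ → refl))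
    (cong (∑ (suc N) (λ i → γ i 0) +_)
      (∑-support leafPositions leaves′ (λ i → γ i 1) (positions-unique shape) (positions-< shape) leaves′-∈ leaves′-∉))

  -- Levels and weight centers

  lvl : ℕ → ℕ
  lvl p = (h ∸ p) + (p ∸ (h + δ))

  L : Vertex → ℕ
  L v = lvl (position v) + height v

  lvl-left : ∀ {p} t → p + suc t ≡ h → lvl p ≡ suc t
  lvl-left {p} t e with l , r ← left-≡ {p} t e = trans (cong₂ _+_ l r) (ℕ.+-identityʳ _)

  lvl-mid : ∀ {p} → h ≤ p → p ≤ h + δ → lvl p ≡ 0
  lvl-mid a b with l , r ← mid-≡ a b = cong₂ _+_ l r

  lvl-right : ∀ {p} t → h + δ + suc t ≡ p → lvl p ≡ suc t
  lvl-right t e with l , r ← right-≡ t e = cong₂ _+_ l r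

  suc-N : suc N ≡ h + (suc δ + h)
  suc-N = begin
    suc (2 * h + δ)     ≡⟨ cong (λ x → suc (h + x + δ)) (ℕ.+-identityʳ h) ⟩
    suc (h + h + δ)     ≡⟨ cong suc (ℕ.+-assoc h h δ) ⟩
    suc (h + (h + δ))   ≡⟨ cong (λ x → suc (h + x)) (ℕ.+-comm h δ) ⟩
    suc (h + (δ + h))   ≡⟨ ℕ.+-suc h (δ + h) ⟨
    h + (suc δ + h)     ∎
    where open ≡-Reasoning

  ∑-lvl : ∀ F → ∑ (suc N) (F ∘ lvl) ≡ 2 * ∑ h (F ∘ suc) + suc δ * F 0
  ∑-lvl F = begin
    ∑ (suc N) f                                        ≡⟨ cong (λ m → ∑ m f) suc-N ⟩
    ∑ (h + (suc δ + h)) f                              ≡⟨ ∑-++ h (suc δ + h) f ⟩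
    ∑ h f + ∑ (suc δ + h) (f ∘ (h +_))                 ≡⟨ cong (∑ h f +_) (∑-++ (suc δ) h (f ∘ (h +_))) ⟩
    ∑ h f + (∑ (suc δ) (f ∘ (h +_)) + ∑ h (λ i → f (h + (suc δ + i))))
      ≡⟨ cong₂ _+_ onLeft (cong₂ _+_ onMid onRight) ⟩
    S + (suc δ * F 0 + S)                              ≡⟨ cong (S +_) (ℕ.+-comm (suc δ * F 0) S) ⟩
    S + (S + suc δ * F 0)                              ≡⟨ ℕ.+-assoc S S _ ⟨
    S + S + suc δ * F 0                                ≡⟨ cong (λ x → S + x + suc δ * F 0) (ℕ.+-identityʳ S) ⟨
    2 * S + suc δ * F 0                                ∎
    where
    open ≡-Reasoning
    f = F ∘ lvl
    S = ∑ h (F ∘ suc)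
    onLeft : ∑ h f ≡ S
    onLeft = trans
      (∑-cong h λ i i<h → cong F (lvl-left (h ∸ suc i) (trans (ℕ.+-suc i _) (ℕ.m+[n∸m]≡n i<h))))
      (sym (∑-reverse h (F ∘ suc)))
    onMid : ∑ (suc δ) (f ∘ (h +_)) ≡ suc δ * F 0
    onMid = trans
      (∑-cong (suc δ) λ i i≤δ → cong F (lvl-mid (ℕ.m≤m+n h i) (ℕ.+-monoʳ-≤ h (s≤s⁻¹ i≤δ))))
      (∑-const (suc δ) (F 0))
    onRight : ∑ h (λ i → f (h + (suc δ + i))) ≡ S
    onRight = ∑-cong h λ i _ → cong F (lvl-right i (trans (ℕ.+-assoc h δ (suc i)) (cong (h +_) (ℕ.+-suc δ i))))

  lvl-0 : lvl 0 ≡ h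
  lvl-0 = trans (lvl-left (pred h) suc-pred-h) suc-pred-h

  lvl-N : lvl N ≡ h
  lvl-N = trans (lvl-right (pred h) (trans (cong (h + δ +_) suc-pred-h)
    (trans (ℕ.+-assoc h δ h) (ℕ.suc-injective (sym (trans suc-N (ℕ.+-suc h (δ + h))))))))
    suc-pred-h

  lvl-pred-h : lvl (pred h) ≡ 1
  lvl-pred-h = lvl-left 0 (trans (ℕ.+-comm (pred h) 1) suc-pred-h)

  lvl-suc-h+δ : lvl (suc (h + δ)) ≡ 1
  lvl-suc-h+δ = lvl-right 0 (ℕ.+-comm (h + δ) 1)

  -- The source of all counts: F = 1 gives the order, the identity gives the total level, `_∸ h` the
  -- number of far vertices and `1 ∸_` the number of centers.
  sum-L : ∀ F → sum (map (F ∘ L) vertices) ≡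
          2 * ∑ h (F ∘ suc) + suc δ * F 0 + k * (2 * F (suc h) + inner shape * F 2)
  sum-L F = trans (sumOver (λ p e → F (lvl p + e))) (cong₂ _+_
    (trans (∑-cong (suc N) λ i _ → cong F (ℕ.+-identityʳ (lvl i))) (∑-lvl F))
    (cong (k *_) (onLeaves shape)))
    where
    at : ∀ {p l} → lvl p ≡ l → F (lvl p + 1) ≡ F (suc l)
    at refl = cong F (ℕ.+-comm _ 1)
    onLeaves : ∀ s → sum (map (λ p → F (lvl p + 1)) (positions s)) ≡ 2 * F (suc h) + inner s * F 2
    onLeaves (short _) rewrite at lvl-0 | at lvl-N = sym (ℕ.+-identityʳ _)
    onLeaves (long _)  rewrite at lvl-0 | at lvl-N | at lvl-pred-h | at lvl-suc-h+δ =
      2a+2b (F (suc h)) (F 2)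

  order-≡ : order T ≡ 2 * h + suc δ + k * (2 + inner shape)
  order-≡ = begin
    length vertices                  ≡⟨ ℕ.*-identityʳ _ ⟨
    length vertices * 1              ≡⟨ sum-const 1 vertices ⟨
    sum (map (λ _ → 1) vertices)     ≡⟨ sum-L (λ _ → 1) ⟩
    2 * ∑ h (λ _ → 1) + suc δ * 1 + k * (2 + inner shape * 1)
      ≡⟨ cong₂ (λ a b → 2 * a + suc δ * 1 + k * (2 + b)) (trans (∑-const h 1) (ℕ.*-identityʳ h)) (ℕ.*-identityʳ (inner shape)) ⟩
    2 * h + suc δ * 1 + k * (2 + inner shape)
      ≡⟨ cong (λ a → 2 * h + a + k * (2 + inner shape)) (ℕ.*-identityʳ (suc δ)) ⟩
    2 * h + suc δ + k * (2 + inner shape) ∎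
    where open ≡-Reasoning

  Σ-L : sum (map L vertices) ≡ h * suc h + k * (2 * suc h + inner shape * 2)
  Σ-L = trans (sum-L (λ l → l)) (cong (_+ k * (2 * suc h + inner shape * 2))
    (trans (cong (2 * ∑ h suc +_) (ℕ.*-zeroʳ (suc δ))) (trans (ℕ.+-identityʳ _) (∑-triangular h))))

  Σ-far : sum (map (λ v → L v ∸ h) vertices) ≡ 2 * k
  Σ-far = trans (sum-L (_∸ h)) (cong₂ _+_
    (cong₂ _+_ (cong (2 *_) (trans (∑-cong h λ i i<h → ℕ.m≤n⇒m∸n≡0 i<h) (trans (∑-const h 0) (ℕ.*-zeroʳ h))))
               (trans (cong (suc δ *_) (ℕ.0∸n≡0 h)) (ℕ.*-zeroʳ (suc δ))))
    (trans (cong₂ (λ a b → k * (2 * a + b)) (ℕ.m+n∸n≡m 1 h) (inner-not-far shape)) (ℕ.*-comm k 2)))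
    where
    inner-not-far : ∀ (s : Shape h δ P) → inner s * (2 ∸ h) ≡ 0
    inner-not-far (short _)  = refl
    inner-not-far (long 2≤h) = cong (2 *_) (ℕ.m≤n⇒m∸n≡0 2≤h)

  -- The reflection of the spine, used as a symmetry of sums so that no automorphism of the graph
  -- has to be constructed. It exchanges the two centers, and it makes the two sides equally large.
  sum-reflect : ∀ γ → sum (map (λ v → γ (position v) (height v)) vertices) ≡
                sum (map (λ v → γ (N ∸ position v) (height v)) vertices)
  sum-reflect γ = begin
    sum (map (λ v → γ (position v) (height v)) vertices)  ≡⟨ sumOver γ ⟩
    ∑ (suc N) (λ i → γ i 0) + k * sum (map (λ i → γ i 1) leafPositions)
      ≡⟨ cong₂ _+_ (∑-reverse (suc N) (λ i → γ i 0)) (cong (k *_) (onLeaves (λ i → γ i 1) shape)) ⟩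
    ∑ (suc N) (λ i → γ (N ∸ i) 0) + k * sum (map (λ i → γ (N ∸ i) 1) leafPositions)  ≡⟨ sumOver (λ p → γ (N ∸ p)) ⟨
    sum (map (λ v → γ (N ∸ position v) (height v)) vertices) ∎
    where
    open ≡-Reasoning
    N∸pred-h : N ∸ pred h ≡ suc (h + δ)
    N∸pred-h = trans (cong (_∸ pred h) N≡) (ℕ.m+n∸m≡n (pred h) _)
      where
      N≡ : N ≡ pred h + suc (h + δ)
      N≡ = trans (trans (cong (_+ δ) (cong (h +_) (ℕ.+-identityʳ h))) (ℕ.+-assoc h h δ))
        (trans (cong (_+ (h + δ)) (sym suc-pred-h)) (sym (ℕ.+-suc (pred h) (h + δ))))
    N∸suc-h+δ : N ∸ suc (h + δ) ≡ pred h
    N∸suc-h+δ = trans (cong (N ∸_) (sym N∸pred-h)) (ℕ.m∸[m∸n]≡n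
      (ℕ.≤-trans ℕ.pred[n]≤n (ℕ.≤-trans (ℕ.m≤m+n h (h + 0)) (ℕ.m≤m+n (2 * h) δ))))
    onLeaves : ∀ g s → sum (map g (positions s)) ≡ sum (map (λ i → g (N ∸ i)) (positions s))
    onLeaves g (short _) rewrite ℕ.n∸n≡0 N = reverse₂ (g 0) (g N)
    onLeaves g (long _)  rewrite ℕ.n∸n≡0 N | N∸pred-h | N∸suc-h+δ =
      reverse₄ (g 0) (g (pred h)) (g (suc (h + δ))) (g N)

  position≤N : ∀ v → position v ≤ N
  position≤N (spine i)  = s≤s⁻¹ (Fin.toℕ<n i)
  position≤N (leaf i _) = s≤s⁻¹ (Fin.toℕ<n i)

  h<n : h < suc N
  h<n = lin (h ∷ δ ∷ []) (λ h δ → [] ⊢ # 1 ⊕ h :≤ # 1 ⊕ (# 2 ⊗ h ⊕ δ)) []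

  h+δ<n : h + δ < suc N
  h+δ<n = lin (h ∷ δ ∷ []) (λ h δ → [] ⊢ # 1 ⊕ (h ⊕ δ) :≤ # 1 ⊕ (# 2 ⊗ h ⊕ δ)) []

  l₀ r₀ : Vertex
  l₀ = spine (Fin.fromℕ< h<n)
  r₀ = spine (Fin.fromℕ< h+δ<n)

  position-l₀ : position l₀ ≡ h
  position-l₀ = Fin.toℕ-fromℕ< h<n

  position-r₀ : position r₀ ≡ h + δ
  position-r₀ = Fin.toℕ-fromℕ< h+δ<n

  spine-≡ : ∀ {i j} → toℕ i ≡ toℕ j → spine i ≡ spine j
  spine-≡ e = cong spine (Fin.toℕ-injective e)

  leaf-lvl>0 : ∀ i (x : Fin (leaves i)) → 0 < lvl (toℕ i)
  leaf-lvl>0 i x with placeOfLeaf i x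
  ... | outerˡ e rewrite e | lvl-0 = 1≤h
  ... | outerʳ e rewrite e | lvl-N = 1≤h
  ... | innerˡ _ _ e rewrite lvl-left 0 (trans (ℕ.+-comm (toℕ i) 1) e) = z<s
  ... | innerʳ _ _ e rewrite e | lvl-suc-h+δ = z<s

  L≡0⇒center : ∀ v → L v ≡ 0 → v ≡ l₀ ⊎ v ≡ r₀
  L≡0⇒center (leaf i x) e = contradiction (ℕ.m+n≡0⇒m≡0 _ e) (ℕ.>⇒≢ (leaf-lvl>0 i x))
  L≡0⇒center (spine i) e with h ∸ toℕ i | toℕ i ∸ (h + δ) | side (toℕ i)
  ... | .0 | .0 | mid h≤i i≤h+δ with toℕ i ℕ.≟ h
  ...   | yes i≡h = inj₁ (spine-≡ (trans i≡h (sym position-l₀)))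
  ...   | no i≢h  = inj₂ (spine-≡ (trans (ℕ.≤-antisym i≤h+δ
            (ℕ.≤-trans (ℕ.+-monoʳ-≤ h δ≤1) (subst (_≤ toℕ i) (ℕ.+-comm 1 h) (ℕ.≤∧≢⇒< h≤i (i≢h ∘ sym)))))
            (sym position-r₀)))

  -- Weights and their minimizers

  weight′ : ℕ → ℕ
  weight′ c = sum (map (λ v → ∣ position v - c ∣ + height v) vertices)

  -- A spine vertex has height 0, so the formula for `gap` is right on the diagonal too, and weights
  -- of spine vertices need no exceptional summand.
  dist-spine : ∀ v i → dist T v (spine i) ≡ ∣ position v - toℕ i ∣ + height v
  dist-spine v i = decide (v ≟ spine i)
    where
    decide : Dec (v ≡ spine i) → dist T v (spine i) ≡ ∣ position v - toℕ i ∣ + height v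
    decide (yes refl) = trans (dist-refl T (spine i)) (sym (trans (ℕ.+-identityʳ _) (ℕ.∣n-n∣≡0 (toℕ i))))
    decide (no v≢i)   = trans (ℕ.≤-antisym (dist≤gap v (spine i)) (gap≤dist v (spine i) v≢i))
                         (cong (∣ position v - toℕ i ∣ +_) (ℕ.+-identityʳ _))

  weight-spine : ∀ i → weight T (spine i) ≡ weight′ (toℕ i)
  weight-spine i = cong sum (List.map-cong (λ v → dist-spine v i) vertices)

  weight-l₀ : weight T l₀ ≡ weight′ h
  weight-l₀ = trans (weight-spine _) (cong weight′ position-l₀)

  reflected : ∀ {p} → p ≤ N → ∃[ q ] (N ∸ p ≡ q × q + p ≡ h + (h + δ))
  reflected {p} p≤N = N ∸ p , refl , trans (ℕ.m∸n+n≡m p≤N)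
    (trans (cong (λ x → h + x + δ) (ℕ.+-identityʳ h)) (ℕ.+-assoc h h δ))

  weight-r₀ : weight T r₀ ≡ weight′ h
  weight-r₀ = trans (weight-spine _) (trans (cong weight′ position-r₀)
    (trans (cong sum (List.map-cong (λ v → cong (_+ height v) (mirror (position≤N v))) vertices))
      (sym (sum-reflect (λ p e → ∣ p - h ∣ + e)))))
    where
    mirror : ∀ {p} → p ≤ N → ∣ p - (h + δ) ∣ ≡ ∣ N ∸ p - h ∣
    mirror {p} p≤N with q , refl , e ← reflected p≤N = begin
      ∣ p - (h + δ) ∣          ≡⟨ ℕ.∣-∣-comm p (h + δ) ⟩
      ∣ h + δ - p ∣            ≡⟨ ℕ.∣m+n-m+o∣≡∣n-o∣ h (h + δ) p ⟨
      ∣ h + (h + δ) - h + p ∣  ≡⟨ cong ∣_- h + p ∣ e ⟨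
      ∣ q + p - h + p ∣        ≡⟨ cong₂ ∣_-_∣ (ℕ.+-comm q p) (ℕ.+-comm h p) ⟩
      ∣ p + q - p + h ∣        ≡⟨ ℕ.∣m+n-m+o∣≡∣n-o∣ p q h ⟩
      ∣ q - h ∣                ∎
      where open ≡-Reasoning

  -- Indicators of the three parts into which the centers divide the tree. No leaf hangs at a
  -- center, so level 0 describes the middle part.
  onLeft onMid onRight : Vertex → ℕ
  onLeft v  = 1 ⊓ (h ∸ position v)
  onMid v   = 1 ∸ L v
  onRight v = 1 ⊓ (position v ∸ (h + δ))

  Σ-onMid : sum (map onMid vertices) ≡ suc δ
  Σ-onMid = trans (sum-L (1 ∸_)) (trans (cong₂ _+_
    (cong₂ _+_ (cong (2 *_) (trans (∑-cong h (λ i _ → ℕ.0∸n≡0 i)) (trans (∑-const h 0) (ℕ.*-zeroʳ h))))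
      (ℕ.*-identityʳ (suc δ)))
    (trans (cong (k *_) (cong₂ _+_ (cong (2 *_) (ℕ.0∸n≡0 h)) (ℕ.*-zeroʳ (inner shape)))) (ℕ.*-zeroʳ k)))
    (ℕ.+-identityʳ (suc δ)))

  Σ-onLeft : sum (map onLeft vertices) ≡ sum (map onRight vertices)
  Σ-onLeft = trans (sum-reflect (λ p _ → 1 ⊓ (h ∸ p)))
    (cong sum (List.map-cong (λ v → cong (1 ⊓_) (mirror (position≤N v))) vertices))
    where
    mirror : ∀ {p} → p ≤ N → h ∸ (N ∸ p) ≡ p ∸ (h + δ)
    mirror {p} p≤N with q , refl , e ← reflected p≤N = begin
      h ∸ q                   ≡⟨ ℕ.[m+n]∸[m+o]≡n∸o p h q ⟨
      (p + h) ∸ (p + q)       ≡⟨ cong₂ _∸_ (ℕ.+-comm p h) (trans (ℕ.+-comm p q) e) ⟩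
      (h + p) ∸ (h + (h + δ)) ≡⟨ ℕ.[m+n]∸[m+o]≡n∸o h p (h + δ) ⟩
      p ∸ (h + δ)             ∎
      where open ≡-Reasoning

  split-left : ∀ v → (onLeft v ≡ 1 × onMid v + onRight v ≡ 0) ⊎ (onMid v + onRight v ≤ 1 × h ≤ position v)
  split-left v with h ∸ position v | position v ∸ (h + δ) | side (position v)
  ... | _ | _ | left t e     = inj₁ (refl , trans (ℕ.+-identityʳ _) (ℕ.0∸n≡0 (t + 0 + height v)))
  ... | _ | _ | mid h≤p _    = inj₂ (ℕ.≤-trans (ℕ.≤-reflexive (ℕ.+-identityʳ _)) (ℕ.m∸n≤m 1 (height v)) , h≤p)
  ... | _ | _ | right t e  = inj₂ (ℕ.≤-reflexive (cong (_+ 1) (ℕ.0∸n≡0 (t + height v))) ,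
    ℕ.≤-trans (ℕ.m≤m+n h δ) (ℕ.≤-trans (ℕ.m≤m+n (h + δ) (suc t)) (ℕ.≤-reflexive e)))

  split-right : ∀ v → (onRight v ≡ 1 × onMid v + onLeft v ≡ 0) ⊎ (onMid v + onLeft v ≤ 1 × position v ≤ h + δ)
  split-right v with h ∸ position v | position v ∸ (h + δ) | side (position v)
  ... | _ | _ | right t e  = inj₁ (refl , trans (ℕ.+-identityʳ _) (ℕ.0∸n≡0 (t + height v)))
  ... | _ | _ | mid _ p≤   = inj₂ (ℕ.≤-trans (ℕ.≤-reflexive (ℕ.+-identityʳ _)) (ℕ.m∸n≤m 1 (height v)) , p≤)
  ... | _ | _ | left t e   = inj₂ (ℕ.≤-reflexive (cong (_+ 1) (ℕ.0∸n≡0 (t + 0 + height v))) ,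
    ℕ.≤-trans (ℕ.m≤m+n _ (suc t)) (ℕ.≤-trans (ℕ.≤-reflexive e) (ℕ.m≤m+n h δ)))

  dist-≤-via : ∀ i u {U} → ∣ position u - toℕ i ∣ + height u ≤ U → ∀ x → dist T x (spine i) ≤ dist T x u + U
  dist-≤-via i u {U} le x = decide (x ≟ u)
    where
    decide : Dec (x ≡ u) → dist T x (spine i) ≤ dist T x u + U
    decide (yes refl) = ℕ.≤-trans (ℕ.≤-reflexive (dist-spine u i)) (ℕ.≤-trans le (ℕ.m≤n+m U _))
    decide (no x≢u)   = lin
      (dist T x (spine i) ∷ dist T x u ∷ ∣ position x - toℕ i ∣ ∷ ∣ position x - position u ∣ ∷ ∣ position u - toℕ i ∣
        ∷ height x ∷ height u ∷ U ∷ [])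
      (λ d d′ xi xu ui x u U →
        d :≤ xi ⊕ x ∷ xi :≤ xu ⊕ ui ∷ ui ⊕ u :≤ U ∷ xu ⊕ (x ⊕ u) :≤ d′ ∷ [] ⊢ d :≤ d′ ⊕ U)
      (ℕ.≤-reflexive (dist-spine x i) ∷ ℕ.∣-∣-triangle (position x) (position u) (toℕ i) ∷ le ∷ gap≤dist x u x≢u ∷ [])

  dist-+-≤ : ∀ i u x {U} → position x ≢ position u → ∣ position x - toℕ i ∣ + U ≤ ∣ position x - position u ∣ + height u →
             dist T x (spine i) + U ≤ dist T x u
  dist-+-≤ i u x {U} px≢pu le = lin
    (dist T x (spine i) ∷ dist T x u ∷ ∣ position x - toℕ i ∣ ∷ ∣ position x - position u ∣ ∷ height x ∷ height u ∷ U ∷ [])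
    (λ d d′ xi xu x u U → d :≤ xi ⊕ x ∷ xi ⊕ U :≤ xu ⊕ u ∷ xu ⊕ (x ⊕ u) :≤ d′ ∷ [] ⊢ d ⊕ U :≤ d′)
    (ℕ.≤-reflexive (dist-spine x i) ∷ le ∷ gap≤dist x u (px≢pu ∘ cong position) ∷ [])

  trade : ∀ {d d′ U} near far → (near ≡ 1 × far ≡ 0) ⊎ (far ≤ 1 × d + U ≤ d′) → d ≤ d′ + U → d + U * far ≤ d′ + U * near
  trade {d} {d′} {U} _ _ (inj₁ (refl , refl)) le =
    lin (d ∷ d′ ∷ U ∷ []) (λ d d′ U → d :≤ d′ ⊕ U ∷ [] ⊢ d ⊕ U ⊗ # 0 :≤ d′ ⊕ U ⊗ # 1) (le ∷ [])
  trade {d} {d′} {U} near _ (inj₂ (far≤1 , le)) _ =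
    ℕ.≤-trans (ℕ.+-monoʳ-≤ d (ℕ.≤-trans (ℕ.*-monoʳ-≤ U far≤1) (ℕ.≤-reflexive (ℕ.*-identityʳ U))))
      (ℕ.≤-trans le (ℕ.m≤m+n d′ (U * near)))

  -- Moving from a center to u brings the vertices on the side of u closer by at most L u,
  -- and puts all others farther by L u.
  shift-left : ∀ u t → position u + suc t ≡ h → ∀ x →
    dist T x l₀ + L u * (onMid x + onRight x) ≤ dist T x u + L u * onLeft x
  shift-left u t e x = trade (onLeft x) (onMid x + onRight x) (Sum.map₂ (λ (b , h≤x) → b , farther h≤x) (split-left x))
    (dist-≤-via _ u (ℕ.+-monoˡ-≤ (height u) near) x)
    where
    near : ∣ position u - toℕ (Fin.fromℕ< h<n) ∣ ≤ lvl (position u)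
    near rewrite position-l₀ | lvl-left t e =
      ∣-∣-≤ (ℕ.≤-trans (ℕ.m≤m+n _ (suc t)) (ℕ.≤-trans (ℕ.≤-reflexive e) (ℕ.m≤m+n h (suc t)))) (ℕ.≤-reflexive (sym e))
    farther : h ≤ position x → dist T x l₀ + L u ≤ dist T x u
    farther h≤x = dist-+-≤ _ u x (λ x≡u → ℕ.<⇒≱ (ℕ.m<m+n (position u) z<s) (subst₂ _≤_ (sym e) x≡u h≤x)) far
      where
      far : ∣ position x - toℕ (Fin.fromℕ< h<n) ∣ + L u ≤ ∣ position x - position u ∣ + height u
      far rewrite position-l₀ | lvl-left t e | ℕ.m≤n⇒∣n-m∣≡n∸m h≤x = ℕ.≤-trans (ℕ.≤-reflexive (sym (ℕ.+-assoc (position x ∸ h) (suc t) (height u))))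
        (ℕ.+-monoˡ-≤ (height u) (≤-∣-∣ (inj₂ (lin (position u ∷ t ∷ h ∷ position x ∷ position x ∸ h ∷ [])
          (λ u t h x xh → u ⊕ (# 1 ⊕ t) :≤ h ∷ h ⊕ xh :≤ x ∷ [] ⊢ u ⊕ (xh ⊕ (# 1 ⊕ t)) :≤ x)
          (ℕ.≤-reflexive e ∷ ℕ.≤-reflexive (ℕ.m+[n∸m]≡n h≤x) ∷ [])))))

  shift-right : ∀ u t → h + δ + suc t ≡ position u → ∀ x →
    dist T x r₀ + L u * (onMid x + onLeft x) ≤ dist T x u + L u * onRight x
  shift-right u t e x = trade (onRight x) (onMid x + onLeft x) (Sum.map₂ (λ (b , x≤) → b , farther x≤) (split-right x))
    (dist-≤-via _ u (ℕ.+-monoˡ-≤ (height u) near) x)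
    where
    near : ∣ position u - toℕ (Fin.fromℕ< h+δ<n) ∣ ≤ lvl (position u)
    near rewrite position-r₀ | lvl-right t e =
      ∣-∣-≤ (ℕ.≤-reflexive (sym e)) (ℕ.≤-trans (ℕ.m≤m+n _ (suc t)) (ℕ.≤-trans (ℕ.≤-reflexive e) (ℕ.m≤m+n _ (suc t))))
    farther : position x ≤ h + δ → dist T x r₀ + L u ≤ dist T x u
    farther x≤ = dist-+-≤ _ u x (λ x≡u → ℕ.<⇒≱ (ℕ.m<m+n (h + δ) z<s) (subst (_≤ h + δ) (trans x≡u (sym e)) x≤)) far
      where
      far : ∣ position x - toℕ (Fin.fromℕ< h+δ<n) ∣ + L u ≤ ∣ position x - position u ∣ + height u
      far rewrite position-r₀ | lvl-right t e | ℕ.m≤n⇒∣m-n∣≡n∸m x≤ = ℕ.≤-trans (ℕ.≤-reflexive (sym (ℕ.+-assoc (h + δ ∸ position x) (suc t) (height u))))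
        (ℕ.+-monoˡ-≤ (height u) (≤-∣-∣ {position x} {position u} (inj₁ (lin (position u ∷ t ∷ h + δ ∷ position x ∷ h + δ ∸ position x ∷ [])
          (λ u t h x xh → h ⊕ (# 1 ⊕ t) :≤ u ∷ x ⊕ xh :≤ h ∷ [] ⊢ x ⊕ (xh ⊕ (# 1 ⊕ t)) :≤ u)
          (ℕ.≤-reflexive e ∷ ℕ.≤-reflexive (ℕ.m+[n∸m]≡n x≤) ∷ [])))))

  -- Both sides have equally many vertices, so in the sum what is lost on one side is gained on the
  -- other. The 1 + δ vertices in the middle all become farther by `L u`; one of them suffices for
  -- the claim.
  sum-shift : ∀ c u (near far : Vertex → ℕ) → sum (map near vertices) ≡ sum (map far vertices) →
    (∀ x → dist T x c + L u * (onMid x + far x) ≤ dist T x u + L u * near x) →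
    weight T c + L u ≤ weight T u
  sum-shift c u near far balanced le = lin
    (weight T c ∷ weight T u ∷ L u ∷ δ ∷ sum (map near vertices) ∷ [])
    (λ c u U δ s → c ⊕ U ⊗ ((# 1 ⊕ δ) ⊕ s) :≤ u ⊕ U ⊗ s ∷ [] ⊢ c ⊕ U :≤ u)
    (subst₂ _≤_ left-total right-total (sum-mono vertices le) ∷ [])
    where
    U = L u
    left-total : sum (map (λ x → dist T x c + U * (onMid x + far x)) vertices) ≡
                 weight T c + U * (suc δ + sum (map near vertices))
    left-total = trans (sum-+ (λ x → dist T x c) _ vertices) (cong (weight T c +_)
      (trans (sum-* U (λ x → onMid x + far x) vertices) (cong (U *_)
        (trans (sum-+ onMid far vertices) (cong₂ _+_ Σ-onMid (sym balanced))))))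
    right-total : sum (map (λ x → dist T x u + U * near x) vertices) ≡ weight T u + U * sum (map near vertices)
    right-total = trans (sum-+ (λ x → dist T x u) _ vertices) (cong (weight T u +_) (sum-* U near vertices))

  mid⇒L≡0 : ∀ u → h ≤ position u → position u ≤ h + δ → L u ≡ 0
  mid⇒L≡0 (spine i)  h≤p p≤ = trans (ℕ.+-identityʳ _) (lvl-mid h≤p p≤)
  mid⇒L≡0 (leaf i x) h≤p p≤ = contradiction (lvl-mid h≤p p≤) (ℕ.>⇒≢ (leaf-lvl>0 i x))

  weight-center : ∀ {v} → v ≡ l₀ ⊎ v ≡ r₀ → weight T v ≡ weight′ h
  weight-center (inj₁ refl) = weight-l₀
  weight-center (inj₂ refl) = weight-r₀

  -- The margin `L u` shows at once that vertices of level 0 are minimizers and that there are no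
  -- others.
  weight-≥ : ∀ u → weight′ h + L u ≤ weight T u
  weight-≥ u = onSide (side (position u))
    where
    onSide : ∀ {a b} → Side (position u) a b → weight′ h + L u ≤ weight T u
    onSide (left t e)   = subst (λ w → w + L u ≤ weight T u) weight-l₀ (sum-shift l₀ u onLeft onRight Σ-onLeft (shift-left u t e))
    onSide (right t e)  = subst (λ w → w + L u ≤ weight T u) weight-r₀ (sum-shift r₀ u onRight onLeft (sym Σ-onLeft) (shift-right u t e))
    onSide (mid h≤p p≤) = ℕ.≤-reflexive (trans
      (trans (cong (weight′ h +_) (mid⇒L≡0 u h≤p p≤)) (ℕ.+-identityʳ (weight′ h)))
      (sym (weight-center (L≡0⇒center u (mid⇒L≡0 u h≤p p≤)))))

  weightCenter? : ∀ v → Dec (IsWeightCenter T v)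
  weightCenter? v = All.all? (λ u → weight T v ℕ.≤? weight T u) vertices

  L≡0⇒weightCenter : ∀ {v} → L v ≡ 0 → IsWeightCenter T v
  L≡0⇒weightCenter {v} e = All.tabulate λ {u} _ → ℕ.≤-trans (ℕ.≤-reflexive (weight-center (L≡0⇒center v e)))
    (ℕ.≤-trans (ℕ.m≤m+n _ (L u)) (weight-≥ u))

  weightCenter⇒L≡0 : ∀ {v} → IsWeightCenter T v → L v ≡ 0
  weightCenter⇒L≡0 {v} center = ℕ.n≤0⇒n≡0 (ℕ.+-cancelˡ-≤ (weight′ h) _ _ (ℕ.≤-trans (weight-≥ v)
    (ℕ.≤-trans (All.lookup center (complete l₀)) (ℕ.≤-reflexive (trans weight-l₀ (sym (ℕ.+-identityʳ _)))))))

  ∈-weightCenters⁺ : ∀ {v} → L v ≡ 0 → v ∈ weightCenters T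
  ∈-weightCenters⁺ e = ∈-filter⁺ weightCenter? (complete _) (L≡0⇒weightCenter e)

  ∈-weightCenters⁻ : ∀ {v} → v ∈ weightCenters T → L v ≡ 0
  ∈-weightCenters⁻ {v} v∈ = weightCenter⇒L≡0 {v} (proj₂ (∈-filter⁻ weightCenter? {v} {vertices} v∈))

  |weightCenters| : length (weightCenters T) ≡ suc δ
  |weightCenters| = trans (length-filter weightCenter? onMid vertices
    (λ v center → cong (1 ∸_) (weightCenter⇒L≡0 center))
    (λ v ¬center → notCenter (λ e → ¬center (L≡0⇒weightCenter e))))
    Σ-onMid
    where
    notCenter : ∀ {l} → l ≢ 0 → 1 ∸ l ≡ 0
    notCenter {zero}  l≢0 = contradiction refl l≢0
    notCenter {suc l} l≢0 = ℕ.0∸n≡0 l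

  lvl≤h : ∀ {p} → p ≤ N → lvl p ≤ h
  lvl≤h {p} p≤N = go (side p)
    where
    go : ∀ {a b} → Side p a b → lvl p ≤ h
    go (left t e) rewrite lvl-left t e = ℕ.≤-trans (ℕ.m≤n+m (suc t) p) (ℕ.≤-reflexive e)
    go (mid a b) rewrite lvl-mid a b = z≤n
    go (right t e) rewrite lvl-right t e = lin (h ∷ δ ∷ t ∷ p ∷ [])
      (λ h δ t p → h ⊕ δ ⊕ (# 1 ⊕ t) :≤ p ∷ p :≤ # 2 ⊗ h ⊕ δ ∷ [] ⊢ # 1 ⊕ t :≤ h) (ℕ.≤-reflexive e ∷ p≤N ∷ [])

  height≤1 : ∀ v → height v ≤ 1
  height≤1 (spine _)  = z≤n
  height≤1 (leaf _ _) = ℕ.≤-refl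

  L≤suc-h : ∀ v → L v ≤ suc h
  L≤suc-h v = ℕ.≤-trans (ℕ.+-mono-≤ (lvl≤h (position≤N v)) (height≤1 v)) (ℕ.≤-reflexive (ℕ.+-comm h 1))

  -- Diameter, levels and far vertices

  leafAt : ∀ {p} → p ∈ leafPositions → p < suc N → ∃[ v ] (position v ≡ p × height v ≡ 1)
  leafAt {p} p∈ p<n = leaf (Fin.fromℕ< p<n) (Fin.fromℕ< 0<leaves) , Fin.toℕ-fromℕ< p<n , refl
    where
    0<leaves : 0 < leaves (Fin.fromℕ< p<n)
    0<leaves = subst (0 <_) (sym (trans (cong leaves′ (Fin.toℕ-fromℕ< p<n)) (leaves′-∈ p∈))) 1≤k

  diam-≡ : diam T ≡ 2 + N
  diam-≡ = ℕ.≤-antisym (maxOverPairs-≤ T upper) lower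
    where
    upper : ∀ u v → dist T u v ≤ 2 + N
    upper u v = lin (dist T u v ∷ ∣ position u - position v ∣ ∷ height u ∷ height v ∷ N ∷ [])
      (λ d pq u v N → d :≤ pq ⊕ (u ⊕ v) ∷ pq :≤ N ∷ u :≤ # 1 ∷ v :≤ # 1 ∷ [] ⊢ d :≤ # 2 ⊕ N)
      (dist≤gap u v ∷ ∣-∣-≤ (ℕ.≤-trans (position≤N u) (ℕ.m≤n+m N (position v))) (ℕ.≤-trans (position≤N v) (ℕ.m≤n+m N (position u)))
        ∷ height≤1 u ∷ height≤1 v ∷ [])
    lower : 2 + N ≤ diam T
    lower = between (leafAt (∈-leafPositions (outerˡ refl)) z<s) (leafAt (∈-leafPositions (outerʳ refl)) ℕ.≤-refl)
      where
      between : ∃[ u ] (position u ≡ 0 × height u ≡ 1) → ∃[ v ] (position v ≡ N × height v ≡ 1) → 2 + N ≤ diam T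
      between (u , pu , hu) (v , pv , hv) = ℕ.≤-trans
        (ℕ.≤-reflexive (trans (ℕ.+-comm 2 N) (sym (cong₂ _+_ (cong₂ ∣_-_∣ pu pv) (cong₂ _+_ hu hv)))))
        (ℕ.≤-trans (gap≤dist u v (λ u≡v → 0≢N (trans (sym pu) (trans (cong position u≡v) pv)))) (≤-maxOverPairs T (dist T) u v))
        where
        0≢N : 0 ≢ N
        0≢N = ℕ.<⇒≢ (lin (h ∷ δ ∷ []) (λ h δ → # 1 :≤ h ∷ [] ⊢ # 1 :≤ # 2 ⊗ h ⊕ δ) (1≤h ∷ []))

  center-range : ∀ {c} → L c ≡ 0 → h ≤ position c × position c ≤ h + δ
  center-range {c} e = ℕ.m∸n≡0⇒m≤n (ℕ.m+n≡0⇒m≡0 _ (ℕ.m+n≡0⇒m≡0 (lvl (position c)) e)) ,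
                       ℕ.m∸n≡0⇒m≤n (ℕ.m+n≡0⇒n≡0 (h ∸ position c) (ℕ.m+n≡0⇒m≡0 (lvl (position c)) e))

  L≤dist-center : ∀ u {c} → L c ≡ 0 → L u ≤ dist T u c
  L≤dist-center u {c} e = decide (u ≟ c)
    where
    h≤c = proj₁ (center-range {c} e)
    c≤  = proj₂ (center-range {c} e)
    lvl≤ : ∀ {a b} → Side (position u) a b → lvl (position u) ≤ ∣ position u - position c ∣
    lvl≤ (left t e)  = ℕ.≤-trans (ℕ.≤-reflexive (lvl-left t e)) (≤-∣-∣ (inj₁ (ℕ.≤-trans (ℕ.≤-reflexive e) h≤c)))
    lvl≤ (mid a b)   = ℕ.≤-trans (ℕ.≤-reflexive (lvl-mid a b)) z≤n
    lvl≤ (right t e) = ℕ.≤-trans (ℕ.≤-reflexive (lvl-right t e))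
      (≤-∣-∣ (inj₂ (ℕ.≤-trans (ℕ.+-monoˡ-≤ (suc t) c≤) (ℕ.≤-reflexive e))))
    decide : Dec (u ≡ c) → L u ≤ dist T u c
    decide (yes refl) = subst (_≤ dist T u u) (sym e) z≤n
    decide (no u≢c)   = ℕ.≤-trans (ℕ.+-mono-≤ (lvl≤ (side (position u))) (ℕ.m≤m+n (height u) (height c))) (gap≤dist u c u≢c)

  L-l₀ : L l₀ ≡ 0
  L-l₀ = mid⇒L≡0 l₀ (ℕ.≤-reflexive (sym position-l₀)) (ℕ.≤-trans (ℕ.≤-reflexive position-l₀) (ℕ.m≤m+n h δ))

  L-r₀ : L r₀ ≡ 0
  L-r₀ = mid⇒L≡0 r₀ (ℕ.≤-trans (ℕ.m≤m+n h δ) (ℕ.≤-reflexive (sym position-r₀))) (ℕ.≤-reflexive position-r₀)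

  nearestCenter : ∀ u → ∃[ c ] (L c ≡ 0 × dist T u c ≤ L u)
  nearestCenter u = onSide (side (position u))
    where
    onSide : ∀ {a b} → Side (position u) a b → ∃[ c ] (L c ≡ 0 × dist T u c ≤ L u)
    onSide (left t e) = l₀ , L-l₀ , ℕ.≤-trans (ℕ.≤-reflexive (dist-spine u _)) (ℕ.+-monoˡ-≤ (height u)
      (subst₂ (λ c l → ∣ position u - c ∣ ≤ l) (sym position-l₀) (sym (lvl-left t e))
        (∣-∣-≤ (ℕ.≤-trans (ℕ.m≤m+n _ (suc t)) (ℕ.≤-trans (ℕ.≤-reflexive e) (ℕ.m≤m+n h (suc t)))) (ℕ.≤-reflexive (sym e)))))
    onSide (mid h≤p p≤) = u , mid⇒L≡0 u h≤p p≤ , ℕ.≤-trans (ℕ.≤-reflexive (dist-refl T u)) z≤n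
    onSide (right t e) = r₀ , L-r₀ , ℕ.≤-trans (ℕ.≤-reflexive (dist-spine u _)) (ℕ.+-monoˡ-≤ (height u)
      (subst₂ (λ c l → ∣ position u - c ∣ ≤ l) (sym position-r₀) (sym (lvl-right t e))
        (∣-∣-≤ (ℕ.≤-reflexive (sym e)) (ℕ.≤-trans (ℕ.m≤m+n _ (suc t)) (ℕ.≤-trans (ℕ.≤-reflexive e) (ℕ.m≤m+n _ (suc t)))))))

  level-≡ : ∀ u → level T u ≡ L u
  level-≡ u = ℕ.≤-antisym
    (min≤v⁺ (diam T) _ (inj₂ (Any.map (λ { refl → proj₂ (proj₂ (nearestCenter u)) })
      (∈-map⁺ (dist T u) (∈-weightCenters⁺ (proj₁ (proj₂ (nearestCenter u))))))))
    -- The default value of the minimum has to be bounded from below as well: levels are at most h +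
    -- 1, hence at most the diameter.
    (v≤min⁺ (ℕ.≤-trans (L≤suc-h u) (subst (suc h ≤_) (sym diam-≡)
        (lin (h ∷ δ ∷ []) (λ h δ → [] ⊢ # 1 ⊕ h :≤ # 2 ⊕ (# 2 ⊗ h ⊕ δ)) [])))
      (All.map⁺ (All.tabulate λ c∈ → L≤dist-center u (∈-weightCenters⁻ c∈))))

  totalLevel-≡ : totalLevel T ≡ sum (map L vertices)
  totalLevel-≡ = cong sum (List.map-cong level-≡ vertices)

  levelBound-≡ : levelBound T ≡ suc h
  levelBound-≡ = trans
    (cong₂ (λ c d → if c ≡ᵇ 1 then ⌈ d /2⌉ else ⌊ d /2⌋) |weightCenters| diam-≡) (go δ≤1)
    where
    go : ∀ {d} → d ≤ 1 → (if suc d ≡ᵇ 1 then ⌈ 2 + (2 * h + d) /2⌉ else ⌊ 2 + (2 * h + d) /2⌋) ≡ suc h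
    go z≤n       rewrite ℕ.+-identityʳ (2 * h) | ℕ.+-identityʳ h = cong suc (sym (ℕ.n≡⌈n+n/2⌉ h))
    -- Since `⌈ m /2⌉` is by definition `⌊ suc m /2⌋`, the rounded-down half of the odd diameter is
    -- covered by the same equation.
    go (s≤s z≤n) rewrite ℕ.+-comm (2 * h) 1 | ℕ.+-identityʳ h    = cong suc (sym (ℕ.n≡⌈n+n/2⌉ h))

  |farVertices| : length (farVertices T) ≡ sum (map (λ v → L v ∸ h) vertices)
  |farVertices| = length-filter (λ v → levelBound T ℕ.≤? level T v) (λ v → L v ∸ h) vertices
    (λ v far → far-≡1 (subst₂ _≤_ levelBound-≡ (level-≡ v) far) (L≤suc-h v))
    (λ v ¬far → ℕ.m≤n⇒m∸n≡0 (s≤s⁻¹ (ℕ.≰⇒> (λ far → ¬far (subst₂ _≤_ (sym levelBound-≡) (sym (level-≡ v)) far)))))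
    where
    far-≡1 : ∀ {l} → suc h ≤ l → l ≤ suc h → l ∸ h ≡ 1
    far-≡1 a b rewrite ℕ.≤-antisym b a = ℕ.m+n∸n≡m 1 h

  -- Lower bound

  farness centrality : Vertex → ℕ
  farness v    = L v ∸ h
  centrality v = 1 ∸ L v

  D : ℕ
  D = 2 * h + 3

  gap≤L : ∀ u v → gap u v ≤ L u + L v + δ
  gap≤L u v = lin (∣ position u - position v ∣ ∷ lvl (position u) ∷ lvl (position v) ∷ height u ∷ height v ∷ δ ∷ [])
    (λ d a b u v δ → d :≤ a ⊕ b ⊕ δ ∷ [] ⊢ d ⊕ (u ⊕ v) :≤ (a ⊕ u) ⊕ (b ⊕ v) ⊕ δ)
    (∣-∣-≤ (half-≤ (position u) (position v)) (ℕ.≤-trans (half-≤ (position v) (position u))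
      (ℕ.≤-reflexive (cong (λ x → position u + (x + δ)) (ℕ.+-comm (lvl (position v)) _)))) ∷ [])
    where
    half-≤ : ∀ p q → p ≤ q + (lvl p + lvl q + δ)
    half-≤ p q = lin (p ∷ q ∷ h ∷ δ ∷ h ∸ p ∷ p ∸ (h + δ) ∷ h ∸ q ∷ q ∸ (h + δ) ∷ [])
      (λ p q h δ a b c d → p :≤ h ⊕ δ ⊕ b ∷ h :≤ q ⊕ c ∷ [] ⊢ p :≤ q ⊕ ((a ⊕ b) ⊕ (c ⊕ d) ⊕ δ))
      (ℕ.m≤n+m∸n p (h + δ) ∷ ℕ.m≤n+m∸n h q ∷ [])

  gap-left : ∀ u v {s t} → position u + suc s ≡ h → position v + suc t ≡ h → gap u v + 2 ≤ L u + L v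
  gap-left u v {s} {t} e e′ rewrite lvl-left s e | lvl-left t e′ =
    lin (∣ position u - position v ∣ ∷ s ∷ t ∷ height u ∷ height v ∷ [])
      (λ d s t u v → d :≤ s ⊕ t ∷ [] ⊢ d ⊕ (u ⊕ v) ⊕ # 2 :≤ (# 1 ⊕ s ⊕ u) ⊕ (# 1 ⊕ t ⊕ v))
      (∣-∣-≤ (bound e e′) (ℕ.≤-trans (bound e′ e) (ℕ.≤-reflexive (cong (position u +_) (ℕ.+-comm t s)))) ∷ [])
    where
    bound : ∀ {p q s t} → p + suc s ≡ h → q + suc t ≡ h → p ≤ q + (s + t)
    bound {p} {q} {s} {t} e e′ = lin (p ∷ q ∷ s ∷ t ∷ h ∷ [])
      (λ p q s t h → p ⊕ (# 1 ⊕ s) :≤ h ∷ h :≤ q ⊕ (# 1 ⊕ t) ∷ [] ⊢ p :≤ q ⊕ (s ⊕ t))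
      (ℕ.≤-reflexive e ∷ ℕ.≤-reflexive (sym e′) ∷ [])

  gap-right : ∀ u v {s t} → h + δ + suc s ≡ position u → h + δ + suc t ≡ position v → gap u v + 2 ≤ L u + L v
  gap-right u v {s} {t} e e′ rewrite lvl-right s e | lvl-right t e′ =
    lin (∣ position u - position v ∣ ∷ s ∷ t ∷ height u ∷ height v ∷ [])
      (λ d s t u v → d :≤ s ⊕ t ∷ [] ⊢ d ⊕ (u ⊕ v) ⊕ # 2 :≤ (# 1 ⊕ s ⊕ u) ⊕ (# 1 ⊕ t ⊕ v))
      (∣-∣-≤ (bound e e′) (ℕ.≤-trans (bound e′ e) (ℕ.≤-reflexive (cong (position u +_) (ℕ.+-comm t s)))) ∷ [])
    where
    bound : ∀ {p q s t} → h + δ + suc s ≡ p → h + δ + suc t ≡ q → p ≤ q + (s + t)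
    bound {p} {q} {s} {t} e e′ = lin (p ∷ q ∷ s ∷ t ∷ h + δ ∷ [])
      (λ p q s t h → p :≤ h ⊕ (# 1 ⊕ s) ∷ h ⊕ (# 1 ⊕ t) :≤ q ∷ [] ⊢ p :≤ q ⊕ (s ⊕ t))
      (ℕ.≤-reflexive (sym e) ∷ ℕ.≤-reflexive e′ ∷ [])

  farness≤1 : ∀ v → farness v ≤ 1
  farness≤1 v = ℕ.≤-trans (ℕ.∸-monoˡ-≤ h (L≤suc-h v)) (ℕ.≤-reflexive (ℕ.m+n∸n≡m 1 h))

  -- In `xy` and `yz` the shared side improves one of the two pair bounds. In `xz` both pair bounds
  -- are given up for a direct comparison of x and z, which pays only if y is far.
  data Excess (x y z : Vertex) : Set where
    none : farness y ≤ centrality x + centrality z → Excess x y z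
    xy   : gap x y + 2 ≤ L x + L y → Excess x y z
    yz   : gap y z + 2 ≤ L y + L z → Excess x y z
    xz   : h < L y → gap x z + 2 ≤ L x + L z → Excess x y z

  excess : ∀ x y z → Excess x y z
  excess x y z = go (side (position x)) (side (position y)) (side (position z))
    where
    center-1 : ∀ u → h ≤ position u → position u ≤ h + δ → centrality u ≡ 1
    center-1 u h≤p p≤ = cong (1 ∸_) (mid⇒L≡0 u h≤p p≤)
    far : farness y ≤ centrality x + centrality z ⊎ h < L y
    far with h ℕ.<? L y
    ... | yes h<L = inj₂ h<L
    ... | no h≮L  = inj₁ (ℕ.≤-trans (ℕ.≤-reflexive (ℕ.m≤n⇒m∸n≡0 (ℕ.≮⇒≥ h≮L))) z≤n)
    opposite : gap x z + 2 ≤ L x + L z → Excess x y z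
    opposite le with far
    ... | inj₁ e   = none e
    ... | inj₂ h<L = xz h<L le
    go : ∀ {a a′ b b′ c c′} → Side (position x) a a′ → Side (position y) b b′ → Side (position z) c c′ → Excess x y z
    go (mid h≤p p≤) _ _ = none (ℕ.≤-trans (farness≤1 y)
      (ℕ.≤-trans (ℕ.≤-reflexive (sym (center-1 x h≤p p≤))) (ℕ.m≤m+n _ _)))
    go _ _ (mid h≤p p≤) = none (ℕ.≤-trans (farness≤1 y)
      (ℕ.≤-trans (ℕ.≤-reflexive (sym (center-1 z h≤p p≤))) (ℕ.m≤n+m _ _)))
    go _ (mid h≤p p≤) _ = none (ℕ.≤-trans (ℕ.≤-reflexive (trans (cong (_∸ h) (mid⇒L≡0 y h≤p p≤)) (ℕ.0∸n≡0 h))) z≤n)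
    go (left _ e)  (left _ e′)  _            = xy (gap-left x y e e′)
    go (right _ e) (right _ e′) _            = xy (gap-right x y e e′)
    go _           (left _ e)   (left _ e′)  = yz (gap-left y z e e′)
    go _           (right _ e)  (right _ e′) = yz (gap-right y z e e′)
    go (left _ e)  (right _ _)  (left _ e′)  = opposite (gap-left x z e e′)
    go (right _ e) (left _ _)   (right _ e′) = opposite (gap-right x z e e′)

  δ-cases : ∀ {d} → d ≤ 1 → d ≡ 0 ⊎ d ≡ 1
  δ-cases z≤n       = inj₁ refl
  δ-cases (s≤s z≤n) = inj₂ refl

  -- An end of the ordering is the middle of no triple, so its farness earns nothing; in return its
  -- level enters the doubled sum twice instead of four times. Since h ≥ 1 and κ ≤ 2, the return
  -- outweighs the loss, with equality at a center.
  end-bound : ∀ v → 2 + suc δ * farness v ≤ 2 * L v + 2 * centrality v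
  end-bound v = ℕ.≤-trans (ℕ.+-monoʳ-≤ 2 (ℕ.*-monoˡ-≤ (farness v) (s≤s δ≤1))) (go (L v))
    where
    go : ∀ l → 2 + 2 * (l ∸ h) ≤ 2 * l + 2 * (1 ∸ l)
    go zero    = ℕ.≤-reflexive (cong (λ x → 2 + 2 * x) (ℕ.0∸n≡0 h))
    go (suc l) = ℕ.≤-trans (ℕ.+-monoʳ-≤ 2 (ℕ.*-monoʳ-≤ 2 (ℕ.∸-monoʳ-≤ (suc l) 1≤h)))
      (ℕ.≤-trans (ℕ.≤-reflexive (sym (ℕ.*-suc 2 l))) (ℕ.m≤m+n (2 * suc l) _))

  -- For κ = 2 both sides are equal. For κ = 1 the claim is that the two ends are not both centers,
  -- which holds because they are distinct and there is only one center.
  centrality-ends : ∀ {u v} → u ≢ v →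
    2 * (centrality u + centrality v) + suc δ ≤ suc δ * (centrality u + centrality v) + 2
  centrality-ends {u} {v} u≢v with δ-cases δ≤1
  ... | inj₂ δ≡1 = lin (centrality u + centrality v ∷ δ ∷ [])
    (λ c δ → c ⊗ # 1 :≤ c ⊗ δ ∷ δ :≤ # 1 ∷ [] ⊢ # 2 ⊗ c ⊕ (# 1 ⊕ δ) :≤ (# 1 ⊕ δ) ⊗ c ⊕ # 2)
    (ℕ.≤-reflexive (cong ((centrality u + centrality v) *_) (sym δ≡1)) ∷ δ≤1 ∷ [])
  ... | inj₁ δ≡0 = lin (centrality u + centrality v ∷ δ ∷ [])
    (λ c δ → c :≤ # 1 ∷ δ :≤ # 0 ∷ [] ⊢ # 2 ⊗ c ⊕ (# 1 ⊕ δ) :≤ (# 1 ⊕ δ) ⊗ c ⊕ # 2)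
    (c≤1 (L u) (L v) refl refl ∷ ℕ.≤-reflexive δ≡0 ∷ [])
    where
    l₀≡r₀ : l₀ ≡ r₀
    l₀≡r₀ = spine-≡ (trans position-l₀ (trans (sym (ℕ.+-identityʳ h)) (trans (cong (h +_) (sym δ≡0)) (sym position-r₀))))
    same : ∀ {a b} → a ≡ l₀ ⊎ a ≡ r₀ → b ≡ l₀ ⊎ b ≡ r₀ → a ≡ b
    same (inj₁ a) (inj₁ b) = trans a (sym b)
    same (inj₁ a) (inj₂ b) = trans a (trans l₀≡r₀ (sym b))
    same (inj₂ a) (inj₁ b) = trans a (trans (sym l₀≡r₀) (sym b))
    same (inj₂ a) (inj₂ b) = trans a (sym b)
    c≤1 : ∀ l m → L u ≡ l → L v ≡ m → (1 ∸ l) + (1 ∸ m) ≤ 1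
    c≤1 zero zero e e′ = contradiction (same (L≡0⇒center u e) (L≡0⇒center v e′)) u≢v
    c≤1 zero (suc m) _ _ rewrite ℕ.0∸n≡0 m = ℕ.≤-refl
    c≤1 (suc l) m _ _ rewrite ℕ.0∸n≡0 l = ℕ.m∸n≤m 1 m

  module LowerBound (f : Vertex → ℕ) (radio : IsRadioLabelling T f) where

    Spaced : Vertex → Vertex → Set
    Spaced u v = 3 + N + f u ≤ f v + gap u v

    spaced : ∀ {u v} → u ≢ v × f u ≤ f v → Spaced u v
    spaced {u} {v} (u≢v , fu≤fv) = lin (diam T ∷ dist T u v ∷ ∣ f u - f v ∣ ∷ f u ∷ f v ∷ gap u v ∷ N ∷ [])
      (λ d uv fuv fu fv g N → # 2 ⊕ N :≤ d ∷ d ⊕ # 1 :≤ uv ⊕ fuv ∷ fuv ⊕ fu :≤ fv ∷ uv :≤ g ∷ [] ⊢ # 3 ⊕ N ⊕ fu :≤ fv ⊕ g)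
      (ℕ.≤-reflexive (sym diam-≡)
        ∷ ℕ.≤-trans (ℕ.m≤n+m∸n (diam T + 1) (dist T u v)) (ℕ.+-monoʳ-≤ (dist T u v) (radio u v u≢v))
        ∷ ℕ.≤-reflexive (trans (cong (_+ f u) (ℕ.m≤n⇒∣m-n∣≡n∸m fu≤fv)) (ℕ.m∸n+n≡m fu≤fv)) ∷ dist≤gap u v ∷ [])

    κ : ℕ
    κ = suc δ

    pair : ∀ {x y} → Spaced x y → D + f x ≤ f y + (L x + L y)
    pair {x} {y} Sxy = lin (f x ∷ f y ∷ L x ∷ L y ∷ gap x y ∷ h ∷ δ ∷ [])
      (λ fx fy Lx Ly g h δ → # 3 ⊕ (# 2 ⊗ h ⊕ δ) ⊕ fx :≤ fy ⊕ g ∷ g :≤ Lx ⊕ Ly ⊕ δ ∷ [] ⊢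
        # 2 ⊗ h ⊕ # 3 ⊕ fx :≤ fy ⊕ (Lx ⊕ Ly))
      (Sxy ∷ gap≤L x y ∷ [])

    -- A shared side makes a distance at least 2 + δ smaller than the bound `gap≤L`, more than the
    -- required κ; only the comparison across y is tight.
    triple : ∀ {x y z} → Spaced x y → Spaced y z → Spaced x z →
             2 * D + f x + κ * farness y ≤ f z + (L x + 2 * L y + L z) + κ * (centrality x + centrality z)
    triple {x} {y} {z} Sxy Syz Sxz = go (excess x y z)
      where
      κ*far≤κ : κ * farness y ≤ κ * 1
      κ*far≤κ = ℕ.*-monoʳ-≤ κ (farness≤1 y)
      go : Excess x y z → _
      go (none e) = lin
        (f x ∷ f y ∷ f z ∷ L x ∷ L y ∷ L z ∷ D ∷ κ * farness y ∷ κ * (centrality x + centrality z) ∷ [])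
        (λ fx fy fz Lx Ly Lz D s c → D ⊕ fx :≤ fy ⊕ (Lx ⊕ Ly) ∷ D ⊕ fy :≤ fz ⊕ (Ly ⊕ Lz) ∷ s :≤ c ∷ [] ⊢
          # 2 ⊗ D ⊕ fx ⊕ s :≤ fz ⊕ (Lx ⊕ # 2 ⊗ Ly ⊕ Lz) ⊕ c)
        (pair Sxy ∷ pair Syz ∷ ℕ.*-monoʳ-≤ κ e ∷ [])
      go (xy g) = lin
        (f x ∷ f y ∷ f z ∷ L x ∷ L y ∷ L z ∷ gap x y ∷ h ∷ δ ∷ κ * farness y ∷ κ * (centrality x + centrality z) ∷ [])
        (λ fx fy fz Lx Ly Lz g h δ s c →
          # 3 ⊕ (# 2 ⊗ h ⊕ δ) ⊕ fx :≤ fy ⊕ g ∷ (# 2 ⊗ h ⊕ # 3) ⊕ fy :≤ fz ⊕ (Ly ⊕ Lz)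
          ∷ g ⊕ # 2 :≤ Lx ⊕ Ly ∷ s :≤ (# 1 ⊕ δ) ⊗ # 1 ∷ [] ⊢
          # 2 ⊗ (# 2 ⊗ h ⊕ # 3) ⊕ fx ⊕ s :≤ fz ⊕ (Lx ⊕ # 2 ⊗ Ly ⊕ Lz) ⊕ c)
        (Sxy ∷ pair Syz ∷ g ∷ κ*far≤κ ∷ [])
      go (yz g) = lin
        (f x ∷ f y ∷ f z ∷ L x ∷ L y ∷ L z ∷ gap y z ∷ h ∷ δ ∷ κ * farness y ∷ κ * (centrality x + centrality z) ∷ [])
        (λ fx fy fz Lx Ly Lz g h δ s c →
          # 3 ⊕ (# 2 ⊗ h ⊕ δ) ⊕ fy :≤ fz ⊕ g ∷ (# 2 ⊗ h ⊕ # 3) ⊕ fx :≤ fy ⊕ (Lx ⊕ Ly)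
          ∷ g ⊕ # 2 :≤ Ly ⊕ Lz ∷ s :≤ (# 1 ⊕ δ) ⊗ # 1 ∷ [] ⊢
          # 2 ⊗ (# 2 ⊗ h ⊕ # 3) ⊕ fx ⊕ s :≤ fz ⊕ (Lx ⊕ # 2 ⊗ Ly ⊕ Lz) ⊕ c)
        (Syz ∷ pair Sxy ∷ g ∷ κ*far≤κ ∷ [])
      -- The direct bound exceeds `D` minus the levels of x and z by 2 + δ. The second `D` is
      -- replaced by twice `L y`, at least 2h + 2 = `D` - 1, at a loss of 1. What remains is κ = 1 +
      -- δ.
      go (xz h<L g) = lin
        (f x ∷ f z ∷ L x ∷ L y ∷ L z ∷ gap x z ∷ h ∷ δ ∷ κ * farness y ∷ κ * (centrality x + centrality z) ∷ [])
        (λ fx fz Lx Ly Lz g h δ s c →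
          # 3 ⊕ (# 2 ⊗ h ⊕ δ) ⊕ fx :≤ fz ⊕ g ∷ # 1 ⊕ h :≤ Ly ∷ # 1 ⊕ h :≤ Ly
          ∷ g ⊕ # 2 :≤ Lx ⊕ Lz ∷ s :≤ (# 1 ⊕ δ) ⊗ # 1 ∷ [] ⊢
          # 2 ⊗ (# 2 ⊗ h ⊕ # 3) ⊕ fx ⊕ s :≤ fz ⊕ (Lx ⊕ # 2 ⊗ Ly ⊕ Lz) ⊕ c)
        (Sxz ∷ h<L ∷ h<L ∷ g ∷ κ*far≤κ ∷ [])

    open Telescope f L farness centrality D κ Spaced pair triple using (telescope)

    lowerBound : radioNumber h δ k P ≤ span T f
    lowerBound = go (sortBy f unique)
      where
      go : ∃[ xs ] (xs ↭ vertices × AllPairs (λ u v → u ≢ v × f u ≤ f v) xs) → radioNumber h δ k P ≤ span T f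
      go ([] , perm , _) = contradiction (∈-resp-↭ (↭-sym perm) (complete l₀)) λ ()
      go (x ∷ [] , perm , _) = contradiction (trans (↭-length perm) order-≡) (ℕ.<⇒≢ 1<order)
        where
        1<order : 1 < 2 * h + suc δ + k * (2 + inner shape)
        1<order = lin (h ∷ δ ∷ k * (2 + inner shape) ∷ []) (λ h δ r → # 1 :≤ h ∷ [] ⊢ # 2 :≤ # 2 ⊗ h ⊕ (# 1 ⊕ δ) ⊕ r) (1≤h ∷ [])
      go (xs@(x ∷ y ∷ zs) , perm , sorted@(x< ∷ _)) = ℕ.≤-trans difference (≤-maxOverPairs T (λ u v → ∣ f u - f v ∣) x ℓ)
        where
        ℓ = lastOf y zs
        x<ℓ : x ≢ ℓ × f x ≤ f ℓ
        x<ℓ = All.lookup x< (lastOf-∈ y zs)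
        sum-perm : ∀ g → sum (map g xs) ≡ sum (map g vertices)
        sum-perm g = sum-↭ (↭-map⁺ g perm)
        combined : 2 * (1 + length zs) * D + 2 * f x + κ * (2 * k) + 2 + κ
                   ≤ 2 * f ℓ + 4 * sum (map L vertices) + κ * (2 * κ)
        combined = lin
          (f x ∷ f ℓ ∷ L x ∷ L ℓ ∷ farness x ∷ farness ℓ ∷ centrality x ∷ centrality ℓ
            ∷ sum (map L vertices) ∷ sum (map farness xs) ∷ sum (map centrality xs) ∷ sum (map L xs)
            ∷ length zs ∷ D ∷ κ ∷ k ∷ [])
          (λ fx fℓ Lx Lℓ sx sℓ cx cℓ ΣL Σs Σc ΣL′ m D κ k →
            # 2 ⊗ (# 1 ⊕ m) ⊗ D ⊕ # 2 ⊗ fx ⊕ # 2 ⊗ (Lx ⊕ Lℓ) ⊕ κ ⊗ (Σs ⊕ (cx ⊕ cℓ))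
              :≤ # 2 ⊗ fℓ ⊕ # 4 ⊗ ΣL′ ⊕ κ ⊗ (sx ⊕ sℓ ⊕ # 2 ⊗ Σc)
            ∷ # 2 ⊕ κ ⊗ sx :≤ # 2 ⊗ Lx ⊕ # 2 ⊗ cx
            ∷ # 2 ⊕ κ ⊗ sℓ :≤ # 2 ⊗ Lℓ ⊕ # 2 ⊗ cℓ
            ∷ # 2 ⊗ (cx ⊕ cℓ) ⊕ κ :≤ κ ⊗ (cx ⊕ cℓ) ⊕ # 2
            ∷ # 4 ⊗ ΣL′ :≤ # 4 ⊗ ΣL
            ∷ κ ⊗ (# 2 ⊗ k) :≤ κ ⊗ Σs
            ∷ κ ⊗ (# 2 ⊗ Σc) :≤ κ ⊗ (# 2 ⊗ κ)
            ∷ [] ⊢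
            # 2 ⊗ (# 1 ⊕ m) ⊗ D ⊕ # 2 ⊗ fx ⊕ κ ⊗ (# 2 ⊗ k) ⊕ # 2 ⊕ κ :≤ # 2 ⊗ fℓ ⊕ # 4 ⊗ ΣL ⊕ κ ⊗ (# 2 ⊗ κ))
          (telescope x y zs (AllPairs.map spaced sorted) ∷ end-bound x ∷ end-bound ℓ ∷ centrality-ends (proj₁ x<ℓ)
            ∷ ℕ.≤-reflexive (cong (4 *_) (sum-perm L))
            ∷ ℕ.≤-reflexive (cong (κ *_) (sym (trans (sum-perm farness) Σ-far)))
            ∷ ℕ.≤-reflexive (cong (λ c → κ * (2 * c)) (trans (sum-perm centrality) Σ-onMid)) ∷ [])
        difference : radioNumber h δ k P ≤ ∣ f x - f ℓ ∣
        difference = subst (radioNumber h δ k P ≤_) (sym (ℕ.m≤n⇒∣m-n∣≡n∸m (proj₂ x<ℓ)))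
          (ℕ.m+n≤o⇒m≤o∸n (radioNumber h δ k P)
            (radioNumber-≤ {m = length zs} {f x} {f ℓ} δ≤1 shape (trans (↭-length perm) order-≡) Σ-L combined))

  -- Upper bound

  -- With the left center at 0, the first leaf takes its least possible label h + 2. For δ = 0 this
  -- leaf is of kind A at offset 0. For δ = 1 block 0 has no A and begins with B at offset 3, so
  -- `start` is lowered by 3. `base` is the least label that the last leaf leaves to `lf 0`: the
  -- difference is 2h after b, and 2 after B if h = 1.
  start base : ℕ
  start = h + 2 ∸ 3 * δ
  base  = start + h + P * k

  start-≡ : start + 3 * δ ≡ h + 2
  start-≡ = ℕ.m∸n+n≡m (lin (h ∷ δ ∷ []) (λ h δ → # 1 :≤ h ∷ δ :≤ # 1 ∷ δ :≤ # 1 ∷ δ :≤ # 1 ∷ [] ⊢ # 3 ⊗ δ :≤ h ⊕ # 2)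
    (1≤h ∷ δ≤1 ∷ δ≤1 ∷ δ≤1 ∷ []))

  -- Leaves of one kind are at distance 2, so labels of successive blocks have to differ by at least
  -- d - 1 = 2h + 1 + δ. For h = 1 this determines the period.
  P-min : ∀ {h δ P} → Shape h δ P → 2 * h + 1 + δ ≤ P
  P-min (short refl) = ℕ.≤-refl
  P-min {h} {δ} (long _) = lin (h ∷ δ ∷ []) (λ h δ → [] ⊢ # 2 ⊗ h ⊕ # 1 ⊕ δ :≤ # 4 ⊗ h ⊕ # 1 ⊕ δ) []

  Pm : 2 * h + 1 + δ ≤ P
  Pm = P-min shape

  -- The leaves at the ends (A, B) and, if h ≥ 2, next to the centers (a, b).
  data Kind : Set where
    A B a b : Kind

  data Allowed : Kind → Set where
    A : Allowed A
    B : Allowed B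
    a : 2 ≤ h → P ≡ 4 * h + 1 + δ → Allowed a
    b : 2 ≤ h → P ≡ 4 * h + 1 + δ → Allowed b

  -- c is the center at h and z the leaf that is moved behind the spine; lf s and rt s are
  -- the spine vertices at positions h - 1 - s and 2h + δ - s, so that rt h is the right
  -- center if δ = 1; lv κ i is the leaf of kind κ in block i.
  data Role : Set where
    c z   : Role
    lf rt : ℕ → Role
    lv    : Kind → ℕ → Role

  kindPos offset : Kind → ℕ
  kindPos A = 0
  kindPos B = N
  kindPos a = pred h
  kindPos b = suc (h + δ)
  offset A = 0
  offset B = 2 + δ
  offset a = h + 2 + δ
  offset b = 3 * h + 1 + δ

  -- The levels of `lf s` and `rt s` add up to h + 1, those of `rt s` and `lf (suc s)` to h + 2, so
  -- least differences alternate between h + 2 and h + 1 and repeat with period `D`. The leaf `z` of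
  -- level h + 1 continues the sequence in the place of `lf h`.
  pos ht lab index : Role → ℕ
  pos c        = h
  pos z        = 0
  pos (lf s)   = h ∸ suc s
  pos (rt s)   = N ∸ s
  pos (lv κ _) = kindPos κ
  ht c        = 0
  ht z        = 1
  ht (lf s)   = 0
  ht (rt s)   = 0
  ht (lv _ _) = 1
  lab c        = 0
  lab z        = base + D * h
  lab (lf s)   = base + D * s
  lab (rt s)   = base + D * s + (h + 2)
  lab (lv κ i) = start + P * i + offset κ
  index (lv _ i) = i
  index _        = 0

  -- If δ = 1, the leaf of kind A with index 0 has role z; this is the room 4δ ≤ P i.
  data Valid : Role → Set where
    c  : Valid c
    z  : δ ≡ 1 → Valid z
    lf : ∀ {s} → s < h → Valid (lf s)
    rt : ∀ {s} → s < h + δ → Valid (rt s)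
    lv : ∀ {κ i} → Allowed κ → i < k → (κ ≡ A → 4 * δ ≤ P * i) → Valid (lv κ i)

  separation : Role → Role → ℕ
  separation r r′ = ∣ pos r - pos r′ ∣ + (ht r + ht r′)

  -- The radio condition for a label that comes later, free of subtraction; 3 + `N` is the diameter
  -- plus 1.
  Fwd : Role → Role → Set
  Fwd r r′ = 3 + N + lab r ≤ lab r′ + separation r r′

  -- Radio condition between leaves

  kindGap : Kind → Kind → ℕ
  kindGap κ κ′ = ∣ kindPos κ - kindPos κ′ ∣

  P≡-≥ : P ≡ 4 * h + 1 + δ → 4 * h + 1 + δ ≤ P
  P≡-≥ e = ℕ.≤-reflexive (sym e)

  -- Later blocks only increase the difference of labels, so the block immediately after is the
  -- critical one.
  next-block : ∀ {κ κ′} → Allowed κ → Allowed κ′ → 3 + N + offset κ ≤ P + offset κ′ + (kindGap κ κ′ + 2)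
  next-block {κ′ = κ′} A _ = lin (h ∷ δ ∷ P ∷ offset κ′ ∷ kindGap A κ′ ∷ [])
    (λ h δ P o g → # 2 ⊗ h ⊕ # 1 ⊕ δ :≤ P ∷ [] ⊢ # 3 ⊕ (# 2 ⊗ h ⊕ δ) ⊕ # 0 :≤ P ⊕ o ⊕ (g ⊕ # 2)) (Pm ∷ [])
  next-block B A = lin (h ∷ δ ∷ P ∷ kindGap B A ∷ [])
    (λ h δ P g → # 2 ⊗ h ⊕ # 1 ⊕ δ :≤ P ∷ # 1 :≤ h ∷ # 1 :≤ h ∷ # 2 ⊗ h ⊕ δ :≤ g ∷ [] ⊢ # 3 ⊕ (# 2 ⊗ h ⊕ δ) ⊕ (# 2 ⊕ δ) :≤ P ⊕ # 0 ⊕ (g ⊕ # 2))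
    (Pm ∷ 1≤h ∷ 1≤h ∷ ≤-∣-∣ {N} {0} (inj₂ ℕ.≤-refl) ∷ [])
  next-block B B = lin (h ∷ δ ∷ P ∷ kindGap B B ∷ [])
    (λ h δ P g → # 2 ⊗ h ⊕ # 1 ⊕ δ :≤ P ∷ [] ⊢ # 3 ⊕ (# 2 ⊗ h ⊕ δ) ⊕ (# 2 ⊕ δ) :≤ P ⊕ (# 2 ⊕ δ) ⊕ (g ⊕ # 2)) (Pm ∷ [])
  next-block B (a _ P≡) = lin (h ∷ δ ∷ P ∷ kindGap B a ∷ [])
    (λ h δ P g → # 4 ⊗ h ⊕ # 1 ⊕ δ :≤ P ∷ [] ⊢ # 3 ⊕ (# 2 ⊗ h ⊕ δ) ⊕ (# 2 ⊕ δ) :≤ P ⊕ (h ⊕ # 2 ⊕ δ) ⊕ (g ⊕ # 2)) (P≡-≥ P≡ ∷ [])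
  next-block B (b 2≤h P≡) = lin (h ∷ δ ∷ P ∷ kindGap B b ∷ [])
    (λ h δ P g → # 4 ⊗ h ⊕ # 1 ⊕ δ :≤ P ∷ # 2 :≤ h ∷ [] ⊢ # 3 ⊕ (# 2 ⊗ h ⊕ δ) ⊕ (# 2 ⊕ δ) :≤ P ⊕ (# 3 ⊗ h ⊕ # 1 ⊕ δ) ⊕ (g ⊕ # 2)) (P≡-≥ P≡ ∷ 2≤h ∷ [])
  next-block (a 2≤h P≡) A = lin (h ∷ δ ∷ P ∷ pred h ∷ kindGap a A ∷ [])
    (λ h δ P q g → # 4 ⊗ h ⊕ # 1 ⊕ δ :≤ P ∷ # 2 :≤ h ∷ # 2 :≤ h ∷ h :≤ # 1 ⊕ q ∷ q :≤ g ∷ δ :≤ # 1 ∷ [] ⊢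
      # 3 ⊕ (# 2 ⊗ h ⊕ δ) ⊕ (h ⊕ # 2 ⊕ δ) :≤ P ⊕ # 0 ⊕ (g ⊕ # 2))
    (P≡-≥ P≡ ∷ 2≤h ∷ 2≤h ∷ ℕ.≤-reflexive (sym suc-pred-h) ∷ ≤-∣-∣ {pred h} {0} (inj₂ ℕ.≤-refl) ∷ δ≤1 ∷ [])
  next-block (a 2≤h P≡) B = lin (h ∷ δ ∷ P ∷ kindGap a B ∷ [])
    (λ h δ P g → # 4 ⊗ h ⊕ # 1 ⊕ δ :≤ P ∷ [] ⊢ # 3 ⊕ (# 2 ⊗ h ⊕ δ) ⊕ (h ⊕ # 2 ⊕ δ) :≤ P ⊕ (# 2 ⊕ δ) ⊕ (g ⊕ # 2)) (P≡-≥ P≡ ∷ [])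
  next-block (a 2≤h P≡) (a _ _) = lin (h ∷ δ ∷ P ∷ kindGap a a ∷ [])
    (λ h δ P g → # 4 ⊗ h ⊕ # 1 ⊕ δ :≤ P ∷ [] ⊢ # 3 ⊕ (# 2 ⊗ h ⊕ δ) ⊕ (h ⊕ # 2 ⊕ δ) :≤ P ⊕ (h ⊕ # 2 ⊕ δ) ⊕ (g ⊕ # 2)) (P≡-≥ P≡ ∷ [])
  next-block (a 2≤h P≡) (b _ _) = lin (h ∷ δ ∷ P ∷ kindGap a b ∷ [])
    (λ h δ P g → # 4 ⊗ h ⊕ # 1 ⊕ δ :≤ P ∷ # 2 :≤ h ∷ [] ⊢ # 3 ⊕ (# 2 ⊗ h ⊕ δ) ⊕ (h ⊕ # 2 ⊕ δ) :≤ P ⊕ (# 3 ⊗ h ⊕ # 1 ⊕ δ) ⊕ (g ⊕ # 2)) (P≡-≥ P≡ ∷ 2≤h ∷ [])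
  next-block (b 2≤h P≡) A = lin (h ∷ δ ∷ P ∷ kindGap b A ∷ [])
    (λ h δ P g → # 4 ⊗ h ⊕ # 1 ⊕ δ :≤ P ∷ # 1 ⊕ (h ⊕ δ) :≤ g ∷ [] ⊢
      # 3 ⊕ (# 2 ⊗ h ⊕ δ) ⊕ (# 3 ⊗ h ⊕ # 1 ⊕ δ) :≤ P ⊕ # 0 ⊕ (g ⊕ # 2))
    (P≡-≥ P≡ ∷ ≤-∣-∣ {suc (h + δ)} {0} (inj₂ ℕ.≤-refl) ∷ [])
  next-block (b 2≤h P≡) B = lin (h ∷ δ ∷ P ∷ pred h ∷ kindGap b B ∷ [])
    (λ h δ P q g → # 4 ⊗ h ⊕ # 1 ⊕ δ :≤ P ∷ h :≤ # 1 ⊕ q ∷ q :≤ g ∷ [] ⊢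
      # 3 ⊕ (# 2 ⊗ h ⊕ δ) ⊕ (# 3 ⊗ h ⊕ # 1 ⊕ δ) :≤ P ⊕ (# 2 ⊕ δ) ⊕ (g ⊕ # 2))
    (P≡-≥ P≡ ∷ ℕ.≤-reflexive (sym suc-pred-h) ∷ ≤-∣-∣ {suc (h + δ)} {N} (inj₁ (lin (h ∷ δ ∷ pred h ∷ [])
      (λ h δ q → # 1 ⊕ q :≤ h ∷ [] ⊢ # 1 ⊕ (h ⊕ δ) ⊕ q :≤ # 2 ⊗ h ⊕ δ) (ℕ.≤-reflexive suc-pred-h ∷ []))) ∷ [])
  next-block (b 2≤h P≡) (a _ _) = lin (h ∷ δ ∷ P ∷ kindGap b a ∷ [])
    (λ h δ P g → # 4 ⊗ h ⊕ # 1 ⊕ δ :≤ P ∷ [] ⊢ # 3 ⊕ (# 2 ⊗ h ⊕ δ) ⊕ (# 3 ⊗ h ⊕ # 1 ⊕ δ) :≤ P ⊕ (h ⊕ # 2 ⊕ δ) ⊕ (g ⊕ # 2)) (P≡-≥ P≡ ∷ [])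
  next-block (b 2≤h P≡) (b _ _) = lin (h ∷ δ ∷ P ∷ kindGap b b ∷ [])
    (λ h δ P g → # 4 ⊗ h ⊕ # 1 ⊕ δ :≤ P ∷ [] ⊢ # 3 ⊕ (# 2 ⊗ h ⊕ δ) ⊕ (# 3 ⊗ h ⊕ # 1 ⊕ δ) :≤ P ⊕ (# 3 ⊗ h ⊕ # 1 ⊕ δ) ⊕ (g ⊕ # 2)) (P≡-≥ P≡ ∷ [])

  leaf-next : ∀ {κ κ′ i j} → Allowed κ → Allowed κ′ → i < j → Fwd (lv κ i) (lv κ′ j)
  leaf-next {κ} {κ′} {i} {j} ok ok′ i<j = lin (N ∷ P ∷ start ∷ offset κ ∷ offset κ′ ∷ kindGap κ κ′ ∷ i ∷ j ∷ [])
    (λ N P st o o′ g i j → # 3 ⊕ N ⊕ o :≤ P ⊕ o′ ⊕ (g ⊕ # 2) ∷ P ⊗ (# 1 ⊕ i) :≤ P ⊗ j ∷ [] ⊢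
      # 3 ⊕ N ⊕ (st ⊕ P ⊗ i ⊕ o) :≤ st ⊕ P ⊗ j ⊕ o′ ⊕ (g ⊕ # 2))
    (next-block ok ok′ ∷ ℕ.*-monoʳ-≤ P i<j ∷ [])

  leaf-same : ∀ {κ κ′ i} → 3 + N + offset κ ≤ offset κ′ + (kindGap κ κ′ + 2) → Fwd (lv κ i) (lv κ′ i)
  leaf-same {κ} {κ′} {i} le = lin (N ∷ start + P * i ∷ offset κ ∷ offset κ′ ∷ kindGap κ κ′ ∷ [])
    (λ N x o o′ g → # 3 ⊕ N ⊕ o :≤ o′ ⊕ (g ⊕ # 2) ∷ [] ⊢ # 3 ⊕ N ⊕ (x ⊕ o) :≤ x ⊕ o′ ⊕ (g ⊕ # 2)) (le ∷ [])

  AB : 3 + N + offset A ≤ offset B + (kindGap A B + 2)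
  AB = lin (N ∷ δ ∷ kindGap A B ∷ []) (λ N δ g → N :≤ g ∷ [] ⊢ # 3 ⊕ N ⊕ # 0 :≤ # 2 ⊕ δ ⊕ (g ⊕ # 2)) (≤-∣-∣ {0} {N} (inj₁ ℕ.≤-refl) ∷ [])

  Aa : 3 + N + offset A ≤ offset a + (kindGap A a + 2)
  Aa = lin (h ∷ δ ∷ pred h ∷ kindGap A a ∷ [])
    (λ h δ q g → h :≤ # 1 ⊕ q ∷ q :≤ g ∷ [] ⊢ # 3 ⊕ (# 2 ⊗ h ⊕ δ) ⊕ # 0 :≤ h ⊕ # 2 ⊕ δ ⊕ (g ⊕ # 2))
    (ℕ.≤-reflexive (sym suc-pred-h) ∷ ≤-∣-∣ {0} {pred h} (inj₁ ℕ.≤-refl) ∷ [])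

  Ab : 2 ≤ h → 3 + N + offset A ≤ offset b + (kindGap A b + 2)
  Ab 2≤h = lin (h ∷ δ ∷ kindGap A b ∷ [])
    (λ h δ g → # 2 :≤ h ∷ [] ⊢ # 3 ⊕ (# 2 ⊗ h ⊕ δ) ⊕ # 0 :≤ # 3 ⊗ h ⊕ # 1 ⊕ δ ⊕ (g ⊕ # 2)) (2≤h ∷ [])

  Ba : 3 + N + offset B ≤ offset a + (kindGap B a + 2)
  Ba = lin (h ∷ δ ∷ kindGap B a ∷ [])
    (λ h δ g → # 1 ⊕ (h ⊕ δ) :≤ g ∷ [] ⊢ # 3 ⊕ (# 2 ⊗ h ⊕ δ) ⊕ (# 2 ⊕ δ) :≤ h ⊕ # 2 ⊕ δ ⊕ (g ⊕ # 2))
    (≤-∣-∣ {N} {pred h} (inj₂ (lin (h ∷ δ ∷ pred h ∷ []) (λ h δ q → # 1 ⊕ q :≤ h ∷ [] ⊢ q ⊕ (# 1 ⊕ (h ⊕ δ)) :≤ # 2 ⊗ h ⊕ δ)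
      (ℕ.≤-reflexive suc-pred-h ∷ []))) ∷ [])

  Bb : 2 ≤ h → 3 + N + offset B ≤ offset b + (kindGap B b + 2)
  Bb 2≤h = lin (h ∷ δ ∷ pred h ∷ kindGap B b ∷ [])
    (λ h δ q g → h :≤ # 1 ⊕ q ∷ q :≤ g ∷ # 2 :≤ h ∷ # 2 :≤ h ∷ δ :≤ # 1 ∷ [] ⊢
      # 3 ⊕ (# 2 ⊗ h ⊕ δ) ⊕ (# 2 ⊕ δ) :≤ # 3 ⊗ h ⊕ # 1 ⊕ δ ⊕ (g ⊕ # 2))
    (ℕ.≤-reflexive (sym suc-pred-h) ∷ ≤-∣-∣ {N} {suc (h + δ)} (inj₂ (lin (h ∷ δ ∷ pred h ∷ [])
      (λ h δ q → # 1 ⊕ q :≤ h ∷ [] ⊢ # 1 ⊕ (h ⊕ δ) ⊕ q :≤ # 2 ⊗ h ⊕ δ) (ℕ.≤-reflexive suc-pred-h ∷ []))) ∷ 2≤h ∷ 2≤h ∷ δ≤1 ∷ [])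

  ab : 3 + N + offset a ≤ offset b + (kindGap a b + 2)
  ab = lin (h ∷ δ ∷ kindGap a b ∷ [])
    (λ h δ g → # 2 ⊕ δ :≤ g ∷ [] ⊢ # 3 ⊕ (# 2 ⊗ h ⊕ δ) ⊕ (h ⊕ # 2 ⊕ δ) :≤ # 3 ⊗ h ⊕ # 1 ⊕ δ ⊕ (g ⊕ # 2))
    (≤-∣-∣ {pred h} {suc (h + δ)} (inj₁ (lin (h ∷ δ ∷ pred h ∷ []) (λ h δ q → # 1 ⊕ q :≤ h ∷ [] ⊢ q ⊕ (# 2 ⊕ δ) :≤ # 1 ⊕ (h ⊕ δ))
      (ℕ.≤-reflexive suc-pred-h ∷ []))) ∷ [])

  -- Radio condition for the left center, the spine and the moved leaf

  lf-pos : ∀ {s} → s < h → h ∸ suc s + suc s ≡ h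
  lf-pos = ℕ.m∸n+n≡m

  rt-pos : ∀ {s} → s < h + δ → N ∸ s + s ≡ N
  rt-pos {s} s< = ℕ.m∸n+n≡m (lin (h ∷ δ ∷ s ∷ []) (λ h δ s → # 1 ⊕ s :≤ h ⊕ δ ∷ [] ⊢ s :≤ # 2 ⊗ h ⊕ δ) (s< ∷ []))

  -- Reduces everything behind the leaves to a comparison with the last block, by
  -- `P * suc i ≤ P * k`.
  leaf-before : ∀ {i} → i < k → ∀ κ r {e} → lab r ≡ base + e →
    3 + N + offset κ ≤ h + P + e + separation (lv κ i) r → Fwd (lv κ i) r
  leaf-before {i} i<k κ r {e} lab≡ le = lin (N ∷ P ∷ h ∷ start ∷ offset κ ∷ separation (lv κ i) r ∷ i ∷ k ∷ e ∷ lab r ∷ [])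
    (λ N P h st o g i k e l → # 3 ⊕ N ⊕ o :≤ h ⊕ P ⊕ e ⊕ g ∷ P ⊗ (# 1 ⊕ i) :≤ P ⊗ k ∷ st ⊕ h ⊕ P ⊗ k ⊕ e :≤ l ∷ [] ⊢
      # 3 ⊕ N ⊕ (st ⊕ P ⊗ i ⊕ o) :≤ l ⊕ g)
    (le ∷ ℕ.*-monoʳ-≤ P i<k ∷ ℕ.≤-reflexive (sym lab≡) ∷ [])

  leaf-lf : ∀ {κ s i} → Allowed κ → i < k → s < h → Fwd (lv κ i) (lf s)
  leaf-lf {κ} {s} {i} ok i<k s<h = leaf-before i<k κ (lf s) refl (go ok)
    where
    t = h ∸ suc s
    t+ = ℕ.≤-reflexive (lf-pos s<h)
    +t = ℕ.≤-reflexive (sym (lf-pos s<h))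
    go : Allowed κ → 3 + N + offset κ ≤ h + P + D * s + separation (lv κ i) (lf s)
    go A = lin (h ∷ δ ∷ P ∷ s ∷ t ∷ ∣ 0 - t ∣ ∷ [])
      (λ h δ P s t g → # 2 ⊗ h ⊕ # 1 ⊕ δ :≤ P ∷ h :≤ t ⊕ (# 1 ⊕ s) ∷ t :≤ g ∷ # 1 :≤ h ∷ # 1 :≤ h ∷ [] ⊢
        # 3 ⊕ (# 2 ⊗ h ⊕ δ) ⊕ # 0 :≤ h ⊕ P ⊕ (# 2 ⊗ h ⊕ # 3) ⊗ s ⊕ (g ⊕ (# 1 ⊕ # 0)))
      (Pm ∷ +t ∷ ≤-∣-∣ {0} {t} (inj₁ ℕ.≤-refl) ∷ 1≤h ∷ 1≤h ∷ [])
    go B = lin (h ∷ δ ∷ P ∷ s ∷ t ∷ ∣ N - t ∣ ∷ [])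
      (λ h δ P s t g → # 2 ⊗ h ⊕ # 1 ⊕ δ :≤ P ∷ # 1 ⊕ (h ⊕ δ) :≤ g ∷ # 1 :≤ h ∷ # 1 :≤ h ∷ [] ⊢
        # 3 ⊕ (# 2 ⊗ h ⊕ δ) ⊕ (# 2 ⊕ δ) :≤ h ⊕ P ⊕ (# 2 ⊗ h ⊕ # 3) ⊗ s ⊕ (g ⊕ (# 1 ⊕ # 0)))
      (Pm ∷ ≤-∣-∣ {N} {t} (inj₂ (lin (h ∷ δ ∷ t ∷ s ∷ []) (λ h δ t s → t ⊕ (# 1 ⊕ s) :≤ h ∷ [] ⊢
        t ⊕ (# 1 ⊕ (h ⊕ δ)) :≤ # 2 ⊗ h ⊕ δ) (t+ ∷ []))) ∷ 1≤h ∷ 1≤h ∷ [])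
    go (a 2≤h P≡) = lin (h ∷ δ ∷ P ∷ s ∷ ∣ pred h - t ∣ ∷ [])
      (λ h δ P s g → # 4 ⊗ h ⊕ # 1 ⊕ δ :≤ P ∷ # 2 :≤ h ∷ # 2 :≤ h ∷ δ :≤ # 1 ∷ [] ⊢
        # 3 ⊕ (# 2 ⊗ h ⊕ δ) ⊕ (h ⊕ # 2 ⊕ δ) :≤ h ⊕ P ⊕ (# 2 ⊗ h ⊕ # 3) ⊗ s ⊕ (g ⊕ (# 1 ⊕ # 0)))
      (P≡-≥ P≡ ∷ 2≤h ∷ 2≤h ∷ δ≤1 ∷ [])
    go (b 2≤h P≡) = lin (h ∷ δ ∷ P ∷ s ∷ ∣ suc (h + δ) - t ∣ ∷ [])
      (λ h δ P s g → # 4 ⊗ h ⊕ # 1 ⊕ δ :≤ P ∷ # 2 ⊕ δ :≤ g ∷ [] ⊢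
        # 3 ⊕ (# 2 ⊗ h ⊕ δ) ⊕ (# 3 ⊗ h ⊕ # 1 ⊕ δ) :≤ h ⊕ P ⊕ (# 2 ⊗ h ⊕ # 3) ⊗ s ⊕ (g ⊕ (# 1 ⊕ # 0)))
      (P≡-≥ P≡ ∷ ≤-∣-∣ {suc (h + δ)} {t} (inj₂ (lin (h ∷ δ ∷ t ∷ s ∷ []) (λ h δ t s → t ⊕ (# 1 ⊕ s) :≤ h ∷ [] ⊢
        t ⊕ (# 2 ⊕ δ) :≤ # 1 ⊕ (h ⊕ δ)) (t+ ∷ []))) ∷ [])

  leaf-rt : ∀ {κ s i} → Allowed κ → i < k → Fwd (lv κ i) (rt s)
  leaf-rt {κ} {s} {i} ok i<k = leaf-before i<k κ (rt s) (ℕ.+-assoc base (D * s) (h + 2)) (go ok)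
    where
    g = ∣ kindPos κ - (N ∸ s) ∣
    go : Allowed κ → 3 + N + offset κ ≤ h + P + (D * s + (h + 2)) + separation (lv κ i) (rt s)
    go A = lin (h ∷ δ ∷ P ∷ D * s ∷ g ∷ []) (λ h δ P Ds g → # 2 ⊗ h ⊕ # 1 ⊕ δ :≤ P ∷ [] ⊢
      # 3 ⊕ (# 2 ⊗ h ⊕ δ) ⊕ # 0 :≤ h ⊕ P ⊕ (Ds ⊕ (h ⊕ # 2)) ⊕ (g ⊕ (# 1 ⊕ # 0))) (Pm ∷ [])
    go B = lin (h ∷ δ ∷ P ∷ D * s ∷ g ∷ []) (λ h δ P Ds g → # 2 ⊗ h ⊕ # 1 ⊕ δ :≤ P ∷ # 1 :≤ h ∷ # 1 :≤ h ∷ δ :≤ # 1 ∷ [] ⊢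
      # 3 ⊕ (# 2 ⊗ h ⊕ δ) ⊕ (# 2 ⊕ δ) :≤ h ⊕ P ⊕ (Ds ⊕ (h ⊕ # 2)) ⊕ (g ⊕ (# 1 ⊕ # 0))) (Pm ∷ 1≤h ∷ 1≤h ∷ δ≤1 ∷ [])
    go (a 2≤h P≡) = lin (h ∷ δ ∷ P ∷ D * s ∷ g ∷ []) (λ h δ P Ds g → # 4 ⊗ h ⊕ # 1 ⊕ δ :≤ P ∷ # 2 :≤ h ∷ δ :≤ # 1 ∷ [] ⊢
      # 3 ⊕ (# 2 ⊗ h ⊕ δ) ⊕ (h ⊕ # 2 ⊕ δ) :≤ h ⊕ P ⊕ (Ds ⊕ (h ⊕ # 2)) ⊕ (g ⊕ (# 1 ⊕ # 0))) (P≡-≥ P≡ ∷ 2≤h ∷ δ≤1 ∷ [])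
    go (b 2≤h P≡) = lin (h ∷ δ ∷ P ∷ D * s ∷ g ∷ []) (λ h δ P Ds g → # 4 ⊗ h ⊕ # 1 ⊕ δ :≤ P ∷ # 2 :≤ h ∷ δ :≤ # 1 ∷ [] ⊢
      # 3 ⊕ (# 2 ⊗ h ⊕ δ) ⊕ (# 3 ⊗ h ⊕ # 1 ⊕ δ) :≤ h ⊕ P ⊕ (Ds ⊕ (h ⊕ # 2)) ⊕ (g ⊕ (# 1 ⊕ # 0))) (P≡-≥ P≡ ∷ 2≤h ∷ δ≤1 ∷ [])

  leaf-z : ∀ {κ i} → Allowed κ → i < k → Fwd (lv κ i) z
  leaf-z {κ} {i} ok i<k = leaf-before i<k κ z refl (go ok)
    where
    g = ∣ kindPos κ - 0 ∣
    go : Allowed κ → 3 + N + offset κ ≤ h + P + D * h + separation (lv κ i) z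
    go A = lin (h ∷ δ ∷ P ∷ g ∷ []) (λ h δ P g → # 2 ⊗ h ⊕ # 1 ⊕ δ :≤ P ∷ [] ⊢
      # 3 ⊕ (# 2 ⊗ h ⊕ δ) ⊕ # 0 :≤ h ⊕ P ⊕ (# 2 ⊗ h ⊕ # 3) ⊗ h ⊕ (g ⊕ (# 1 ⊕ # 1))) (Pm ∷ [])
    go B = lin (h ∷ δ ∷ P ∷ g ∷ []) (λ h δ P g → # 2 ⊗ h ⊕ # 1 ⊕ δ :≤ P ∷ # 1 :≤ h ∷ # 1 :≤ h ∷ # 1 :≤ h ∷ δ :≤ # 1 ∷ [] ⊢
      # 3 ⊕ (# 2 ⊗ h ⊕ δ) ⊕ (# 2 ⊕ δ) :≤ h ⊕ P ⊕ (# 2 ⊗ h ⊕ # 3) ⊗ h ⊕ (g ⊕ (# 1 ⊕ # 1))) (Pm ∷ 1≤h ∷ 1≤h ∷ 1≤h ∷ δ≤1 ∷ [])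
    go (a 2≤h P≡) = lin (h ∷ δ ∷ P ∷ g ∷ []) (λ h δ P g → # 4 ⊗ h ⊕ # 1 ⊕ δ :≤ P ∷ # 2 :≤ h ∷ # 2 :≤ h ∷ δ :≤ # 1 ∷ [] ⊢
      # 3 ⊕ (# 2 ⊗ h ⊕ δ) ⊕ (h ⊕ # 2 ⊕ δ) :≤ h ⊕ P ⊕ (# 2 ⊗ h ⊕ # 3) ⊗ h ⊕ (g ⊕ (# 1 ⊕ # 1))) (P≡-≥ P≡ ∷ 2≤h ∷ 2≤h ∷ δ≤1 ∷ [])
    go (b 2≤h P≡) = lin (h ∷ δ ∷ P ∷ g ∷ []) (λ h δ P g → # 4 ⊗ h ⊕ # 1 ⊕ δ :≤ P ∷ # 2 :≤ h ∷ # 2 :≤ h ∷ δ :≤ # 1 ∷ [] ⊢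
      # 3 ⊕ (# 2 ⊗ h ⊕ δ) ⊕ (# 3 ⊗ h ⊕ # 1 ⊕ δ) :≤ h ⊕ P ⊕ (# 2 ⊗ h ⊕ # 3) ⊗ h ⊕ (g ⊕ (# 1 ⊕ # 1))) (P≡-≥ P≡ ∷ 2≤h ∷ 2≤h ∷ δ≤1 ∷ [])

  start-≥ : h + 2 ≤ start + 3 * δ
  start-≥ = ℕ.≤-reflexive (sym start-≡)

  c-leaf : ∀ {κ i} → Allowed κ → (κ ≡ A → 4 * δ ≤ P * i) → Fwd c (lv κ i)
  -- For δ = 1 a leaf of kind A needs the label h + 3 after the center, but block 0 would offer only
  -- h - 1. The missing 4 is the required room.
  c-leaf {i = i} A room = lin (h ∷ δ ∷ start ∷ P * i ∷ ∣ h - 0 ∣ ∷ [])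
    (λ h δ st Pi g → h ⊕ # 2 :≤ st ⊕ # 3 ⊗ δ ∷ # 4 ⊗ δ :≤ Pi ∷ h :≤ g ∷ [] ⊢
      # 3 ⊕ (# 2 ⊗ h ⊕ δ) ⊕ # 0 :≤ st ⊕ Pi ⊕ # 0 ⊕ (g ⊕ (# 0 ⊕ # 1)))
    (start-≥ ∷ room refl ∷ ≤-∣-∣ {h} {0} (inj₂ ℕ.≤-refl) ∷ [])
  c-leaf {i = i} B _ = lin (h ∷ δ ∷ start ∷ P * i ∷ ∣ h - N ∣ ∷ [])
    (λ h δ st Pi g → h ⊕ # 2 :≤ st ⊕ # 3 ⊗ δ ∷ h ⊕ δ :≤ g ∷ δ :≤ # 1 ∷ δ :≤ # 1 ∷ [] ⊢
      # 3 ⊕ (# 2 ⊗ h ⊕ δ) ⊕ # 0 :≤ st ⊕ Pi ⊕ (# 2 ⊕ δ) ⊕ (g ⊕ (# 0 ⊕ # 1)))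
    (start-≥ ∷ ≤-∣-∣ {h} {N} (inj₁ (lin (h ∷ δ ∷ []) (λ h δ → [] ⊢ h ⊕ (h ⊕ δ) :≤ # 2 ⊗ h ⊕ δ) [])) ∷ δ≤1 ∷ δ≤1 ∷ [])
  c-leaf {i = i} (a _ _) _ = lin (h ∷ δ ∷ start ∷ P * i ∷ ∣ h - pred h ∣ ∷ [])
    (λ h δ st Pi g → h ⊕ # 2 :≤ st ⊕ # 3 ⊗ δ ∷ # 1 :≤ g ∷ δ :≤ # 1 ∷ δ :≤ # 1 ∷ δ :≤ # 1 ∷ [] ⊢
      # 3 ⊕ (# 2 ⊗ h ⊕ δ) ⊕ # 0 :≤ st ⊕ Pi ⊕ (h ⊕ # 2 ⊕ δ) ⊕ (g ⊕ (# 0 ⊕ # 1)))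
    (start-≥ ∷ ≤-∣-∣ {h} {pred h} (inj₂ (ℕ.≤-reflexive (trans (ℕ.+-comm (pred h) 1) suc-pred-h))) ∷ δ≤1 ∷ δ≤1 ∷ δ≤1 ∷ [])
  c-leaf {i = i} (b 2≤h _) _ = lin (h ∷ δ ∷ start ∷ P * i ∷ ∣ h - suc (h + δ) ∣ ∷ [])
    (λ h δ st Pi g → h ⊕ # 2 :≤ st ⊕ # 3 ⊗ δ ∷ # 2 :≤ h ∷ # 2 :≤ h ∷ δ :≤ # 1 ∷ δ :≤ # 1 ∷ δ :≤ # 1 ∷ [] ⊢
      # 3 ⊕ (# 2 ⊗ h ⊕ δ) ⊕ # 0 :≤ st ⊕ Pi ⊕ (# 3 ⊗ h ⊕ # 1 ⊕ δ) ⊕ (g ⊕ (# 0 ⊕ # 1)))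
    (start-≥ ∷ 2≤h ∷ 2≤h ∷ δ≤1 ∷ δ≤1 ∷ δ≤1 ∷ [])

  -- At least one full block of leaves lies in between, so the mere fact that `r` is not at the
  -- center is enough.
  c-before : ∀ r {e} → lab r ≡ base + e → 1 ≤ separation c r → Fwd c r
  c-before r {e} lab≡ 1≤sep = lin (h ∷ δ ∷ start ∷ P ∷ k ∷ e ∷ lab r ∷ separation c r ∷ [])
    (λ h δ st P k e l g → h ⊕ # 2 :≤ st ⊕ # 3 ⊗ δ ∷ # 2 ⊗ h ⊕ # 1 ⊕ δ :≤ P ∷ P ⊗ # 1 :≤ P ⊗ k ∷ st ⊕ h ⊕ P ⊗ k ⊕ e :≤ l ∷ # 1 :≤ g
       ∷ # 1 :≤ h ∷ # 1 :≤ h ∷ δ :≤ # 1 ∷ δ :≤ # 1 ∷ δ :≤ # 1 ∷ [] ⊢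
      # 3 ⊕ (# 2 ⊗ h ⊕ δ) ⊕ # 0 :≤ l ⊕ g)
    (start-≥ ∷ Pm ∷ ℕ.*-monoʳ-≤ P 1≤k ∷ ℕ.≤-reflexive (sym lab≡) ∷ 1≤sep ∷ 1≤h ∷ 1≤h ∷ δ≤1 ∷ δ≤1 ∷ δ≤1 ∷ [])

  c-lf : ∀ {s} → s < h → Fwd c (lf s)
  c-lf {s} s<h = c-before (lf s) refl (ℕ.≤-trans (≤-∣-∣ {h} {h ∸ suc s} (inj₂ (lin (h ∷ s ∷ h ∸ suc s ∷ [])
    (λ h s t → t ⊕ (# 1 ⊕ s) :≤ h ∷ [] ⊢ t ⊕ # 1 :≤ h) (ℕ.≤-reflexive (lf-pos s<h) ∷ [])))) (ℕ.m≤m+n _ 0))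

  c-rt : ∀ {s} → s < h + δ → Fwd c (rt s)
  c-rt {s} s< = c-before (rt s) (ℕ.+-assoc base (D * s) (h + 2)) (ℕ.≤-trans (≤-∣-∣ {h} {N ∸ s} (inj₁ (lin (h ∷ δ ∷ s ∷ N ∸ s ∷ [])
    (λ h δ s t → # 2 ⊗ h ⊕ δ :≤ t ⊕ s ∷ # 1 ⊕ s :≤ h ⊕ δ ∷ [] ⊢ h ⊕ # 1 :≤ t) (ℕ.≤-reflexive (sym (rt-pos s<)) ∷ s< ∷ [])))) (ℕ.m≤m+n _ 0))

  c-z : Fwd c z
  c-z = c-before z refl (ℕ.m≤n+m 1 ∣ h - 0 ∣)

  lf-lf : ∀ {s s′} → s′ < h → s < s′ → Fwd (lf s) (lf s′)
  lf-lf {s} {s′} s′<h s<s′ = lin (h ∷ δ ∷ base ∷ s ∷ s′ ∷ ∣ t - t′ ∣ ∷ [])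
    (λ h δ B s s′ g → (# 2 ⊗ h ⊕ # 3) ⊗ (# 1 ⊕ s) :≤ (# 2 ⊗ h ⊕ # 3) ⊗ s′ ∷ # 1 :≤ g ∷ δ :≤ # 1 ∷ [] ⊢
      # 3 ⊕ (# 2 ⊗ h ⊕ δ) ⊕ (B ⊕ (# 2 ⊗ h ⊕ # 3) ⊗ s) :≤ B ⊕ (# 2 ⊗ h ⊕ # 3) ⊗ s′ ⊕ (g ⊕ (# 0 ⊕ # 0)))
    (ℕ.*-monoʳ-≤ D s<s′ ∷ ≤-∣-∣ {t} {t′} (inj₂ (lin (h ∷ s ∷ s′ ∷ t ∷ t′ ∷ [])
      (λ h s s′ t t′ → h :≤ t ⊕ (# 1 ⊕ s) ∷ t′ ⊕ (# 1 ⊕ s′) :≤ h ∷ # 1 ⊕ s :≤ s′ ∷ [] ⊢ t′ ⊕ # 1 :≤ t)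
      (ℕ.≤-reflexive (sym (lf-pos (ℕ.<-trans s<s′ s′<h))) ∷ ℕ.≤-reflexive (lf-pos s′<h) ∷ s<s′ ∷ []))) ∷ δ≤1 ∷ [])
    where t = h ∸ suc s
          t′ = h ∸ suc s′

  rt-rt : ∀ {s s′} → s′ < h + δ → s < s′ → Fwd (rt s) (rt s′)
  rt-rt {s} {s′} s′< s<s′ = lin (h ∷ δ ∷ base ∷ s ∷ s′ ∷ ∣ t - t′ ∣ ∷ [])
    (λ h δ B s s′ g → (# 2 ⊗ h ⊕ # 3) ⊗ (# 1 ⊕ s) :≤ (# 2 ⊗ h ⊕ # 3) ⊗ s′ ∷ # 1 :≤ g ∷ δ :≤ # 1 ∷ [] ⊢
      # 3 ⊕ (# 2 ⊗ h ⊕ δ) ⊕ (B ⊕ (# 2 ⊗ h ⊕ # 3) ⊗ s ⊕ (h ⊕ # 2)) :≤ B ⊕ (# 2 ⊗ h ⊕ # 3) ⊗ s′ ⊕ (h ⊕ # 2) ⊕ (g ⊕ (# 0 ⊕ # 0)))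
    (ℕ.*-monoʳ-≤ D s<s′ ∷ ≤-∣-∣ {t} {t′} (inj₂ (lin (N ∷ s ∷ s′ ∷ t ∷ t′ ∷ [])
      (λ N s s′ t t′ → N :≤ t ⊕ s ∷ t′ ⊕ s′ :≤ N ∷ # 1 ⊕ s :≤ s′ ∷ [] ⊢ t′ ⊕ # 1 :≤ t)
      (ℕ.≤-reflexive (sym (rt-pos (ℕ.<-trans s<s′ s′<))) ∷ ℕ.≤-reflexive (rt-pos s′<) ∷ s<s′ ∷ []))) ∷ δ≤1 ∷ [])
    where t = N ∸ s
          t′ = N ∸ s′

  lf-rt : ∀ {s s′} → s < h → s′ < h + δ → s ≤ s′ → Fwd (lf s) (rt s′)
  lf-rt {s} {s′} s<h s′< s≤s′ with ℕ.m≤n⇒m<n∨m≡n s≤s′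
  ... | inj₁ s<s′ = lin (h ∷ δ ∷ base ∷ s ∷ s′ ∷ ∣ h ∸ suc s - N ∸ s′ ∣ ∷ [])
    (λ h δ B s s′ g → (# 2 ⊗ h ⊕ # 3) ⊗ (# 1 ⊕ s) :≤ (# 2 ⊗ h ⊕ # 3) ⊗ s′ ∷ δ :≤ # 1 ∷ [] ⊢
      # 3 ⊕ (# 2 ⊗ h ⊕ δ) ⊕ (B ⊕ (# 2 ⊗ h ⊕ # 3) ⊗ s) :≤ B ⊕ (# 2 ⊗ h ⊕ # 3) ⊗ s′ ⊕ (h ⊕ # 2) ⊕ (g ⊕ (# 0 ⊕ # 0)))
    (ℕ.*-monoʳ-≤ D s<s′ ∷ δ≤1 ∷ [])
  -- For equal indices the two vertices are consecutive in the labelling and the inequality is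
  -- tight: their distance is exactly h + 1 + δ.
  ... | inj₂ refl = lin (h ∷ δ ∷ base ∷ s ∷ ∣ t - t′ ∣ ∷ [])
    (λ h δ B s g → # 1 ⊕ (h ⊕ δ) :≤ g ∷ [] ⊢
      # 3 ⊕ (# 2 ⊗ h ⊕ δ) ⊕ (B ⊕ (# 2 ⊗ h ⊕ # 3) ⊗ s) :≤ B ⊕ (# 2 ⊗ h ⊕ # 3) ⊗ s ⊕ (h ⊕ # 2) ⊕ (g ⊕ (# 0 ⊕ # 0)))
    (≤-∣-∣ {t} {t′} (inj₁ (lin (h ∷ δ ∷ s ∷ t ∷ t′ ∷ [])
      (λ h δ s t t′ → t ⊕ (# 1 ⊕ s) :≤ h ∷ # 2 ⊗ h ⊕ δ :≤ t′ ⊕ s ∷ [] ⊢ t ⊕ (# 1 ⊕ (h ⊕ δ)) :≤ t′)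
      (ℕ.≤-reflexive (lf-pos s<h) ∷ ℕ.≤-reflexive (sym (rt-pos s′<)) ∷ []))) ∷ [])
    where t = h ∸ suc s
          t′ = N ∸ s

  rt-lf : ∀ {s s′} → s′ < h → s < s′ → Fwd (rt s) (lf s′)
  rt-lf {s} {s′} s′<h s<s′ = lin (h ∷ δ ∷ base ∷ s ∷ s′ ∷ ∣ t - t′ ∣ ∷ [])
    (λ h δ B s s′ g → (# 2 ⊗ h ⊕ # 3) ⊗ (# 1 ⊕ s) :≤ (# 2 ⊗ h ⊕ # 3) ⊗ s′ ∷ # 2 ⊕ (h ⊕ δ) :≤ g ∷ [] ⊢
      # 3 ⊕ (# 2 ⊗ h ⊕ δ) ⊕ (B ⊕ (# 2 ⊗ h ⊕ # 3) ⊗ s ⊕ (h ⊕ # 2)) :≤ B ⊕ (# 2 ⊗ h ⊕ # 3) ⊗ s′ ⊕ (g ⊕ (# 0 ⊕ # 0)))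
    (ℕ.*-monoʳ-≤ D s<s′ ∷ ≤-∣-∣ {t} {t′} (inj₂ (lin (h ∷ δ ∷ s ∷ s′ ∷ t ∷ t′ ∷ [])
      (λ h δ s s′ t t′ → # 2 ⊗ h ⊕ δ :≤ t ⊕ s ∷ t′ ⊕ (# 1 ⊕ s′) :≤ h ∷ # 1 ⊕ s :≤ s′ ∷ [] ⊢ t′ ⊕ (# 2 ⊕ (h ⊕ δ)) :≤ t)
      (ℕ.≤-reflexive (sym (rt-pos (ℕ.<-≤-trans (ℕ.<-trans s<s′ s′<h) (ℕ.m≤m+n h δ)))) ∷ ℕ.≤-reflexive (lf-pos s′<h) ∷ s<s′ ∷ []))) ∷ [])
    where t = N ∸ s
          t′ = h ∸ suc s′

  lf-z : ∀ {s} → s < h → Fwd (lf s) z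
  lf-z {s} s<h = lin (h ∷ δ ∷ base ∷ s ∷ ∣ h ∸ suc s - 0 ∣ ∷ [])
    (λ h δ B s g → (# 2 ⊗ h ⊕ # 3) ⊗ (# 1 ⊕ s) :≤ (# 2 ⊗ h ⊕ # 3) ⊗ h ∷ δ :≤ # 1 ∷ [] ⊢
      # 3 ⊕ (# 2 ⊗ h ⊕ δ) ⊕ (B ⊕ (# 2 ⊗ h ⊕ # 3) ⊗ s) :≤ B ⊕ (# 2 ⊗ h ⊕ # 3) ⊗ h ⊕ (g ⊕ (# 0 ⊕ # 1)))
    (ℕ.*-monoʳ-≤ D s<h ∷ δ≤1 ∷ [])

  rt-z : ∀ {s} → s < h → Fwd (rt s) z
  rt-z {s} s<h = lin (h ∷ δ ∷ base ∷ s ∷ ∣ t - 0 ∣ ∷ [])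
    (λ h δ B s g → (# 2 ⊗ h ⊕ # 3) ⊗ (# 1 ⊕ s) :≤ (# 2 ⊗ h ⊕ # 3) ⊗ h ∷ # 1 ⊕ (h ⊕ δ) :≤ g ∷ [] ⊢
      # 3 ⊕ (# 2 ⊗ h ⊕ δ) ⊕ (B ⊕ (# 2 ⊗ h ⊕ # 3) ⊗ s ⊕ (h ⊕ # 2)) :≤ B ⊕ (# 2 ⊗ h ⊕ # 3) ⊗ h ⊕ (g ⊕ (# 0 ⊕ # 1)))
    (ℕ.*-monoʳ-≤ D s<h ∷ ≤-∣-∣ {t} {0} (inj₂ (lin (h ∷ δ ∷ s ∷ t ∷ [])
      (λ h δ s t → # 2 ⊗ h ⊕ δ :≤ t ⊕ s ∷ # 1 ⊕ s :≤ h ∷ [] ⊢ # 1 ⊕ (h ⊕ δ) :≤ t)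
      (ℕ.≤-reflexive (sym (rt-pos (ℕ.<-≤-trans s<h (ℕ.m≤m+n h δ)))) ∷ s<h ∷ []))) ∷ [])
    where t = N ∸ s

  -- The hypotheses leave only δ = 1 and s = h, so that `rt s` is the right center.
  z-rt : ∀ {s} → h ≤ s → s < h + δ → Fwd z (rt s)
  z-rt {s} h≤s s< = lin (h ∷ δ ∷ base ∷ s ∷ ∣ 0 - t ∣ ∷ [])
    (λ h δ B s g → (# 2 ⊗ h ⊕ # 3) ⊗ h :≤ (# 2 ⊗ h ⊕ # 3) ⊗ s ∷ h ⊕ δ :≤ g ∷ [] ⊢
      # 3 ⊕ (# 2 ⊗ h ⊕ δ) ⊕ (B ⊕ (# 2 ⊗ h ⊕ # 3) ⊗ h) :≤ B ⊕ (# 2 ⊗ h ⊕ # 3) ⊗ s ⊕ (h ⊕ # 2) ⊕ (g ⊕ (# 1 ⊕ # 0)))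
    (ℕ.*-monoʳ-≤ D h≤s ∷ ≤-∣-∣ {0} {t} (inj₁ (lin (h ∷ δ ∷ s ∷ t ∷ [])
      (λ h δ s t → # 2 ⊗ h ⊕ δ :≤ t ⊕ s ∷ # 1 ⊕ s :≤ h ⊕ δ ∷ δ :≤ # 1 ∷ [] ⊢ h ⊕ δ :≤ t)
      (ℕ.≤-reflexive (sym (rt-pos s<)) ∷ s< ∷ δ≤1 ∷ []))) ∷ [])
    where t = N ∸ s

  -- Radio condition for all pairs of roles

  Apart : Role → Role → Set
  Apart r r′ = 3 + N ≤ ∣ lab r - lab r′ ∣ + separation r r′

  fwd⇒apart : ∀ {r r′} → Fwd r r′ → Apart r r′
  fwd⇒apart {r} {r′} le = lin (N ∷ lab r ∷ lab r′ ∷ ∣ lab r - lab r′ ∣ ∷ separation r r′ ∷ [])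
    (λ N l l′ d g → # 3 ⊕ N ⊕ l :≤ l′ ⊕ g ∷ l′ :≤ l ⊕ d ∷ [] ⊢ # 3 ⊕ N :≤ d ⊕ g)
    (le ∷ ℕ.≤-trans (ℕ.m≤n+∣m-n∣ (lab r′) (lab r)) (ℕ.≤-reflexive (cong (lab r +_) (ℕ.∣-∣-comm (lab r′) (lab r)))) ∷ [])

  apart-sym : ∀ {r r′} → Apart r r′ → Apart r′ r
  apart-sym {r} {r′} = subst (3 + N ≤_) (cong₂ _+_ (ℕ.∣-∣-comm (lab r) (lab r′))
    (cong₂ _+_ (ℕ.∣-∣-comm (pos r) (pos r′)) (ℕ.+-comm (ht r) (ht r′))))

  fwd⇐apart : ∀ {r r′} → Fwd r′ r → Apart r r′
  fwd⇐apart {r} {r′} le = apart-sym {r′} {r} (fwd⇒apart {r′} {r} le)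

  leaf-apart : ∀ {κ κ′ i j} → Allowed κ → Allowed κ′ → lv κ i ≢ lv κ′ j → Apart (lv κ i) (lv κ′ j)
  leaf-apart {κ} {κ′} {i} {j} ok ok′ r≢r′ with ℕ.<-cmp i j
  ... | tri< i<j _ _ = fwd⇒apart {lv κ i} {lv κ′ j} (leaf-next ok ok′ i<j)
  ... | tri> _ _ j<i = fwd⇐apart {lv κ i} {lv κ′ j} (leaf-next ok′ ok j<i)
  ... | tri≈ _ refl _ = same ok ok′ r≢r′
    where
    same : ∀ {κ κ′} → Allowed κ → Allowed κ′ → lv κ i ≢ lv κ′ i → Apart (lv κ i) (lv κ′ i)
    same A       A       r≢r′ = contradiction refl r≢r′
    same B       B       r≢r′ = contradiction refl r≢r′
    same (a _ _) (a _ _) r≢r′ = contradiction refl r≢r′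
    same (b _ _) (b _ _) r≢r′ = contradiction refl r≢r′
    same A       B       _ = fwd⇒apart {lv A i} {lv B i} (leaf-same {A} {B} {i} AB)
    same A       (a _ _) _ = fwd⇒apart {lv A i} {lv a i} (leaf-same {A} {a} {i} Aa)
    same A       (b l _) _ = fwd⇒apart {lv A i} {lv b i} (leaf-same {A} {b} {i} (Ab l))
    same B       (a _ _) _ = fwd⇒apart {lv B i} {lv a i} (leaf-same {B} {a} {i} Ba)
    same B       (b l _) _ = fwd⇒apart {lv B i} {lv b i} (leaf-same {B} {b} {i} (Bb l))
    same (a _ _) (b _ _) _ = fwd⇒apart {lv a i} {lv b i} (leaf-same {a} {b} {i} ab)
    same B       A       _ = fwd⇐apart {lv B i} {lv A i} (leaf-same {A} {B} {i} AB)
    same (a _ _) A       _ = fwd⇐apart {lv a i} {lv A i} (leaf-same {A} {a} {i} Aa)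
    same (b l _) A       _ = fwd⇐apart {lv b i} {lv A i} (leaf-same {A} {b} {i} (Ab l))
    same (a _ _) B       _ = fwd⇐apart {lv a i} {lv B i} (leaf-same {B} {a} {i} Ba)
    same (b l _) B       _ = fwd⇐apart {lv b i} {lv B i} (leaf-same {B} {b} {i} (Bb l))
    same (b _ _) (a _ _) _ = fwd⇐apart {lv b i} {lv a i} (leaf-same {a} {b} {i} ab)

  apart : ∀ {r r′} → Valid r → Valid r′ → r ≢ r′ → Apart r r′
  apart c c r≢r′ = contradiction refl r≢r′
  apart (z _) (z _) r≢r′ = contradiction refl r≢r′
  apart (lv {κ} {i} ok _ _) (lv {κ′} {j} ok′ _ _) r≢r′ = leaf-apart ok ok′ r≢r′
  apart (lf {s} s<) (lf {s′} s′<) r≢r′ with ℕ.<-cmp s s′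
  ... | tri< s<s′ _ _ = fwd⇒apart {lf s} {lf s′} (lf-lf s′< s<s′)
  ... | tri≈ _ refl _ = contradiction refl r≢r′
  ... | tri> _ _ s′<s = fwd⇐apart {lf s} {lf s′} (lf-lf s< s′<s)
  apart (rt {s} s<) (rt {s′} s′<) r≢r′ with ℕ.<-cmp s s′
  ... | tri< s<s′ _ _ = fwd⇒apart {rt s} {rt s′} (rt-rt s′< s<s′)
  ... | tri≈ _ refl _ = contradiction refl r≢r′
  ... | tri> _ _ s′<s = fwd⇐apart {rt s} {rt s′} (rt-rt s< s′<s)
  apart (lf {s} s<) (rt {s′} s′<) _ with s ℕ.≤? s′
  ... | yes s≤s′ = fwd⇒apart {lf s} {rt s′} (lf-rt s< s′< s≤s′)
  ... | no s≰s′  = fwd⇐apart {lf s} {rt s′} (rt-lf s< (ℕ.≰⇒> s≰s′))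
  apart (rt {s} s<) (z _) _ with s ℕ.<? h
  ... | yes s<h = fwd⇒apart {rt s} {z} (rt-z s<h)
  ... | no s≮h  = fwd⇐apart {rt s} {z} (z-rt (ℕ.≮⇒≥ s≮h) s<)
  apart c (z _) _ = fwd⇒apart {c} {z} c-z
  apart c (lf {s} s<) _ = fwd⇒apart {c} {lf s} (c-lf s<)
  apart c (rt {s} s<) _ = fwd⇒apart {c} {rt s} (c-rt s<)
  apart c (lv {κ} {i} ok _ room) _ = fwd⇒apart {c} {lv κ i} (c-leaf ok room)
  apart (lv {κ} {i} ok i<k _) (lf {s} s<) _ = fwd⇒apart {lv κ i} {lf s} (leaf-lf ok i<k s<)
  apart (lv {κ} {i} ok i<k _) (rt {s} _) _ = fwd⇒apart {lv κ i} {rt s} (leaf-rt {s = s} ok i<k)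
  apart (lv {κ} {i} ok i<k _) (z _) _ = fwd⇒apart {lv κ i} {z} (leaf-z ok i<k)
  apart (lf {s} s<) (z _) _ = fwd⇒apart {lf s} {z} (lf-z s<)
  apart v@(rt {s} _) w@(lf {s′} _) r≢r′ = apart-sym {lf s′} {rt s} (apart w v (r≢r′ ∘ sym))
  apart v@(z _) w@(rt {s′} _) r≢r′ = apart-sym {rt s′} {z} (apart w v (r≢r′ ∘ sym))
  apart v@(z _) c r≢r′ = apart-sym {c} {z} (apart c v (r≢r′ ∘ sym))
  apart v@(lf {s} _) c r≢r′ = apart-sym {c} {lf s} (apart c v (r≢r′ ∘ sym))
  apart v@(rt {s} _) c r≢r′ = apart-sym {c} {rt s} (apart c v (r≢r′ ∘ sym))
  apart v@(lv {κ} {i} _ _ _) c r≢r′ = apart-sym {c} {lv κ i} (apart c v (r≢r′ ∘ sym))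
  apart v@(lf {s} _) w@(lv {κ} {i} _ _ _) r≢r′ = apart-sym {lv κ i} {lf s} (apart w v (r≢r′ ∘ sym))
  apart v@(rt {s} _) w@(lv {κ} {i} _ _ _) r≢r′ = apart-sym {lv κ i} {rt s} (apart w v (r≢r′ ∘ sym))
  apart v@(z _) w@(lv {κ} {i} _ _ _) r≢r′ = apart-sym {lv κ i} {z} (apart w v (r≢r′ ∘ sym))
  apart v@(z _) w@(lf {s} _) r≢r′ = apart-sym {lf s} {z} (apart w v (r≢r′ ∘ sym))

  -- The labelling and its span

  last : ℕ
  last = pred (h + δ)

  suc-last : suc last ≡ h + δ
  suc-last = ℕ.suc-pred (h + δ) {{>-nonZero (ℕ.≤-trans 1≤h (ℕ.m≤m+n h δ))}}

  last-valid : last < h + δ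
  last-valid = ℕ.≤-reflexive suc-last

  lab-last : lab (rt last) ≤ radioNumber h δ k P
  lab-last = lin (h ∷ δ ∷ start ∷ P * k ∷ last ∷ [])
    (λ h δ st Pk l → st ⊕ # 3 ⊗ δ :≤ h ⊕ # 2 ∷ (# 2 ⊗ h ⊕ # 3) ⊗ (# 1 ⊕ l) :≤ (# 2 ⊗ h ⊕ # 3) ⊗ (h ⊕ δ) ∷ [] ⊢
      st ⊕ h ⊕ Pk ⊕ (# 2 ⊗ h ⊕ # 3) ⊗ l ⊕ (h ⊕ # 2)
        :≤ # 2 ⊗ h ⊗ h ⊕ # 4 ⊗ h ⊕ # 1 ⊕ # 2 ⊗ h ⊗ δ ⊕ Pk)
    (ℕ.≤-reflexive start-≡ ∷ ℕ.≤-reflexive (cong (D *_) suc-last) ∷ [])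

  -- A separation is at most `N` + 2, one less than the demanded `N` + 3, so `Fwd` also orders the
  -- labels. The largest label is thereby found without comparing labels again.
  fwd⇒lab≤ : ∀ r r′ → pos r ≤ N → pos r′ ≤ N → Fwd r r′ → lab r ≤ lab r′
  fwd⇒lab≤ r r′ p≤N p′≤N le = lin (N ∷ lab r ∷ lab r′ ∷ ∣ pos r - pos r′ ∣ ∷ ht r ∷ ht r′ ∷ [])
    (λ N l l′ g e e′ → # 3 ⊕ N ⊕ l :≤ l′ ⊕ (g ⊕ (e ⊕ e′)) ∷ g :≤ N ∷ e :≤ # 1 ∷ e′ :≤ # 1 ∷ [] ⊢ l :≤ l′)
    (le ∷ ∣-∣-≤ (ℕ.≤-trans p≤N (ℕ.m≤n+m N (pos r′))) (ℕ.≤-trans p′≤N (ℕ.m≤n+m N (pos r))) ∷ ht≤1 r ∷ ht≤1 r′ ∷ [])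
    where
    ht≤1 : ∀ r → ht r ≤ 1
    ht≤1 c        = z≤n
    ht≤1 z        = ℕ.≤-refl
    ht≤1 (lf _)   = z≤n
    ht≤1 (rt _)   = z≤n
    ht≤1 (lv _ _) = ℕ.≤-refl

  -- Position, height and leaf index determine a vertex. Recording that the role has the same three
  -- values makes the roles of distinct vertices distinct.
  record Placed (v : Vertex) (leafIndex : ℕ) : Set where
    constructor placed
    field
      role   : Role
      valid  : Valid role
      pos-≡  : pos role ≡ position v
      ht-≡   : ht role ≡ height v
      index-≡ : index role ≡ leafIndex

  leafIndex : Vertex → ℕ
  leafIndex (spine _)  = 0
  leafIndex (leaf _ x) = toℕ x

  roleOf : ∀ v → Placed v (leafIndex v)
  roleOf (spine i) with ℕ.<-cmp (toℕ i) h
  ... | tri< i<h _ _ = placed (lf (h ∸ suc (toℕ i))) (lf (lin (h ∷ toℕ i ∷ h ∸ suc (toℕ i) ∷ [])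
          (λ h i t → t ⊕ (# 1 ⊕ i) :≤ h ∷ [] ⊢ # 1 ⊕ t :≤ h) (ℕ.≤-reflexive (ℕ.m∸n+n≡m i<h) ∷ [])))
          (trans (cong (h ∸_) (sym (ℕ.+-∸-assoc 1 i<h))) (ℕ.m∸[m∸n]≡n (ℕ.<⇒≤ i<h))) refl refl
  ... | tri≈ _ i≡h _ = placed c c (sym i≡h) refl refl
  ... | tri> _ _ h<i = placed (rt (N ∸ toℕ i)) (rt (lin (h ∷ δ ∷ toℕ i ∷ N ∸ toℕ i ∷ [])
          (λ h δ i t → t ⊕ i :≤ # 2 ⊗ h ⊕ δ ∷ # 1 ⊕ h :≤ i ∷ [] ⊢ # 1 ⊕ t :≤ h ⊕ δ)
          (ℕ.≤-reflexive (ℕ.m∸n+n≡m (position≤N (spine i))) ∷ h<i ∷ [])))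
          (ℕ.m∸[m∸n]≡n (position≤N (spine i))) refl refl
  roleOf (leaf i x) = go (placeOfLeaf i x)
    where
    x<k : toℕ x < k
    x<k = ℕ.<-≤-trans (Fin.toℕ<n x) (leaves≤k i)
    go : Place (toℕ i) → Placed (leaf i x) (toℕ x)
    go (outerʳ e)       = placed (lv B (toℕ x)) (lv B x<k λ ()) (sym e) refl refl
    go (innerˡ 2≤h P≡ e) = placed (lv a (toℕ x)) (lv (a 2≤h P≡) x<k λ ()) (cong pred (sym e)) refl refl
    go (innerʳ 2≤h P≡ e) = placed (lv b (toℕ x)) (lv (b 2≤h P≡) x<k λ ()) (sym e) refl refl
    go (outerˡ e) with δ-cases δ≤1 | toℕ x ℕ.≟ 0
    -- The default clause of `index` gives 0 for `z`, which is the index of the leaf that is moved.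
    ... | inj₂ δ≡1 | yes x≡0 = placed z (z δ≡1) (sym e) refl (sym x≡0)
    ... | inj₁ δ≡0 | _ = placed (lv A (toℕ x)) (lv A x<k λ _ → subst (λ d → 4 * d ≤ P * toℕ x) (sym δ≡0) z≤n) (sym e) refl refl
    ... | inj₂ δ≡1 | no x≢0 = placed (lv A (toℕ x)) (lv A x<k λ _ → room) (sym e) refl refl
      where
      room : 4 * δ ≤ P * toℕ x
      room = lin (h ∷ δ ∷ P ∷ P * toℕ x ∷ [])
        (λ h δ P Px → P ⊗ # 1 :≤ Px ∷ # 2 ⊗ h ⊕ # 1 ⊕ δ :≤ P ∷ # 1 :≤ h ∷ # 1 :≤ h ∷ δ :≤ # 1 ∷ δ :≤ # 1 ∷ δ :≤ # 1 ∷ [] ⊢ # 4 ⊗ δ :≤ Px)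
        (ℕ.*-monoʳ-≤ P (ℕ.n≢0⇒n>0 x≢0) ∷ Pm ∷ 1≤h ∷ 1≤h ∷ δ≤1 ∷ δ≤1 ∷ δ≤1 ∷ [])

  vertex-≡ : ∀ u v → position u ≡ position v → height u ≡ height v → leafIndex u ≡ leafIndex v → u ≡ v
  vertex-≡ (spine i)  (spine j)  p _ _ = spine-≡ p
  vertex-≡ (leaf i x) (leaf j y) p _ e with Fin.toℕ-injective p
  ... | refl = cong (leaf i) (Fin.toℕ-injective e)

  open Placed

  labelling : Vertex → ℕ
  labelling v = lab (role (roleOf v))

  labelling-radio : IsRadioLabelling T labelling
  labelling-radio u v u≢v = ℕ.m≤n+o⇒m∸n≤o (diam T + 1) (dist T u v) (lin
    (diam T ∷ N ∷ dist T u v ∷ ∣ labelling u - labelling v ∣ ∷ gap u v ∷ [])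
    (λ d N uv l g → d :≤ # 2 ⊕ N ∷ # 3 ⊕ N :≤ l ⊕ g ∷ g :≤ uv ∷ [] ⊢ d ⊕ # 1 :≤ uv ⊕ l)
    (ℕ.≤-reflexive diam-≡
      ∷ subst (λ g → 3 + N ≤ ∣ labelling u - labelling v ∣ + g)
          (cong₂ _+_ (cong₂ ∣_-_∣ (pos-≡ pu) (pos-≡ pv)) (cong₂ _+_ (ht-≡ pu) (ht-≡ pv)))
          (apart (valid pu) (valid pv) roles-≢)
      ∷ gap≤dist u v u≢v ∷ []))
    where
    pu = roleOf u
    pv = roleOf v
    roles-≢ : role pu ≢ role pv
    roles-≢ e = u≢v (vertex-≡ u v
      (trans (sym (pos-≡ pu)) (trans (cong pos e) (pos-≡ pv)))
      (trans (sym (ht-≡ pu)) (trans (cong ht e) (ht-≡ pv)))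
      (trans (sym (index-≡ pu)) (trans (cong index e) (index-≡ pv))))

  labelling-≤ : ∀ v → labelling v ≤ radioNumber h δ k P
  labelling-≤ v = ℕ.≤-trans (go (role pv) (valid pv) (subst (_≤ N) (sym (pos-≡ pv)) (position≤N v))) lab-last
    where
    pv = roleOf v
    below : ∀ r → pos r ≤ N → Fwd r (rt last) → lab r ≤ lab (rt last)
    below r p≤N = fwd⇒lab≤ r (rt last) p≤N (ℕ.m∸n≤m N last)
    go : ∀ r → Valid r → pos r ≤ N → lab r ≤ lab (rt last)
    go c c p≤N = below c p≤N (c-rt last-valid)
    go z (z δ≡1) p≤N = below z p≤N (z-rt (s≤s⁻¹ (ℕ.≤-reflexive (trans (trans (ℕ.+-comm 1 h) (cong (h +_) (sym δ≡1))) (sym suc-last)))) last-valid)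
    go (lf s) (lf s<h) p≤N = below (lf s) p≤N (lf-rt s<h last-valid (s≤s⁻¹ (ℕ.≤-trans s<h (ℕ.≤-trans (ℕ.m≤m+n h δ) (ℕ.≤-reflexive (sym suc-last))))))
    go (lv κ i) (lv ok i<k _) p≤N = below (lv κ i) p≤N (leaf-rt {s = last} ok i<k)
    go (rt s) (rt s<) _ = ℕ.+-monoˡ-≤ (h + 2) (ℕ.+-monoʳ-≤ base (ℕ.*-monoʳ-≤ D (s≤s⁻¹ (ℕ.≤-trans s< (ℕ.≤-reflexive (sym suc-last))))))

  -- The span of the labelling is computed from above only; the lower bound, applied to this
  -- labelling, gives the equality.
  isRadioNumber : IsRadioNumber T (radioNumber h δ k P)
  isRadioNumber = (labelling , labelling-radio , ℕ.≤-antisym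
      (maxOverPairs-≤ T λ u v → ℕ.≤-trans (ℕ.∣m-n∣≤m⊔n (labelling u) (labelling v)) (ℕ.⊔-lub (labelling-≤ u) (labelling-≤ v)))
      (LowerBound.lowerBound labelling labelling-radio))
    , LowerBound.lowerBound

-- The theorem over ℤ

open import Data.Integer.Base as ℤ using (+_)
import Data.Integer.Properties as ℤ
import Data.Integer.Tactic.RingSolver as ℤ-Solver

rearrange : ∀ x l e ξ → x ℤ.- l ℤ.+ e ℤ.+ ξ ≡ (x ℤ.+ e ℤ.+ ξ) ℤ.- l
rearrange = ℤ-Solver.solve-∀

cancel : ∀ r l → (r ℤ.+ l) ℤ.- l ≡ r
cancel = ℤ-Solver.solve-∀

cancel₂ : ∀ r a b → (r ℤ.+ a ℤ.+ b) ℤ.- a ℤ.- b ≡ r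
cancel₂ = ℤ-Solver.solve-∀

bound-as-ℤ : ∀ {q d e ξ l r} → q * (d + e) + e + ξ ≡ r + l →
  + r ≡ (+ suc q ℤ.- + 1) ℤ.* (+ d ℤ.+ + e) ℤ.- + l ℤ.+ + e ℤ.+ + ξ
bound-as-ℤ {q} {d} {e} {ξ} {l} {r} eq = sym (begin
  + q ℤ.* + (d + e) ℤ.- + l ℤ.+ + e ℤ.+ + ξ
    ≡⟨ cong (λ x → x ℤ.- + l ℤ.+ + e ℤ.+ + ξ) (ℤ.pos-* q (d + e)) ⟨
  + (q * (d + e)) ℤ.- + l ℤ.+ + e ℤ.+ + ξ
    ≡⟨ rearrange (+ (q * (d + e))) (+ l) (+ e) (+ ξ) ⟩
  + (q * (d + e) + e + ξ) ℤ.- + l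
    ≡⟨ cong (λ x → + x ℤ.- + l) eq ⟩
  + (r + l) ℤ.- + l
    ≡⟨ cancel (+ r) (+ l) ⟩
  + r ∎)
  where open ≡-Reasoning

doubled-as-ℤ : ∀ {r x a b} → 2 * r + a + b ≡ x → + 2 ℤ.* + r ≡ + x ℤ.- + a ℤ.- + b
doubled-as-ℤ {r} {x} {a} {b} refl =
  trans (sym (ℤ.pos-* 2 r)) (sym (cancel₂ (+ (2 * r)) (+ a) (+ b)))

-- Stated as a family in `n` so that it can be transported along n = 1 + 2h + δ.
RadioTheorem : ℕ → ℕ → Set
RadioTheorem n k = let T = C n k in
  ∃[ r ] (IsRadioNumber T r
    × (n ≡ 3 → r ≡ 3 * k + 7)
    × (n ≡ 4 → r ≡ 4 * k + 9)
    × (3 < n → ¬ 2 ∣ n →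
        + 2 ℤ.* + r ≡ + (n ^ 2 + 4 * n * k + 2 * n) ℤ.- + (2 * k) ℤ.- + 1)
    × (4 < n → 2 ∣ n →
        + 2 ℤ.* + r ≡ + (n ^ 2 + 4 * n * k + 2 * n) ℤ.- + (4 * k) ℤ.- + 6)
    × + r ≡ (+ order T ℤ.- + 1) ℤ.* (+ diam T ℤ.+ ε T)
            ℤ.- + (2 * totalLevel T) ℤ.+ ε T ℤ.+ + ξ T)

-- Evaluation of the closed formulas

long≮ : ∀ {h δ} → 2 ≤ h → 4 < suc (2 * h + δ)
long≮ {h} {δ} 2≤h = lin (h ∷ δ ∷ []) (λ h δ → # 2 :≤ h ∷ # 2 :≤ h ∷ [] ⊢ # 5 :≤ # 1 ⊕ (# 2 ⊗ h ⊕ δ)) (2≤h ∷ 2≤h ∷ [])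

value-3 : ∀ {h δ P} k → Shape h δ P → suc (2 * h + δ) ≡ 3 → radioNumber h δ k P ≡ 3 * k + 7
value-3 k (short refl) refl = ℕ.+-comm 7 (3 * k)
value-3 {h} {δ} k (long 2≤h) e = contradiction e (ℕ.>⇒≢ (ℕ.<-trans ℕ.≤-refl (long≮ {h} {δ} 2≤h)))

value-4 : ∀ {h δ P} k → Shape h δ P → suc (2 * h + δ) ≡ 4 → radioNumber h δ k P ≡ 4 * k + 9
value-4 k (short refl) refl = ℕ.+-comm 9 (4 * k)
value-4 {h} {δ} k (long 2≤h) e = contradiction e (ℕ.>⇒≢ (long≮ {h} {δ} 2≤h))

-- The right-hand side has the form to which the expression in `n ^ 2` computes; hence the factor 1.
odd-≡ : ∀ h k → 2 * (2 * h * h + 4 * h + 1 + 2 * h * 0 + (4 * h + 1 + 0) * k) + 2 * k + 1 ≡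
  suc (2 * h + 0) * (suc (2 * h + 0) * 1) + 4 * suc (2 * h + 0) * k + 2 * suc (2 * h + 0)
odd-≡ = solve-∀

even-≡ : ∀ h k → 2 * (2 * h * h + 4 * h + 1 + 2 * h * 1 + (4 * h + 1 + 1) * k) + 4 * k + 6 ≡
  suc (2 * h + 1) * (suc (2 * h + 1) * 1) + 4 * suc (2 * h + 1) * k + 2 * suc (2 * h + 1)
even-≡ = solve-∀

value-odd : ∀ {h δ P} k → δ ≤ 1 → Shape h δ P → let n = suc (2 * h + δ) in 3 < n → 2 ∤ n →
  2 * radioNumber h δ k P + 2 * k + 1 ≡ n ^ 2 + 4 * n * k + 2 * n
value-odd k z≤n (short refl) (s≤s (s≤s (s≤s ())))
value-odd {h} k z≤n (long _) _ _ = odd-≡ h k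
value-odd {h} k (s≤s z≤n) _ _ 2∤n = contradiction (subst (λ m → 2 ∣ suc m) (ℕ.+-comm 1 (2 * h)) (2∣2+2m h)) 2∤n

value-even : ∀ {h δ P} k → δ ≤ 1 → Shape h δ P → let n = suc (2 * h + δ) in 4 < n → 2 ∣ n →
  2 * radioNumber h δ k P + 4 * k + 6 ≡ n ^ 2 + 4 * n * k + 2 * n
value-even {h} k z≤n _ _ 2∣n = contradiction (subst (λ m → 2 ∣ suc m) (ℕ.+-identityʳ (2 * h)) 2∣n) (2∤1+2m h)
value-even k (s≤s z≤n) (short refl) (s≤s (s≤s (s≤s (s≤s ()))))
value-even {h} k (s≤s z≤n) (long _) _ _ = even-≡ h k

ξ-value : ℕ → ℕ → ℕ
ξ-value c s = if c ≡ᵇ 1 then ⌊ s /2⌋ else s ∸ 2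

⌊2k/2⌋ : ∀ k → ⌊ 2 * k /2⌋ ≡ k
⌊2k/2⌋ k = trans (cong (λ x → ⌊ k + x /2⌋) (ℕ.+-identityʳ k)) (sym (ℕ.n≡⌊n+n/2⌋ k))

odd-short : ∀ k → (2 + k * 2) * 5 + 1 + k ≡ 2 + 4 + 1 + 0 + 3 * k + 2 * (2 + k * 4)
odd-short = solve-∀

odd-long : ∀ h k → (2 * h + 0 + k * 4) * (2 + (2 * h + 0) + 1) + 1 + k ≡
  2 * h * h + 4 * h + 1 + 2 * h * 0 + (4 * h + 1 + 0) * k + 2 * (h * suc h + k * (2 * suc h + 4))
odd-long = solve-∀

even-short : ∀ k → (3 + suc k * 2) * 5 + 0 + 2 * k ≡ 2 + 4 + 1 + 2 + 4 * suc k + 2 * (2 + suc k * 4)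
even-short = solve-∀

even-long : ∀ h k → (2 * h + 1 + suc k * 4) * (2 + (2 * h + 1) + 0) + 0 + 2 * k ≡
  2 * h * h + 4 * h + 1 + 2 * h * 1 + (4 * h + 1 + 1) * suc k + 2 * (h * suc h + suc k * (2 * suc h + 4))
even-long = solve-∀

-- The general formula with the subtraction of 2L(T) moved to the other side, so that it can be
-- checked over ℕ; the first factor is the order minus 1, and ε is `1 ∸ δ`.
sharp : ∀ {h δ k P} → δ ≤ 1 → 1 ≤ k → (s : Shape h δ P) →
  (2 * h + δ + k * (2 + inner s)) * (2 + (2 * h + δ) + (1 ∸ δ)) + (1 ∸ δ) + ξ-value (suc δ) (2 * k) ≡
  radioNumber h δ k P + 2 * (h * suc h + k * (2 * suc h + inner s * 2))
sharp {k = k} z≤n _ (short refl) rewrite ⌊2k/2⌋ k = odd-short k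
sharp {h} {k = k} z≤n _ (long _) rewrite ⌊2k/2⌋ k = odd-long h k
-- Here ξ is 2k - 2. With k written as a successor the truncated difference computes to twice its
-- predecessor.
sharp {k = suc k} (s≤s z≤n) _ (short refl) = trans (cong (λ x → (3 + suc k * 2) * 5 + 0 + (x ∸ 2)) (ℕ.*-suc 2 k)) (even-short k)
sharp {h} {k = suc k} (s≤s z≤n) _ (long _) =
  trans (cong (λ x → (2 * h + 1 + suc k * 4) * (2 + (2 * h + 1) + 0) + 0 + (x ∸ 2)) (ℕ.*-suc 2 k)) (even-long h k)

conclusion : ∀ {h δ k P} → 1 ≤ h → δ ≤ 1 → 1 ≤ k → Shape h δ P → RadioTheorem (suc (2 * h + δ)) k
conclusion {h} {δ} {k} {P} 1≤h δ≤1 1≤k shape =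
  radioNumber h δ k P , B.isRadioNumber , value-3 k shape , value-4 k shape
  , (λ 3<n 2∤n → doubled-as-ℤ {radioNumber h δ k P} (value-odd k δ≤1 shape 3<n 2∤n))
  , (λ 4<n 2∣n → doubled-as-ℤ {radioNumber h δ k P} (value-even k δ≤1 shape 4<n 2∣n))
  , attained (trans B.order-≡ (cong (_+ k * (2 + inner shape)) (ℕ.+-suc (2 * h) δ))) B.diam-≡ (ε-≡ δ≤1 B.|weightCenters|)
      (cong (2 *_) (trans B.totalLevel-≡ B.Σ-L))
      (cong₂ ξ-value B.|weightCenters| (trans B.|farVertices| B.Σ-far))
  where
  module B = Balanced h δ k P 1≤h δ≤1 1≤k shape
  ε-≡ : ∀ {d w} → d ≤ 1 → w ≡ suc d → + 2 ℤ.- + w ≡ + (1 ∸ d)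
  ε-≡ z≤n       refl = refl
  ε-≡ (s≤s z≤n) refl = refl
  attained : ∀ {p d e l x} → p ≡ suc (2 * h + δ + k * (2 + inner shape)) → d ≡ 2 + (2 * h + δ) → e ≡ + (1 ∸ δ) →
    l ≡ 2 * (h * suc h + k * (2 * suc h + inner shape * 2)) → x ≡ ξ-value (suc δ) (2 * k) →
    + radioNumber h δ k P ≡ (+ p ℤ.- + 1) ℤ.* (+ d ℤ.+ e) ℤ.- + l ℤ.+ e ℤ.+ + x
  attained refl refl refl refl refl = bound-as-ℤ {2 * h + δ + k * (2 + inner shape)} (sharp δ≤1 1≤k shape)

theorem3p3 : (n k : ℕ) → 3 ≤ n → 1 ≤ k →
  let T = C n k in
  ∃[ r ] (IsRadioNumber T r
    × (n ≡ 3 → r ≡ 3 * k + 7)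
    × (n ≡ 4 → r ≡ 4 * k + 9)
    × (3 < n → ¬ 2 ∣ n →
        + 2 ℤ.* + r ≡ + (n ^ 2 + 4 * n * k + 2 * n) ℤ.- + (2 * k) ℤ.- + 1)
    × (4 < n → 2 ∣ n →
        + 2 ℤ.* + r ≡ + (n ^ 2 + 4 * n * k + 2 * n) ℤ.- + (4 * k) ℤ.- + 6)
    × + r ≡ (+ order T ℤ.- + 1) ℤ.* (+ diam T ℤ.+ ε T)
            ℤ.- + (2 * totalLevel T) ℤ.+ ε T ℤ.+ + ξ T)
theorem3p3 (suc m) k (s≤s 2≤m) 1≤k = subst (λ n → RadioTheorem n k) (cong suc (sym m≡))
  (byShape (ℕ.m≤n⇒m<n∨m≡n 1≤h))
  where
  h = m / 2
  δ = m % 2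
  1≤h : 1 ≤ h
  1≤h = m≥n⇒m/n>0 2≤m
  δ≤1 : δ ≤ 1
  δ≤1 = s≤s⁻¹ (m%n<n m 2)
  m≡ : m ≡ 2 * h + δ
  m≡ = trans (m≡m%n+[m/n]*n m 2) (trans (ℕ.+-comm δ (h * 2)) (cong (_+ δ) (ℕ.*-comm h 2)))
  byShape : 1 < h ⊎ 1 ≡ h → RadioTheorem (suc (2 * h + δ)) k
  byShape (inj₁ 2≤h) = conclusion 1≤h δ≤1 1≤k (long 2≤h)
  byShape (inj₂ 1≡h) = conclusion 1≤h δ≤1 1≤k (short (sym 1≡h))
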